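{- Let $K$ be a primitive quartic CM field whose real quadratic subfield $K_0$ has class number one. Let $\ell$ be a prime with $\ell\mathcal{O}_{K_0}=\mathfrak{l}_1\mathfrak{l}_2$, where $\mathfrak{l}_1\neq\mathfrak{l}_2$ are primes of norm $\ell$. Let $\mathcal{O}$ be an order in $K$ with locally maximal real multiplication at $\ell$. Then the position of $\mathcal{O}_\ell$ within the lattice of $\mathcal{O}_{K_0}$-orders localized at $\ell$ is given by the valuations $\nu_{\mathfrak{l}_i}(\mathfrak{f}_{\mathcal{O}})$, for $i=1,2$.
   Context: A quartic CM field is primitive if it contains no imaginary quadratic subfield. For an order $\mathcal{O}$ of $K$ or $K_0$, $\mathcal{O}_\ell=\mathcal{O}\otimes\mathbb{Z}_\ell$; an order $\mathcal{O}$ of $K$ has locally maximal real multiplication at $\ell$ if $(\mathcal{O}_{K_0})_\ell\subset\mathcal{O}_\ell$. An $\mathcal{O}_{K_0}$-order is an order of $K$ containing $\mathcal{O}_{K_0}$; the lattice of $\mathcal{O}_{K_0}$-orders localized at $\ell$ consists of the rings $\mathcal{O}'_\ell$ for $\mathcal{O}'$ an $\mathcal{O}_{K_0}$-order, ordered by inclusion. The conductor of $\mathcal{O}$ is $\{x\in\mathcal{O}_K: x\mathcal{O}_K\subset\mathcal{O}\}$, and $\mathfrak{f}_{\mathcal{O}}$ here denotes its intersection with $\mathcal{O}_{K_0}$, which is an ideal of $\mathcal{O}_{K_0}$; $\nu_{\mathfrak{l}_i}$ is the $\mathfrak{l}_i$-adic valuation of ideals of $\mathcal{O}_{K_0}$.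 -}

module Defs where

open import Level using (0ℓ) renaming (suc to lsuc)
open import Algebra.Bundles using (CommutativeRing; Semiring; AbelianGroup)
open import Algebra.Morphism.Structures using (IsRingHomomorphism)
import Algebra.Definitions.RawSemiring as SemiringDefs
open import Data.Nat as ℕ using (ℕ; zero; suc)
open import Data.Integer as ℤ using (ℤ; +_)
open import Data.Integer.Divisibility.Signed
  using (_∣_; divides; ∣m∣n⇒∣m+n; ∣m⇒∣-m)
import Data.Integer.Properties as ℤ
open import Data.Integer.Solver using (module +-*-Solver)
open import Data.Rational as ℚ using (ℚ; 0ℚ; 1ℚ; _/_)
open import Data.Fin using (Fin; toℕ)
open import Data.List using (List; []; _∷_; _++_; [_])
open import Data.List.Relation.Unary.All using (All)
open import Data.Product using (Σ-syntax; ∃-syntax; _×_; _,_; proj₁)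
open import Data.Product.Relation.Binary.Pointwise.NonDependent using (Pointwise)
open import Data.Sum using (_⊎_)
open import Relation.Binary using (Rel)
open import Relation.Binary.Morphism.Structures using (IsOrderIsomorphism)
open import Relation.Binary.PropositionalEquality using (_≡_; refl; sym; subst)
open import Relation.Nullary using (¬_)
open import Relation.Unary using (Pred; _∈_; _∉_; _⊆_; _≐_; _∩_; U)

-- Reals are Cauchy sequences of rationals, two of them being equal when
-- their difference is a null sequence. The field operations of ℂ are
-- the pointwise ones on these representatives.

Seq : Set
Seq = ℕ → ℚ

IsCauchy : Pred Seq 0ℓ
IsCauchy s = ∀ ε → 0ℚ ℚ.< ε →
  ∃[ N ] ∀ m n → N ℕ.≤ m → N ℕ.≤ n → ℚ.∣ s m ℚ.- s n ∣ ℚ.< ε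

IsNull : Pred Seq 0ℓ
IsNull s = ∀ ε → 0ℚ ℚ.< ε → ∃[ N ] ∀ n → N ℕ.≤ n → ℚ.∣ s n ∣ ℚ.< ε

infix 4 _~_
_~_ : Rel Seq 0ℓ
s ~ t = IsNull λ n → s n ℚ.- t n

record ℂ : Set where
  field
    re im     : Seq
    re-cauchy : IsCauchy re
    im-cauchy : IsCauchy im

open ℂ

IsReal : Pred ℂ 0ℓ
IsReal z = IsNull (im z)

-- The inverse limit of the groups ℤ/ℓⁿ; `seq n` represents the residue
-- modulo ℓⁿ.

record ℤAdic (ℓ : ℕ) : Set where
  field
    seq      : ℕ → ℤ
    coherent : ∀ n → + (ℓ ℕ.^ n) ∣ seq (suc n) ℤ.- seq n

open ℤAdic

module _ (ℓ : ℕ) where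

  private
    _∣0 : ∀ i → i ∣ + 0
    i ∣0 = divides (+ 0) refl

    infix 4 _≈_
    _≈_ : Rel (ℤAdic ℓ) 0ℓ
    a ≈ b = ∀ n → + (ℓ ℕ.^ n) ∣ seq a n ℤ.- seq b n

    ≡⇒≈ : ∀ {a b} → (∀ n → seq a n ≡ seq b n) → a ≈ b
    ≡⇒≈ {a} {b} eq n = subst (_ ∣_) (sym (ℤ.i≡j⇒i-j≡0 (eq n))) (_ ∣0)

    minus-+ : ∀ i j k l → (i ℤ.- j) ℤ.+ (k ℤ.- l) ≡ (i ℤ.+ k) ℤ.- (j ℤ.+ l)
    minus-+ = solve 4 (λ i j k l →
      (i :- j) :+ (k :- l) := (i :+ k) :- (j :+ l)) refl
      where open +-*-Solver

    minus-neg : ∀ i j → ℤ.- (i ℤ.- j) ≡ (ℤ.- i) ℤ.- (ℤ.- j)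
    minus-neg = solve 2 (λ i j → :- (i :- j) := (:- i) :- (:- j)) refl
      where open +-*-Solver

    minus-sym : ∀ i j → ℤ.- (i ℤ.- j) ≡ j ℤ.- i
    minus-sym = solve 2 (λ i j → :- (i :- j) := j :- i) refl
      where open +-*-Solver

    minus-trans : ∀ i j k → (i ℤ.- j) ℤ.+ (j ℤ.- k) ≡ i ℤ.- k
    minus-trans = solve 3 (λ i j k → (i :- j) :+ (j :- k) := i :- k) refl
      where open +-*-Solver

    _+ₗ_ : ℤAdic ℓ → ℤAdic ℓ → ℤAdic ℓ
    seq      (a +ₗ b) n = seq a n ℤ.+ seq b n
    coherent (a +ₗ b) n = subst (_ ∣_) (minus-+ (seq a (suc n)) _ _ _)
      (∣m∣n⇒∣m+n (coherent a n) (coherent b n))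

    -ₗ_ : ℤAdic ℓ → ℤAdic ℓ
    seq      (-ₗ a) n = ℤ.- seq a n
    coherent (-ₗ a) n = subst (_ ∣_) (minus-neg (seq a (suc n)) _)
      (∣m⇒∣-m (coherent a n))

    0ₗ : ℤAdic ℓ
    seq      0ₗ _ = + 0
    coherent 0ₗ _ = _ ∣0

  ℤAdic-abelianGroup : AbelianGroup 0ℓ 0ℓ
  ℤAdic-abelianGroup = record
    { Carrier = ℤAdic ℓ
    ; _≈_ = _≈_
    ; _∙_ = _+ₗ_
    ; ε   = 0ₗ
    ; _⁻¹ = -ₗ_
    ; isAbelianGroup = record
      { isGroup = record
        { isMonoid = record
          { isSemigroup = record
            { isMagma = record
              { isEquivalence = record
                { refl  = λ {a} → ≡⇒≈ {a} {a} λ _ → refl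
                ; sym   = λ {a} {b} p n →
                    subst (_ ∣_) (minus-sym (seq a n) _) (∣m⇒∣-m (p n))
                ; trans = λ {a} p q n →
                    subst (_ ∣_) (minus-trans (seq a n) _ _) (∣m∣n⇒∣m+n (p n) (q n))
                }
              ; ∙-cong = λ {a} p q n →
                  subst (_ ∣_) (minus-+ (seq a n) _ _ _) (∣m∣n⇒∣m+n (p n) (q n))
              }
            ; assoc = λ a b c → ≡⇒≈ {(a +ₗ b) +ₗ c} {a +ₗ (b +ₗ c)}
                λ n → ℤ.+-assoc (seq a n) _ _
            }
          ; identity = (λ a → ≡⇒≈ {0ₗ +ₗ a} {a} λ n → ℤ.+-identityˡ _)
                     , (λ a → ≡⇒≈ {a +ₗ 0ₗ} {a} λ n → ℤ.+-identityʳ _)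
          }
        ; inverse = (λ a → ≡⇒≈ {(-ₗ a) +ₗ a} {0ₗ} λ n → ℤ.+-inverseˡ (seq a n))
                  , (λ a → ≡⇒≈ {a +ₗ (-ₗ a)} {0ₗ} λ n → ℤ.+-inverseʳ (seq a n))
        ; ⁻¹-cong = λ {a} p n →
            subst (_ ∣_) (minus-neg (seq a n) _) (∣m⇒∣-m (p n))
        }
      ; comm = λ a b → ≡⇒≈ {a +ₗ b} {b +ₗ a} λ n → ℤ.+-comm (seq a n) _
      }
    }

module Tensor (A B : AbelianGroup 0ℓ 0ℓ) where

  private
    module A = AbelianGroup A
    module B = AbelianGroup B

  -- A list stands for the sum of the pure tensors a ⊗ b of its entries.
  A⊗B : Set
  A⊗B = List (A.Carrier × B.Carrier)

  -- Negatives need no constructor: by biadditivity and ⊗-zeroˡ, the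
  -- pure tensor (- a) ⊗ b is the opposite of a ⊗ b.
  infix 4 _≋_
  data _≋_ : Rel A⊗B 0ℓ where
    ≋-refl  : ∀ {s} → s ≋ s
    ≋-sym   : ∀ {s t} → s ≋ t → t ≋ s
    ≋-trans : ∀ {s t u} → s ≋ t → t ≋ u → s ≋ u
    ++-cong : ∀ {s s′ t t′} → s ≋ s′ → t ≋ t′ → s ++ t ≋ s′ ++ t′
    ++-comm : ∀ s t → s ++ t ≋ t ++ s
    ⊗-cong  : ∀ {a a′ b b′} → a A.≈ a′ → b B.≈ b′ → [ a , b ] ≋ [ a′ , b′ ]
    ⊗-addˡ  : ∀ a a′ b → [ a A.∙ a′ , b ] ≋ (a , b) ∷ [ a′ , b ]
    ⊗-addʳ  : ∀ a b b′ → [ a , b B.∙ b′ ] ≋ (a , b) ∷ [ a , b′ ]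
    ⊗-zeroˡ : ∀ b → [ A.ε , b ] ≋ []

record CharZeroField : Set (lsuc 0ℓ) where
  field
    commutativeRing : CommutativeRing 0ℓ 0ℓ

  open CommutativeRing commutativeRing public

  field
    1≉0     : ¬ 1# ≈ 0#
    inverse : ∀ x → ¬ x ≈ 0# → ∃[ y ] x * y ≈ 1#
    ι       : ℚ → Carrier
    ι-isRingHomomorphism : IsRingHomomorphism ℚ.+-*-rawRing rawRing ι

  open SemiringDefs (Semiring.rawSemiring semiring) public using (sum; _^_)

  fromℤ : ℤ → Carrier
  fromℤ z = ι (z / 1)

module FieldTheory (K : CharZeroField) where

  open CharZeroField K

  Subset : Set₁
  Subset = Pred Carrier 0ℓ

  record IsSubring (S : Subset) : Set where
    field
      resp : ∀ {x y} → x ≈ y → x ∈ S → y ∈ S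
      has0 : 0# ∈ S
      has1 : 1# ∈ S
      has+ : ∀ {x y} → x ∈ S → y ∈ S → x + y ∈ S
      has- : ∀ {x} → x ∈ S → - x ∈ S
      has* : ∀ {x y} → x ∈ S → y ∈ S → x * y ∈ S

  record IsSubfield (F : Subset) : Set where
    field
      isSubring : IsSubring F
      hasInv    : ∀ {x y} → x ∈ F → x * y ≈ 1# → y ∈ F

  record IsℚBasis (F : Subset) {n : ℕ} (b : Fin n → Carrier) : Set where
    field
      inside      : ∀ i → b i ∈ F
      spanning    : ∀ {x} → x ∈ F → Σ[ q ∈ (Fin n → ℚ) ] x ≈ sum λ i → ι (q i) * b i
      independent : ∀ (q : Fin n → ℚ) → sum (λ i → ι (q i) * b i) ≈ 0# → ∀ i → q i ≡ 0ℚ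

  HasDegree : Subset → ℕ → Set
  HasDegree F n = ∃[ b ] IsℚBasis F {n} b

  record IsComplexEmbedding (F : Subset) (φ : ∀ x → x ∈ F → ℂ) : Set where
    field
      cong-re : ∀ {x y} p q → x ≈ y → re (φ x p) ~ re (φ y q)
      cong-im : ∀ {x y} p q → x ≈ y → im (φ x p) ~ im (φ y q)
      1-re    : ∀ p → re (φ 1# p) ~ λ _ → 1ℚ
      1-im    : ∀ p → im (φ 1# p) ~ λ _ → 0ℚ
      +-re    : ∀ {x y} p q r → re (φ (x + y) r) ~
                λ n → re (φ x p) n ℚ.+ re (φ y q) n
      +-im    : ∀ {x y} p q r → im (φ (x + y) r) ~
                λ n → im (φ x p) n ℚ.+ im (φ y q) n
      *-re    : ∀ {x y} p q r → re (φ (x * y) r) ~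
                λ n → re (φ x p) n ℚ.* re (φ y q) n ℚ.- im (φ x p) n ℚ.* im (φ y q) n
      *-im    : ∀ {x y} p q r → im (φ (x * y) r) ~
                λ n → re (φ x p) n ℚ.* im (φ y q) n ℚ.+ im (φ x p) n ℚ.* re (φ y q) n

  HasRealImage : (F : Subset) → (∀ x → x ∈ F → ℂ) → Set
  HasRealImage F φ = ∀ x p → IsReal (φ x p)

  TotallyReal : Subset → Set
  TotallyReal F = ∀ φ → IsComplexEmbedding F φ → HasRealImage F φ

  TotallyImaginary : Subset → Set
  TotallyImaginary F = ∀ φ → IsComplexEmbedding F φ → ¬ HasRealImage F φ

  -- [K : K₀] = 2 follows from the two degrees over ℚ.
  record IsQuarticCM (K₀ : Subset) : Set where
    field
      degree           : HasDegree U 4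
      totallyImaginary : TotallyImaginary U
      K₀-isSubfield    : IsSubfield K₀
      K₀-degree        : HasDegree K₀ 2
      K₀-totallyReal   : TotallyReal K₀

  IsPrimitive : Set₁
  IsPrimitive = ¬ (Σ[ F ∈ Subset ]
    IsSubfield F × HasDegree F 2 × TotallyImaginary F)

  IsIntegral : Subset
  IsIntegral x = ∃[ n ] Σ[ c ∈ (Fin n → ℤ) ]
    x ^ n + sum (λ i → fromℤ (c i) * x ^ toℕ i) ≈ 0#

  𝒪 : Subset → Subset
  𝒪 F = IsIntegral ∩ F

  ℤSpan : ∀ {n} → (Fin n → Carrier) → Subset
  ℤSpan {n} b x = Σ[ c ∈ (Fin n → ℤ) ] x ≈ sum λ i → fromℤ (c i) * b i

  record IsOrder (O : Subset) : Set where
    field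
      isSubring : IsSubring O
      lattice   : ∃[ n ] Σ[ b ∈ (Fin n → Carrier) ] IsℚBasis U b × O ≐ ℤSpan b

  conductor : Subset → Subset
  conductor O x = x ∈ 𝒪 U × (∀ y → y ∈ 𝒪 U → x * y ∈ O)

  module Ideals (F : Subset) where

    record IsIdeal (I : Subset) : Set where
      field
        resp   : ∀ {x y} → x ≈ y → x ∈ I → y ∈ I
        inside : I ⊆ 𝒪 F
        has0   : 0# ∈ I
        has+   : ∀ {x y} → x ∈ I → y ∈ I → x + y ∈ I
        absorb : ∀ {r x} → r ∈ 𝒪 F → x ∈ I → r * x ∈ I

    IsNonzero : Subset → Set
    IsNonzero I = ∃[ x ] x ∈ I × ¬ x ≈ 0#

    infixl 7 _·_
    _·_ : Subset → Subset → Subset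
    (I · J) x = ∃[ n ] Σ[ a ∈ (Fin n → Carrier) ] Σ[ b ∈ (Fin n → Carrier) ]
      (∀ i → a i ∈ I) × (∀ i → b i ∈ J) × x ≈ sum λ i → a i * b i

    power : Subset → ℕ → Subset
    power I zero    = 𝒪 F
    power I (suc n) = I · power I n

    multiples : Carrier → Subset → Subset
    multiples a I x = ∃[ y ] y ∈ I × x ≈ a * y

    -- Any two nonzero ideals lie in the same ideal class. Ideals being
    -- arbitrary predicates, this has classical force: a generator of the
    -- ideal of all x with x ∈ 2 𝒪 F or (P and x ∈ 𝒪 F) decides P : Set.
    ClassNumberOne : Set₁
    ClassNumberOne = ∀ I J → IsIdeal I → IsIdeal J → IsNonzero I → IsNonzero J →
      ∃[ a ] ∃[ b ] a ∈ 𝒪 F × b ∈ 𝒪 F × ¬ a ≈ 0# × ¬ b ≈ 0# ×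
        multiples a I ≐ multiples b J

    record IsPrimeIdeal (P : Subset) : Set where
      field
        isIdeal : IsIdeal P
        proper  : 1# ∉ P
        prime   : ∀ {x y} → x ∈ 𝒪 F → y ∈ 𝒪 F → x * y ∈ P → x ∈ P ⊎ y ∈ P

    -- The quotient of 𝒪 F by I has exactly N elements, represented by r.
    HasNorm : Subset → ℕ → Set
    HasNorm I N = Σ[ r ∈ (Fin N → Carrier) ]
      (∀ i → r i ∈ 𝒪 F) ×
      (∀ {x} → x ∈ 𝒪 F → ∃[ i ] x - r i ∈ I) ×
      (∀ {i j} → r i - r j ∈ I → i ≡ j)

    _Divides_ : Subset → Subset → Set₁
    I Divides J = Σ[ C ∈ Subset ] IsIdeal C × J ≐ I · C

    -- ν_P(I) = n. The zero ideal has no valuation in this sense.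
    HasValuation : Subset → Subset → ℕ → Set₁
    HasValuation P I n = power P n Divides I × ¬ power P (suc n) Divides I

  module Localization (ℓ : ℕ) where

    open Tensor +-abelianGroup (ℤAdic-abelianGroup ℓ) public
      renaming (A⊗B to K⊗ℤₗ)

    -- S ⊗ ℤ_ℓ for an additive subgroup S of K, regarded as a subset of
    -- K ⊗ ℤ_ℓ (= K ⊗ ℚ_ℓ); nothing is lost, since ℤ_ℓ is flat over ℤ.
    localize : Subset → Pred K⊗ℤₗ 0ℓ
    localize S t = ∃[ s ] All (λ p → proj₁ p ∈ S) s × t ≋ s

    HasLocallyMaximalRM : Subset → Subset → Set
    HasLocallyMaximalRM K₀ O = localize (𝒪 K₀) ⊆ localize O

    -- An element of the lattice of localized orders is given by an
    -- 𝒪 K₀-order; two 𝒪 K₀-orders with the same localization at ℓ give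
    -- the same element.
    record OverOrder (K₀ : Subset) : Set₁ where
      field
        order    : Subset
        isOrder  : IsOrder order
        contains : 𝒪 K₀ ⊆ order

    module _ {K₀ : Subset} where

      open OverOrder

      infix 4 _≈ₗ_ _≤ₗ_

      _≈ₗ_ : Rel (OverOrder K₀) 0ℓ
      X ≈ₗ Y = localize (order X) ≐ localize (order Y)

      _≤ₗ_ : Rel (OverOrder K₀) 0ℓ
      X ≤ₗ Y = localize (order X) ⊆ localize (order Y)

  module _ (K₀ : Subset) where

    open Ideals K₀

    𝔣 : Subset → Subset
    𝔣 O = conductor O ∩ 𝒪 K₀

    HasValuations : (𝔩₁ 𝔩₂ : Subset) → Subset → ℕ × ℕ → Set₁
    HasValuations 𝔩₁ 𝔩₂ I (n₁ , n₂) = HasValuation 𝔩₁ I n₁ × HasValuation 𝔩₂ I n₂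

    module _ (ℓ : ℕ) where

      open Localization ℓ
      open OverOrder

      -- The pair of valuations of 𝔣 is a system of coordinates on the
      -- lattice, i.e. an isomorphism onto ℕ × ℕ (larger rings having
      -- smaller valuations), and the localization of O is the element of
      -- the lattice with coordinates the valuations of 𝔣 O.
      PositionGivenByValuations : (𝔩₁ 𝔩₂ O : Subset) → Set₁
      PositionGivenByValuations 𝔩₁ 𝔩₂ O =
        Σ[ pos ∈ (OverOrder K₀ → ℕ × ℕ) ]
          (∀ X → HasValuations 𝔩₁ 𝔩₂ (𝔣 (order X)) (pos X)) ×
          IsOrderIsomorphism _≈ₗ_ _≡_ _≤ₗ_ (Pointwise ℕ._≥_ ℕ._≥_) pos ×
          (Σ[ X ∈ OverOrder K₀ ]
            localize (order X) ≐ localize O × HasValuations 𝔩₁ 𝔩₂ (𝔣 O) (pos X))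

{-# OPTIONS --safe #-}
-- ClassNumberOne decides every P : Set, so the argument is classical. Both
-- ℚ ⊂ K₀ and K₀ ⊂ K are quadratic extensions F ⊂ L whose base has a
-- principal ring of integers, so 𝒪 L = 𝒪 F ⊕ ω 𝒪 F for some ω. A ring between
-- 𝒪 K₀ and 𝒪 K which is not contained in K₀ is then 𝒪 K₀ ⊕ f ω 𝒪 K₀, where f
-- generates its 𝔣, and conversely each f ≉ 0 gives such an order. An element
-- x ∈ K satisfies x ⊗ 1 ∈ S ⊗ ℤ_ℓ exactly when m x ∈ S for some m prime to ℓ.
-- So the localization of the order of f contains that of the order of g
-- exactly when f divides m g for some m prime to ℓ, i.e. when f has the
-- smaller valuations at the generators π₁ and π₂ of 𝔩₁ and 𝔩₂, as π₁ π₂ is ℓ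
-- up to a unit.
module Submission where

open import Defs
open import Level using (0ℓ)
open import Algebra.Bundles using (AbelianGroup; RawRing)
open import Algebra.Morphism.Structures using (IsRingHomomorphism)
import Algebra.Solver.Ring as RingSolver
open import Algebra.Solver.Ring.AlmostCommutativeRing
  using (fromCommutativeRing; _-Raw-AlmostCommutative⟶_)
import Algebra.Properties.Semiring.Sum as SemiringSum
import Algebra.Properties.Ring as RingProperties
open import Data.Empty using (⊥-elim)
open import Data.Nat as ℕ using (ℕ; zero; suc)
import Data.Nat.Properties as ℕ
import Data.Nat.Induction as ℕ
open import Induction.WellFounded using (Acc; acc)
import Data.Nat.Divisibility as ℕ
import Data.Nat.Coprimality as ℕ
import Data.Nat.GCD as ℕ
open import Data.Nat.Primality
  using (Prime; euclidsLemma; prime⇒irreducible; prime⇒nonZero; prime⇒nonTrivial)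
open import Data.Integer as ℤ using (ℤ; +_; -[1+_])
import Data.Integer.Properties as ℤ
import Data.Integer.DivMod as ℤ
open import Data.Integer.Divisibility.Signed using (_∣_; divides; ∣m∣n⇒∣m+n; ∣n⇒∣m*n)
open import Data.Integer.Solver using () renaming (module +-*-Solver to ℤS)
open import Data.List using ([]; _∷_; _++_; [_])
open import Data.List.Relation.Unary.All using (All; []; _∷_)
open import Data.Rational as ℚ using (ℚ; 0ℚ; 1ℚ)
import Data.Rational.Properties as ℚ
open import Data.Rational.Unnormalised as ℚᵘ using (mkℚᵘ; *≡*)
import Data.Rational.Unnormalised.Properties as ℚᵘ
open import Data.Fin as Fin using (Fin; zero; suc; toℕ)
import Data.Fin.Properties as Fin
import Data.Maybe as Maybe
open import Data.Vec.Functional using (insertAt)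
import Data.Vec.Functional.Properties as Vector
open import Data.Product.Relation.Binary.Pointwise.NonDependent using (Pointwise)
open import Data.Product using (Σ-syntax; ∃-syntax; _×_; _,_; proj₁; proj₂)
open import Data.Sum as Sum using (_⊎_; inj₁; inj₂)
open import Function using (_∘_)
open import Relation.Binary.PropositionalEquality as ≡ using (_≡_)
import Relation.Binary.Reasoning.Setoid as SetoidReasoning
open import Relation.Nullary using (¬_; yes; no; ¬?; dec⇒maybe; decidable-stable)
open import Relation.Unary using (_∈_; _∉_; _⊆_; _≐_; _∩_; U)

-- The given `O` need not contain `𝒪 K₀`; only its localization does. Hence the order that
-- represents it in the lattice is its saturation, the integral elements of `Local O`. As a ring
-- between `𝒪 K₀` and `𝒪 K` the saturation has a finite basis, so a single integer prime to ℓ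
-- carries all of it into `O`, and the two ideals 𝔣 have the same valuations. Unique factorization
-- and norms are replaced by generators of suitable auxiliary ideals: a valuation is finite, and ω
-- exists, because such an ideal is principal. Equality in `K` is not assumed decidable, so
-- integrality is treated through values of polynomials at an element rather than through
-- polynomials. The tensor product is given by generators and relations, so an inclusion of
-- localizations first yields only formal derivations. An inclusion inside `K` is extracted from
-- them by truncating the ℓ-adic coefficients modulo a high power of ℓ.

module FieldProperties (K : CharZeroField) where

  open CharZeroField K hiding (zero)
  open FieldTheory K
  open SemiringSum semiring public
    using (∑-distrib-+; *-distribˡ-sum; sum-remove)
  open RingProperties ring public
    using (-‿distribˡ-*; -‿distribʳ-*; -0#≈0#)
  open SetoidReasoning setoid
  module ι = IsRingHomomorphism ι-isRingHomomorphism

  -- The embeddings of ℤ and ℚ into the field, cancellation and finite sums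

  private
    -- `i / 1` is normalised through a gcd and does not reduce for a variable `i`. Among
    -- unnormalised rationals equality is cross-multiplication, so identities between integers
    -- viewed as fractions are proved there.
    toℚᵘ-/1 : ∀ i → ℚ.toℚᵘ (i ℚ./ 1) ℚᵘ.≃ mkℚᵘ i 0
    toℚᵘ-/1 i = ℚ.toℚᵘ-fromℚᵘ (mkℚᵘ i 0)

    /1-+ : ∀ i j → (i ℤ.+ j) ℚ./ 1 ≡ i ℚ./ 1 ℚ.+ j ℚ./ 1
    /1-+ i j = ℚ.toℚᵘ-injective
      (ℚᵘ.≃-trans (toℚᵘ-/1 (i ℤ.+ j))
      (ℚᵘ.≃-trans (*≡* (≡.cong (ℤ._* + 1) (≡.sym (≡.cong₂ ℤ._+_ (ℤ.*-identityʳ i) (ℤ.*-identityʳ j)))))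
      (ℚᵘ.≃-trans (ℚᵘ.≃-sym (ℚᵘ.+-cong (toℚᵘ-/1 i) (toℚᵘ-/1 j)))
                  (ℚᵘ.≃-sym (ℚ.toℚᵘ-homo-+ (i ℚ./ 1) (j ℚ./ 1))))))

    /1-* : ∀ i j → (i ℤ.* j) ℚ./ 1 ≡ (i ℚ./ 1) ℚ.* (j ℚ./ 1)
    /1-* i j = ℚ.toℚᵘ-injective
      (ℚᵘ.≃-trans (toℚᵘ-/1 (i ℤ.* j))
      (ℚᵘ.≃-trans (ℚᵘ.≃-sym (ℚᵘ.*-cong (toℚᵘ-/1 i) (toℚᵘ-/1 j)))
                  (ℚᵘ.≃-sym (ℚ.toℚᵘ-homo-* (i ℚ./ 1) (j ℚ./ 1)))))

  fromℤ-0 : fromℤ (+ 0) ≈ 0#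
  fromℤ-0 = ι.0#-homo

  fromℤ-1 : fromℤ (+ 1) ≈ 1#
  fromℤ-1 = ι.1#-homo

  fromℤ-+ : ∀ i j → fromℤ (i ℤ.+ j) ≈ fromℤ i + fromℤ j
  fromℤ-+ i j = trans (ι.⟦⟧-cong (/1-+ i j)) (ι.+-homo _ _)

  fromℤ-* : ∀ i j → fromℤ (i ℤ.* j) ≈ fromℤ i * fromℤ j
  fromℤ-* i j = trans (ι.⟦⟧-cong (/1-* i j)) (ι.*-homo _ _)

  fromℤ-pos-* : ∀ m n → fromℤ (+ (m ℕ.* n)) ≈ fromℤ (+ m) * fromℤ (+ n)
  fromℤ-pos-* m n = trans (reflexive (≡.cong fromℤ (ℤ.pos-* m n))) (fromℤ-* (+ m) (+ n))

  +-unique-neg : ∀ {x y} → x + y ≈ 0# → y ≈ - x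
  +-unique-neg {x} {y} p = begin
    y              ≈⟨ +-identityˡ y ⟨
    0# + y         ≈⟨ +-congʳ (-‿inverseˡ x) ⟨
    - x + x + y    ≈⟨ +-assoc _ _ _ ⟩
    - x + (x + y)  ≈⟨ +-congˡ p ⟩
    - x + 0#       ≈⟨ +-identityʳ _ ⟩
    - x            ∎

  fromℤ-neg : ∀ i → fromℤ (ℤ.- i) ≈ - fromℤ i
  fromℤ-neg i = +-unique-neg (begin
    fromℤ i + fromℤ (ℤ.- i)  ≈⟨ fromℤ-+ i (ℤ.- i) ⟨
    fromℤ (i ℤ.- i)          ≡⟨ ≡.cong fromℤ (ℤ.+-inverseʳ i) ⟩
    fromℤ (+ 0)              ≈⟨ fromℤ-0 ⟩
    0#                       ∎)

  fromℤ-morphism : ℤ.+-*-rawRing -Raw-AlmostCommutative⟶ fromCommutativeRing commutativeRing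
  fromℤ-morphism = record
    { ⟦_⟧ = fromℤ ; +-homo = fromℤ-+ ; *-homo = fromℤ-* ; -‿homo = fromℤ-neg
    ; 0-homo = fromℤ-0 ; 1-homo = fromℤ-1 }

  -- Coefficients are integers because normal forms need a test for equality of coefficients, which
  -- `K` does not offer. A literal such as `con (+ 2)` therefore stands for `fromℤ (+ 2)`.
  module Solver = RingSolver ℤ.+-*-rawRing (fromCommutativeRing commutativeRing) fromℤ-morphism
    (λ i j → Maybe.map (λ p → reflexive (≡.cong fromℤ p)) (dec⇒maybe (i ℤ.≟ j)))
  open Solver public using (solve; _:=_; _:+_; _:*_; _:-_; :-_; con)

  -- A nonzero rational has an inverse in ℚ, and its image times the image of that inverse is 1,
  -- which differs from 0.
  ι-0 : ∀ {q} → ι q ≈ 0# → q ≡ 0ℚ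
  ι-0 {q} p with q ℚ.≟ 0ℚ
  ... | yes eq = eq
  ... | no q≢0 = ⊥-elim (1≉0 (begin
    1#                 ≈⟨ ι.1#-homo ⟨
    ι 1ℚ               ≈⟨ ι.⟦⟧-cong (ℚ.*-inverseˡ q) ⟨
    ι (1/q ℚ.* q)      ≈⟨ ι.*-homo _ _ ⟩
    ι 1/q * ι q        ≈⟨ *-congˡ p ⟩
    ι 1/q * 0#         ≈⟨ zeroʳ _ ⟩
    0#                 ∎))
    where
    instance _ = ℚ.≢-nonZero q≢0
    1/q = ℚ.1/ q

  fromℤ-≈0 : ∀ {z} → fromℤ z ≈ 0# → z ≡ + 0
  fromℤ-≈0 {z} p = ≡.trans (≡.sym (ℤ.*-identityʳ z)) (q (ℚᵘ.≃-trans (ℚᵘ.≃-sym (toℚᵘ-/1 z))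
      (ℚᵘ.≃-reflexive (≡.cong ℚ.toℚᵘ (ι-0 p)))))
    where
    q : mkℚᵘ z 0 ℚᵘ.≃ mkℚᵘ (+ 0) 0 → z ℤ.* + 1 ≡ + 0
    q (*≡* e) = e

  fromℤ-≉0 : ∀ {z} → ¬ z ≡ + 0 → ¬ fromℤ z ≈ 0#
  fromℤ-≉0 p q = p (fromℤ-≈0 q)

  x≈y⇒x-y≈0 : ∀ {x y} → x ≈ y → x - y ≈ 0#
  x≈y⇒x-y≈0 e = trans (+-congʳ e) (-‿inverseʳ _)

  x-y≈0⇒x≈y : ∀ {x y} → x - y ≈ 0# → x ≈ y
  x-y≈0⇒x≈y {x} {y} e = begin
    x          ≈⟨ solve 2 (λ x y → x := x :- y :+ y) refl x y ⟩
    x - y + y  ≈⟨ +-congʳ e ⟩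
    0# + y     ≈⟨ +-identityˡ y ⟩
    y          ∎

  cancelˡ-0 : ∀ {x y} → ¬ x ≈ 0# → x * y ≈ 0# → y ≈ 0#
  cancelˡ-0 {x} {y} x≉0 xy≈0 = let x′ , e = inverse x x≉0 in begin
    y             ≈⟨ *-identityˡ y ⟨
    1# * y        ≈⟨ *-congʳ e ⟨
    x * x′ * y    ≈⟨ solve 3 (λ a b c → a :* b :* c := b :* (a :* c)) refl x x′ y ⟩
    x′ * (x * y)  ≈⟨ *-congˡ xy≈0 ⟩
    x′ * 0#       ≈⟨ zeroʳ _ ⟩
    0#            ∎

  cancelˡ : ∀ {x y z} → ¬ x ≈ 0# → x * y ≈ x * z → y ≈ z
  cancelˡ {x} {y} {z} x≉0 e = x-y≈0⇒x≈y (cancelˡ-0 x≉0 (begin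
    x * (y - z)    ≈⟨ solve 3 (λ a b c → a :* (b :- c) := a :* b :- a :* c) refl x y z ⟩
    x * y - x * z  ≈⟨ x≈y⇒x-y≈0 e ⟩
    0#             ∎))

  *-≉0 : ∀ {x y} → ¬ x ≈ 0# → ¬ y ≈ 0# → ¬ x * y ≈ 0#
  *-≉0 x≉0 y≉0 e = y≉0 (cancelˡ-0 x≉0 e)

  ^-≉0 : ∀ {x} n → ¬ x ≈ 0# → ¬ x ^ n ≈ 0#
  ^-≉0 zero    x≉0 = 1≉0
  ^-≉0 (suc n) x≉0 = *-≉0 x≉0 (^-≉0 n x≉0)

  ^-cong : ∀ {x y} n → x ≈ y → x ^ n ≈ y ^ n
  ^-cong zero    e = refl
  ^-cong (suc n) e = *-cong e (^-cong n e)

  ^-+ : ∀ x m n → x ^ (m ℕ.+ n) ≈ x ^ m * x ^ n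
  ^-+ x zero    n = sym (*-identityˡ _)
  ^-+ x (suc m) n = trans (*-congˡ (^-+ x m n)) (sym (*-assoc _ _ _))

  sum-cong : ∀ n {f g : Fin n → Carrier} → (∀ i → f i ≈ g i) → sum f ≈ sum g
  sum-cong zero    p = refl
  sum-cong (suc n) p = +-cong (p zero) (sum-cong n (p ∘ suc))

  sum-≈0 : ∀ n {f : Fin n → Carrier} → (∀ i → f i ≈ 0#) → sum f ≈ 0#
  sum-≈0 zero    p = refl
  sum-≈0 (suc n) p = trans (+-cong (p zero) (sum-≈0 n (p ∘ suc))) (+-identityˡ _)

  sum-+ : ∀ n (f g : Fin n → Carrier) → sum f + sum g ≈ sum (λ i → f i + g i)
  sum-+ n f g = sym (∑-distrib-+ f g)

  *-sum : ∀ n x (f : Fin n → Carrier) → x * sum f ≈ sum (λ i → x * f i)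
  *-sum n = *-distribˡ-sum

  sum-neg : ∀ n (f : Fin n → Carrier) → - sum f ≈ sum (λ i → - f i)
  sum-neg zero    f = -0#≈0#
  sum-neg (suc n) f = trans (solve 2 (λ a b → :- (a :+ b) := :- a :- b)
      refl _ _) (+-congˡ (sum-neg n (f ∘ suc)))

  -- Additive subgroups and spans over ℤ and ℚ

  record IsAdditive (S : Subset) : Set where
    field
      resp : ∀ {x y} → x ≈ y → x ∈ S → y ∈ S
      has0 : 0# ∈ S
      has+ : ∀ {x y} → x ∈ S → y ∈ S → x + y ∈ S
      has- : ∀ {x} → x ∈ S → - x ∈ S

    hasSum : ∀ n {f : Fin n → Carrier} → (∀ i → f i ∈ S) → sum f ∈ S
    hasSum zero    p = has0
    hasSum (suc n) p = has+ (p zero) (hasSum n (p ∘ suc))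

    hasDiff : ∀ {x y} → x ∈ S → y ∈ S → x - y ∈ S
    hasDiff p q = has+ p (has- q)

    hasℕ : ∀ n {x} → x ∈ S → fromℤ (+ n) * x ∈ S
    hasℕ zero    {x} p = resp (sym (trans (*-congʳ fromℤ-0) (zeroˡ x))) has0
    hasℕ (suc n) {x} p = resp (begin
      x + fromℤ (+ n) * x                ≈⟨ solve 2 (λ a x → x :+ a :* x := (con (+ 1) :+ a) :* x) refl _ _ ⟩
      (fromℤ (+ 1) + fromℤ (+ n)) * x    ≈⟨ *-congʳ (fromℤ-+ (+ 1) (+ n)) ⟨
      fromℤ (+ suc n) * x                ∎) (has+ p (hasℕ n p))

    hasℤ : ∀ c {x} → x ∈ S → fromℤ c * x ∈ S
    hasℤ (+ n)    p = hasℕ n p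
    hasℤ -[1+ n ] {x} p = resp (begin
      - (fromℤ (+ suc n) * x)   ≈⟨ -‿distribˡ-* _ _ ⟩
      - fromℤ (+ suc n) * x     ≈⟨ *-congʳ (fromℤ-neg (+ suc n)) ⟨
      fromℤ -[1+ n ] * x        ∎) (has- (hasℕ (suc n) p))

  subringAdditive : ∀ {S} → IsSubring S → IsAdditive S
  subringAdditive r = record { IsSubring r }

  -- Parametrised by the ring map, so that lattices (over ℤ) and dimension counts (over ℚ) share one
  -- theory.
  module Span {A : RawRing 0ℓ 0ℓ} {h : RawRing.Carrier A → Carrier} (hom : IsRingHomomorphism A rawRing h) where

    private
      module A = RawRing A
      C = A.Carrier
      module h = IsRingHomomorphism hom

    -- A record, so that b can be inferred from membership proofs.
    record Spanned {n} (b : Fin n → Carrier) (x : Carrier) : Set where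
      constructor _,_
      field
        coefficients : Fin n → C
        combination  : x ≈ sum λ i → h (coefficients i) * b i

    open Spanned public

    module _ {n} {b : Fin n → Carrier} where

      additive : IsAdditive (Spanned b)
      additive = record
        { resp = λ { e (c , p) → c , trans (sym e) p }
        ; has0 = (λ _ → A.0#) , sym (sum-≈0 n λ i → trans (*-congʳ h.0#-homo) (zeroˡ (b i)))
        ; has+ = λ { {x} {y} (c , p) (d , q) → (λ i → c i A.+ d i) , (begin
            x + y                                          ≈⟨ +-cong p q ⟩
            sum (λ i → h (c i) * b i) + sum (λ i → h (d i) * b i)  ≈⟨ sum-+ n _ _ ⟩
            sum (λ i → h (c i) * b i + h (d i) * b i)      ≈⟨ sum-cong n (λ i → distribʳ (b i) _ _) ⟨
            sum (λ i → (h (c i) + h (d i)) * b i)          ≈⟨ sum-cong n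
                (λ i → *-congʳ {b i} (h.+-homo (c i) (d i))) ⟨
            sum (λ i → h (c i A.+ d i) * b i)              ∎) }
        ; has- = λ { {x} (c , p) → (λ i → A.- c i) , (begin
            - x                                   ≈⟨ -‿cong p ⟩
            - sum (λ i → h (c i) * b i)           ≈⟨ sum-neg n _ ⟩
            sum (λ i → - (h (c i) * b i))         ≈⟨ sum-cong n (λ i → -‿distribˡ-* (h (c i)) (b i)) ⟩
            sum (λ i → - h (c i) * b i)           ≈⟨ sum-cong n (λ i → *-congʳ {b i} (h.-‿homo (c i))) ⟨
            sum (λ i → h (A.- c i) * b i)         ∎) }
        }

      scale : ∀ a {x} → x ∈ Spanned b → h a * x ∈ Spanned b
      scale a {x} (c , p) = (λ i → a A.* c i) , (begin
        h a * x                                 ≈⟨ *-congˡ p ⟩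
        h a * sum (λ i → h (c i) * b i)         ≈⟨ *-sum n (h a) _ ⟩
        sum (λ i → h a * (h (c i) * b i))       ≈⟨ sum-cong n (λ i → *-assoc (h a) (h (c i)) (b i)) ⟨
        sum (λ i → h a * h (c i) * b i)         ≈⟨ sum-cong n (λ i → *-congʳ {b i} (h.*-homo a (c i))) ⟨
        sum (λ i → h (a A.* c i) * b i)         ∎)

      minimal : ∀ {S : Subset} → IsAdditive S → (∀ a {x} → x ∈ S → h a * x ∈ S) →
                (∀ i → b i ∈ S) → ∀ {x} → x ∈ Spanned b → x ∈ S
      minimal add sc p (c , e) = resp (sym e) (hasSum n λ i → sc (c i) (p i))
        where open IsAdditive add

    δ : ∀ {n} → Fin n → Fin n → C
    δ zero    zero    = A.1#
    δ zero    (suc j) = A.0#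
    δ (suc i) zero    = A.0#
    δ (suc i) (suc j) = δ i j

    δ-≡ : ∀ {n} (i : Fin n) → δ i i ≡ A.1#
    δ-≡ zero    = ≡.refl
    δ-≡ (suc i) = δ-≡ i

    δ-≢ : ∀ {n} {i j : Fin n} → ¬ i ≡ j → δ i j ≡ A.0#
    δ-≢ {i = zero}  {zero}  i≢j = ⊥-elim (i≢j ≡.refl)
    δ-≢ {i = zero}  {suc j} i≢j = ≡.refl
    δ-≢ {i = suc i} {zero}  i≢j = ≡.refl
    δ-≢ {i = suc i} {suc j} i≢j = δ-≢ (i≢j ∘ ≡.cong suc)

    sum-δ : ∀ {n} i (b : Fin n → Carrier) → b i ≈ sum (λ j → h (δ i j) * b j)
    sum-δ {suc n} zero b = begin
      b zero                           ≈⟨ +-identityʳ _ ⟨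
      b zero + 0#                      ≈⟨ +-cong (trans (*-congʳ h.1#-homo) (*-identityˡ _))
                                                 (sum-≈0 n λ i → trans (*-congʳ h.0#-homo)
                                                     (zeroˡ (b (suc i)))) ⟨
      sum (λ j → h (δ zero j) * b j)   ∎
    sum-δ {suc n} (suc i) b = begin
      b (suc i)                            ≈⟨ +-identityˡ _ ⟨
      0# + b (suc i)                       ≈⟨ +-cong (sym (trans (*-congʳ h.0#-homo) (zeroˡ (b zero))))
          (sum-δ i (b ∘ suc)) ⟩
      sum (λ j → h (δ (suc i) j) * b j)    ∎

    generator : ∀ {n} (b : Fin n → Carrier) i → b i ∈ Spanned b
    generator b i = δ i , sum-δ i b

  fromℤ-isRingHomomorphism : IsRingHomomorphism ℤ.+-*-rawRing rawRing fromℤ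
  fromℤ-isRingHomomorphism = record
    { isSemiringHomomorphism = record
      { isNearSemiringHomomorphism = record
        { +-isMonoidHomomorphism = record
          { isMagmaHomomorphism = record
            { isRelHomomorphism = record { cong = λ e → reflexive (≡.cong fromℤ e) }
            ; homo = fromℤ-+ }
          ; ε-homo = fromℤ-0 }
        ; *-homo = fromℤ-* }
      ; 1#-homo = fromℤ-1 }
    ; -‿homo = fromℤ-neg }

  module ℤSpan = Span fromℤ-isRingHomomorphism
  module ℚSpan = Span ι-isRingHomomorphism

  -- The induction principle for spans: the x with a x in `S` form an additive subgroup, so
  -- generators suffice. Products of two spans are handled by applying it twice.
  ℤSpan-mul : ∀ {n} {b : Fin n → Carrier} a {S : Subset} → IsAdditive S →
              (∀ i → a * b i ∈ S) → ∀ {x} → x ∈ ℤSpan.Spanned b → a * x ∈ S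
  ℤSpan-mul {b = b} a {S} add gens = ℤSpan.minimal {b = b} {λ x → a * x ∈ S} (record
      { resp = λ e → resp (*-congˡ e)
      ; has0 = resp (sym (zeroʳ a)) has0
      ; has+ = λ p q → resp (sym (distribˡ _ _ _)) (has+ p q)
      ; has- = λ p → resp (-‿distribʳ-* _ _) (has- p)
      })
    (λ c p → resp (solve 3 (λ c a x → c :* (a :* x) := a :* (c :* x)) refl _ _ _) (hasℤ c p)) gens
    where open IsAdditive add

  ℤSpan-min : ∀ {n} {b : Fin n → Carrier} {S : Subset} → IsAdditive S →
              (∀ i → b i ∈ S) → ∀ {x} → x ∈ ℤSpan.Spanned b → x ∈ S
  ℤSpan-min {b = b} add = ℤSpan.minimal {b = b} add (IsAdditive.hasℤ add)

-- Integral elements form a ring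

module Integrality (K : CharZeroField) where

  open CharZeroField K hiding (zero)
  open FieldTheory K
  open FieldProperties K
  open SetoidReasoning setoid

  -- `Low d x` consists of the values at x of integer polynomials of degree below d, and `Monic d x`
  -- of the values of monic ones of degree d. The index carries the degree, which the value alone
  -- does not determine.
  Low : ℕ → Carrier → Subset
  Low d x = ℤSpan.Spanned {d} λ i → x ^ toℕ i

  Monic : ℕ → Carrier → Subset
  Monic d x z = z - x ^ d ∈ Low d x

  Low-additive : ∀ {d x} → IsAdditive (Low d x)
  Low-additive = ℤSpan.additive

  module Low {d x} = IsAdditive (Low-additive {d} {x})

  pow-low : ∀ {d x k} → k ℕ.< d → x ^ k ∈ Low d x
  pow-low {d} {x} k<d = ≡.subst (λ k → x ^ k ∈ Low d x) (Fin.toℕ-fromℕ< k<d)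
    (ℤSpan.generator (λ i → x ^ toℕ i) (Fin.fromℕ< k<d))

  pow*low : ∀ a {b x w} → w ∈ Low b x → x ^ a * w ∈ Low (a ℕ.+ b) x
  pow*low a {b} {x} = ℤSpan-mul (x ^ a) Low-additive
    λ i → Low.resp (^-+ x a (toℕ i)) (pow-low (ℕ.+-monoʳ-< a (Fin.toℕ<n i)))

  low*low : ∀ {a b x z w} → z ∈ Low a x → w ∈ Low b x → z * w ∈ Low (a ℕ.+ b) x
  low*low {a} {b} {x} {z} p = ℤSpan-mul z Low-additive
    λ j → Low.resp (*-comm _ _) (ℤSpan-mul (x ^ toℕ j) Low-additive
      (λ i → Low.resp (^-+ x (toℕ j) (toℕ i)) (pow-low (≡.subst (ℕ._< a ℕ.+ b) (ℕ.+-comm (toℕ i) (toℕ j))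
         (ℕ.+-mono-< (Fin.toℕ<n i) (Fin.toℕ<n j))))) p)

  monic*monic : ∀ {a b x z w} → z ∈ Monic a x → w ∈ Monic b x → z * w ∈ Monic (a ℕ.+ b) x
  monic*monic {a} {b} {x} {z} {w} p q = Low.resp (begin
      (z - x ^ a) * (w - x ^ b) + (x ^ b * (z - x ^ a) + x ^ a * (w - x ^ b))
        ≈⟨ solve 4 (λ z w s t → (z :- s) :* (w :- t) :+ (t :* (z :- s) :+ s :* (w :- t)) := z :* w :- s :* t)
             refl z w (x ^ a) (x ^ b) ⟩
      z * w - x ^ a * x ^ b     ≈⟨ +-congˡ (-‿cong (^-+ x a b)) ⟨
      z * w - x ^ (a ℕ.+ b)     ∎)
    (Low.has+ (low*low {a} p q) (Low.has+ (≡.subst (λ d → x ^ b * (z - x ^ a) ∈ Low d x) (ℕ.+-comm b a)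
        (pow*low b p)) (pow*low a q)))

  monic-low : ∀ {d x z w} → z ∈ Monic d x → w ∈ Low d x → z - w ∈ Monic d x
  monic-low {d} {x} {z} {w} p q = Low.resp
    (solve 3 (λ z w s → z :- s :- w := z :- w :- s) refl z w (x ^ d)) (Low.hasDiff p q)

  -- Fraction-free elimination keeps the diagonal of the matrix monic of a
  -- common degree and the other entries of lower degree; this replaces the
  -- determinant of the Cayley–Hamilton argument.
  annihilator : ∀ n {d x} (B : Fin n → Fin n → Carrier) (m : Fin n → Carrier) →
    (∀ i → B i i ∈ Monic d x) → (∀ {i j} → ¬ i ≡ j → B i j ∈ Low d x) →
    (∀ i → sum (λ j → B i j * m j) ≈ 0#) →
    ∃[ D ] ∃[ p ] p ∈ Monic D x × (∀ i → p * m i ≈ 0#)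
  annihilator zero    B m _ _ _ = 0 , 1# , Low.resp (sym (-‿inverseʳ 1#)) Low.has0 , λ ()
  annihilator (suc n) {d} {x} B m diag off rel = D ℕ.+ d , p * b , monic*monic pm (diag zero) , kills
    where
    b = B zero zero

    B′ : Fin n → Fin n → Carrier
    B′ i j = b * B (suc i) (suc j) - B (suc i) zero * B zero (suc j)

    diag′ : ∀ i → B′ i i ∈ Monic (d ℕ.+ d) x
    diag′ i = monic-low {z = b * B (suc i) (suc i)} (monic*monic (diag zero) (diag (suc i)))
      (low*low {d} (off λ ()) (off λ ()))

    off′ : ∀ {i j} → ¬ i ≡ j → B′ i j ∈ Low (d ℕ.+ d) x
    -- The pivot b is monic, not low. Its leading power x ^ d is split off; times a low entry this
    -- still has degree below d + d.
    off′ {i} {j} i≢j = Low.resp (solve 4 (λ b c e s → (b :- s) :* c :+ s :* c :- e := b :* c :- e)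
          refl b (B (suc i) (suc j)) _ (x ^ d))
        (Low.hasDiff (Low.has+ (low*low {d} (diag zero) (off (i≢j ∘ Fin.suc-injective)))
                               (pow*low d (off (i≢j ∘ Fin.suc-injective))))
                     (low*low {d} (off {suc i} {zero} λ ()) (off {zero} {suc j} λ ())))

    rest : Fin (suc n) → Carrier
    rest i = sum λ j → B i (suc j) * m (suc j)

    rel′ : ∀ i → sum (λ j → B′ i j * m (suc j)) ≈ 0#
    rel′ i = begin
      sum (λ j → B′ i j * m (suc j))
        ≈⟨ sum-cong n (λ j → solve 5 (λ b c e f m → (b :* c :- e :* f) :* m := b :* (c :* m) :+ (:- e) :*
            (f :* m))
             refl b (B (suc i) (suc j)) (B (suc i) zero) (B zero (suc j)) (m (suc j))) ⟩
      sum (λ j → b * (B (suc i) (suc j) * m (suc j)) + - c * (B zero (suc j) * m (suc j)))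
        ≈⟨ sum-+ n _ _ ⟨
      sum (λ j → b * (B (suc i) (suc j) * m (suc j))) + sum (λ j → - c * (B zero (suc j) * m (suc j)))
        ≈⟨ +-cong (*-sum n b _) (*-sum n (- c) _) ⟨
      b * rest (suc i) + - c * rest zero
        ≈⟨ solve 5 (λ b c s t m → b :* s :+ (:- c) :* t := b :* (c :* m :+ s) :- c :* (b :* m :+ t))
             refl b c (rest (suc i)) (rest zero) (m zero) ⟩
      b * (c * m zero + rest (suc i)) - c * (b * m zero + rest zero)
        ≈⟨ +-cong (*-congˡ (rel (suc i))) (-‿cong (*-congˡ (rel zero))) ⟩
      b * 0# - c * 0#
        ≈⟨ +-cong (zeroʳ b) (trans (-‿cong (zeroʳ c)) -0#≈0#) ⟩
      0# + 0#
        ≈⟨ +-identityˡ 0# ⟩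
      0# ∎
      where c = B (suc i) zero

    ih = annihilator n B′ (m ∘ suc) diag′ off′ rel′
    D  = proj₁ ih
    p  = proj₁ (proj₂ ih)
    pm = proj₁ (proj₂ (proj₂ ih))
    pk = proj₂ (proj₂ (proj₂ ih))

    kills : ∀ i → p * b * m i ≈ 0#
    -- By induction p kills all later entries, and the first relation expresses b * m zero through
    -- those.
    kills zero = begin
      p * b * m zero
        ≈⟨ solve 4 (λ p b m t → p :* b :* m := p :* (b :* m :+ t) :- p :* t) refl p b (m zero) (rest zero) ⟩
      p * (b * m zero + rest zero) - p * rest zero
        ≈⟨ +-cong (trans (*-congˡ (rel zero)) (zeroʳ p)) (-‿cong (trans (*-sum n p _) (sum-≈0 n λ j → begin
             p * (B zero (suc j) * m (suc j))  ≈⟨ solve 3 (λ p b m → p :* (b :* m) := b :* (p :* m))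
                 refl p _ _ ⟩
             B zero (suc j) * (p * m (suc j))  ≈⟨ *-congˡ (pk j) ⟩
             B zero (suc j) * 0#               ≈⟨ zeroʳ _ ⟩
             0#                                ∎))) ⟩
      0# - 0#   ≈⟨ -‿inverseʳ 0# ⟩
      0#        ∎
    kills (suc j) = begin
      p * b * m (suc j)    ≈⟨ solve 3 (λ p b m → p :* b :* m := b :* (p :* m)) refl p b (m (suc j)) ⟩
      b * (p * m (suc j))  ≈⟨ *-congˡ (pk j) ⟩
      b * 0#               ≈⟨ zeroʳ b ⟩
      0#                   ∎

  low⇒integral : ∀ {n x} → x ^ n ∈ Low n x → IsIntegral x
  low⇒integral {n} {x} p = let c ℤSpan., e = Low.has- p in n , c , trans (+-congˡ (sym e)) (-‿inverseʳ (x ^ n))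

  integral⇒low : ∀ {x} → IsIntegral x → ∃[ n ] x ^ n ∈ Low n x
  integral⇒low {x} (n , c , e) = n , Low.resp (begin
      - sum (λ i → fromℤ (c i) * x ^ toℕ i)      ≈⟨ -‿cong (+-unique-neg e) ⟩
      - - (x ^ n)                                ≈⟨ solve 1 (λ a → :- :- a := a) refl _ ⟩
      x ^ n                                      ∎) (Low.has- (c ℤSpan., refl))

  monic-root : ∀ {D x p} → p ∈ Monic D x → p ≈ 0# → IsIntegral x
  monic-root {D} {x} {p} m e = low⇒integral {D} (Low.resp (begin
      - (p - x ^ D)  ≈⟨ solve 2 (λ p s → :- (p :- s) := s :- p) refl p _ ⟩
      x ^ D - p      ≈⟨ +-congˡ (trans (-‿cong e) -0#≈0#) ⟩
      x ^ D + 0#     ≈⟨ +-identityʳ _ ⟩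
      x ^ D          ∎) (Low.has- m))

  -- The determinant trick: x acts on the span by an integer matrix `A`, and the rows of x I - A
  -- annihilate the vector m. Elimination yields the value at x of a monic polynomial that kills
  -- every m i, hence kills 1, hence is 0.
  stable⇒integral : ∀ {n x} (m : Fin n → Carrier) → 1# ∈ ℤSpan.Spanned m →
    (∀ i → x * m i ∈ ℤSpan.Spanned m) → IsIntegral x
  stable⇒integral {n} {x} m 1∈ st = monic-root pm
      (trans (sym (*-identityʳ p)) (ℤSpan-mul p zero-additive pk 1∈))
    where
    A : Fin n → Fin n → ℤ
    A i = ℤSpan.coefficients (st i)

    B : Fin n → Fin n → Carrier
    B i j = fromℤ (ℤSpan.δ i j) * x - fromℤ (A i j)

    constant : ∀ z → fromℤ z ∈ Low 1 x
    constant z = Low.resp (*-identityʳ _) (Low.hasℤ z (pow-low {k = 0} (ℕ.s≤s ℕ.z≤n)))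

    diag : ∀ i → B i i ∈ Monic 1 x
    diag i = Low.resp (begin
      - fromℤ (A i i)                                     ≈⟨ solve 2
          (λ x a → :- a := con (+ 1) :* x :- a :- x) refl x _ ⟩
      fromℤ (+ 1) * x - fromℤ (A i i) - x                 ≈⟨ +-cong
          (+-congʳ (*-congʳ (reflexive (≡.cong fromℤ (≡.sym (ℤSpan.δ-≡ i))))))
                                                               (-‿cong (sym (*-identityʳ x))) ⟩
      B i i - x * 1#                                      ∎) (Low.has- (constant (A i i)))

    off : ∀ {i j} → ¬ i ≡ j → B i j ∈ Low 1 x
    off {i} {j} i≢j = Low.resp (begin
      - fromℤ (A i j)                     ≈⟨ solve 2 (λ x a → :- a := con (+ 0) :* x :- a) refl x _ ⟩
      fromℤ (+ 0) * x - fromℤ (A i j)     ≈⟨ +-congʳ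
          (*-congʳ (reflexive (≡.cong fromℤ (≡.sym (ℤSpan.δ-≢ i≢j))))) ⟩
      B i j                               ∎) (Low.has- (constant (A i j)))

    rel : ∀ i → sum (λ j → B i j * m j) ≈ 0#
    rel i = begin
      sum (λ j → B i j * m j)
        ≈⟨ sum-cong n (λ j → solve 4 (λ d x a m → (d :* x :- a) :* m := x :* (d :* m) :+ :- (a :* m))
             refl (fromℤ (ℤSpan.δ i j)) x (fromℤ (A i j)) (m j)) ⟩
      sum (λ j → x * (fromℤ (ℤSpan.δ i j) * m j) + - (fromℤ (A i j) * m j))
        ≈⟨ sum-+ n _ _ ⟨
      sum (λ j → x * (fromℤ (ℤSpan.δ i j) * m j)) + sum (λ j → - (fromℤ (A i j) * m j))
        ≈⟨ +-cong (*-sum n x _) (sum-neg n _) ⟨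
      x * sum (λ j → fromℤ (ℤSpan.δ i j) * m j) - sum (λ j → fromℤ (A i j) * m j)
        ≈⟨ +-cong (*-congˡ (ℤSpan.sum-δ i m)) (-‿cong (ℤSpan.combination (st i))) ⟨
      x * m i - x * m i
        ≈⟨ -‿inverseʳ _ ⟩
      0# ∎

    killed = annihilator n B m diag off rel
    p  = proj₁ (proj₂ killed)
    pm = proj₁ (proj₂ (proj₂ killed))
    pk = proj₂ (proj₂ (proj₂ killed))

    zero-additive : IsAdditive (_≈ 0#)
    zero-additive = record
      { resp = λ e q → trans (sym e) q ; has0 = refl
      ; has+ = λ q r → trans (+-cong q r) (+-identityˡ 0#)
      ; has- = λ q → trans (-‿cong q) -0#≈0# }

  pow∈low : ∀ {n x} → x ^ n ∈ Low n x → ∀ k → x ^ k ∈ Low n x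
  -- In degree 0 the hypothesis already reads 1 ∈ `Low 0 x`, which is the claim.
  pow∈low {zero}  p zero    = p
  pow∈low {suc n} p zero    = pow-low {k = 0} (ℕ.s≤s ℕ.z≤n)
  pow∈low {n} {x} p (suc k) = ℤSpan-mul x Low-additive
    step (pow∈low p k)
    where
    step : ∀ i → x ^ suc (toℕ i) ∈ Low n x
    step i with ℕ.m≤n⇒m<n∨m≡n (Fin.toℕ<n i)
    ... | inj₁ lt = pow-low lt
    ... | inj₂ eq = ≡.subst (λ d → x ^ d ∈ Low n x) (≡.sym eq) p

  module _ {x y} (x-int : IsIntegral x) (y-int : IsIntegral y) where

    private
      a = proj₁ (integral⇒low x-int)
      b = proj₁ (integral⇒low y-int)

      -- These monomials span ℤ[x, y], since higher powers reduce by the two integral equations.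
      -- Both x and y act on this module, and therefore so do their sum and product.
      M : Fin (a ℕ.* b) → Carrier
      M t = x ^ toℕ (proj₁ (Fin.remQuot {a} b t)) * y ^ toℕ (proj₂ (Fin.remQuot {a} b t))

      M-additive : IsAdditive (ℤSpan.Spanned M)
      M-additive = ℤSpan.additive

      open IsAdditive M-additive

      mono : ∀ i j → x ^ toℕ i * y ^ toℕ j ∈ ℤSpan.Spanned M
      mono i j = resp (reflexive (≡.cong (λ (i , j) → x ^ toℕ {a} i * y ^ toℕ {b} j)
          (Fin.remQuot-combine {a} {b} i j)))
        (ℤSpan.generator M (Fin.combine i j))

      pow*pow : ∀ k l → x ^ k * y ^ l ∈ ℤSpan.Spanned M
      pow*pow k l = resp (*-comm _ _)
        (ℤSpan-mul (y ^ l) M-additive (λ i → resp (*-comm _ _)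
          (ℤSpan-mul (x ^ toℕ i) M-additive (mono i)
            (pow∈low (proj₂ (integral⇒low y-int)) l)))
          (pow∈low (proj₂ (integral⇒low x-int)) k))

      1∈M : 1# ∈ ℤSpan.Spanned M
      1∈M = resp (*-identityˡ 1#) (pow*pow 0 0)

      x-stable : ∀ {z} → z ∈ ℤSpan.Spanned M → x * z ∈ ℤSpan.Spanned M
      x-stable = ℤSpan-mul x M-additive λ t → resp (*-assoc _ _ _)
        (pow*pow (suc (toℕ (proj₁ (Fin.remQuot {a} b t)))) (toℕ (proj₂ (Fin.remQuot {a} b t))))

      y-stable : ∀ {z} → z ∈ ℤSpan.Spanned M → y * z ∈ ℤSpan.Spanned M
      y-stable = ℤSpan-mul y M-additive λ t →
        resp (solve 3 (λ x y z → x :* (y :* z) := y :* (x :* z)) refl _ _ _)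
        (pow*pow (toℕ (proj₁ (Fin.remQuot {a} b t))) (suc (toℕ (proj₂ (Fin.remQuot {a} b t)))))

    integral-+ : IsIntegral (x + y)
    integral-+ = stable⇒integral M 1∈M λ t → resp (sym (distribʳ _ _ _))
      (has+ (x-stable (ℤSpan.generator M t)) (y-stable (ℤSpan.generator M t)))

    integral-* : IsIntegral (x * y)
    integral-* = stable⇒integral M 1∈M λ t → resp (sym (*-assoc _ _ _))
        (x-stable (y-stable (ℤSpan.generator M t)))

  integral-resp : ∀ {x y} → x ≈ y → IsIntegral x → IsIntegral y
  integral-resp e (n , c , p) = n , c , trans (+-cong (^-cong n (sym e))
    (sum-cong n λ i → *-congˡ (^-cong (toℕ i) (sym e)))) p

  integral-ℤ : ∀ z → IsIntegral (fromℤ z)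
  integral-ℤ z = low⇒integral {1} (Low.hasℤ z (pow-low {1} {k = 0} (ℕ.s≤s ℕ.z≤n)))

  integral-isSubring : IsSubring IsIntegral
  integral-isSubring = record
    { resp = integral-resp
    ; has0 = integral-resp fromℤ-0 (integral-ℤ (+ 0))
    ; has1 = integral-resp fromℤ-1 (integral-ℤ (+ 1))
    ; has+ = integral-+
    ; has- = λ {x} p → integral-resp (solve 1 (λ x → con -[1+ 0 ] :* x := :- x)
            refl x) (integral-* (integral-ℤ -[1+ 0 ]) p)
    ; has* = integral-*
    }

  -- If x² is a root of a monic P of degree n, then x is a root of P(X²), which is monic of degree n
  -- + n.
  integral-√ : ∀ {x} → IsIntegral (x * x) → IsIntegral x
  integral-√ {x} p = low⇒integral {n ℕ.+ n} (Low.resp (square n)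
      (ℤSpan-min Low-additive
        (λ i → Low.resp (sym (square (toℕ i))) (pow-low (ℕ.+-mono-< (Fin.toℕ<n i) (Fin.toℕ<n i)))) x²ⁿ))
    where
    n = proj₁ (integral⇒low p)
    x²ⁿ = proj₂ (integral⇒low p)

    square : ∀ k → (x * x) ^ k ≈ x ^ (k ℕ.+ k)
    square zero    = refl
    square (suc k) = begin
      x * x * (x * x) ^ k        ≈⟨ *-congˡ (square k) ⟩
      x * x * x ^ (k ℕ.+ k)      ≈⟨ *-assoc _ _ _ ⟩
      x ^ suc (suc (k ℕ.+ k))    ≡⟨ ≡.cong (λ d → x ^ suc d) (ℕ.+-suc k k) ⟨
      x ^ (suc k ℕ.+ suc k)      ∎

  -- Multiplication by an element of `O` preserves `O`, a finitely generated group containing 1.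
  order⊆𝒪 : ∀ {O} → IsOrder O → O ⊆ 𝒪 U
  order⊆𝒪 {O} ord {x} x∈O = stable⇒integral b (spanned has1)
    (λ i → spanned (has* x∈O (proj₂ eq (δ i , sum-δ i b)))) , _
    where
    open IsOrder ord
    open IsSubring isSubring
    open ℤSpan using (δ; sum-δ)
    b  = proj₁ (proj₂ lattice)
    eq = proj₂ (proj₂ (proj₂ lattice))

    spanned : O ⊆ ℤSpan.Spanned b
    spanned x∈O = let c , e = proj₁ eq x∈O in c ℤSpan., e

-- Principal ideals and excluded middle from class number one

module ClassNumber (K : CharZeroField) where

  open CharZeroField K hiding (zero)
  open FieldTheory K
  open FieldProperties K
  open Integrality K
  open SetoidReasoning setoid

  𝒪-isSubring : ∀ {F} → IsSubfield F → IsSubring (𝒪 F)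
  𝒪-isSubring F-field = record
    { resp = λ { e (p , q) → I.resp e p , F.resp e q }
    ; has0 = I.has0 , F.has0
    ; has1 = I.has1 , F.has1
    ; has+ = λ { (p , q) (p′ , q′) → I.has+ p p′ , F.has+ q q′ }
    ; has- = λ { (p , q) → I.has- p , F.has- q }
    ; has* = λ { (p , q) (p′ , q′) → I.has* p p′ , F.has* q q′ }
    }
    where
    module I = IsSubring integral-isSubring
    module F = IsSubring (IsSubfield.isSubring F-field)

  module Divisibility {F : Subset} (F-field : IsSubfield F) where

    open Ideals F
    private
      module R = IsSubring (𝒪-isSubring F-field)

    infix 4 _∥_

    _∥_ : Carrier → Carrier → Set
    a ∥ x = x ∈ multiples a (𝒪 F)

    ∥-isIdeal : ∀ {a} → a ∈ 𝒪 F → IsIdeal (a ∥_)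
    ∥-isIdeal {a} a∈ = record
      { resp = λ { e (y , y∈ , e′) → y , y∈ , trans (sym e) e′ }
      ; inside = λ { (y , y∈ , e) → R.resp (sym e) (R.has* a∈ y∈) }
      ; has0 = 0# , R.has0 , sym (zeroʳ a)
      ; has+ = λ { (y , y∈ , e) (z , z∈ , e′) → y + z , R.has+ y∈ z∈ , trans (+-cong e e′)
              (sym (distribˡ _ _ _)) }
      ; absorb = λ { {r} r∈ (y , y∈ , e) → r * y , R.has* r∈ y∈ ,
          trans (*-congˡ e) (solve 3 (λ r a y → r :* (a :* y) := a :* (r :* y)) refl r a y) }
      }

    ideal-sum : ∀ {I} → IsIdeal I → ∀ n {f : Fin n → Carrier} → (∀ i → f i ∈ I) → sum f ∈ I
    ideal-sum I-ideal zero    p = IsIdeal.has0 I-ideal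
    ideal-sum I-ideal (suc n) p = IsIdeal.has+ I-ideal (p zero) (ideal-sum I-ideal n (p ∘ suc))

    product⊆ : ∀ {I J S} → IsIdeal S → (∀ {a b} → a ∈ I → b ∈ J → a * b ∈ S) → I · J ⊆ S
    product⊆ S-ideal p (n , a , b , a∈ , b∈ , e) =
      IsIdeal.resp S-ideal (sym e) (ideal-sum S-ideal n λ i → p (a∈ i) (b∈ i))

    ∈-product : ∀ {I J a b} → a ∈ I → b ∈ J → a * b ∈ I · J
    ∈-product {a = a} {b} a∈ b∈ = 1 , (λ _ → a) , (λ _ → b) , (λ _ → a∈) , (λ _ → b∈) , sym (+-identityʳ _)

    ∥-* : ∀ {a b x y} → a ∥ x → b ∥ y → a * b ∥ x * y
    ∥-* (x , x∈ , e) (y , y∈ , e′) = x * y , R.has* x∈ y∈ ,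
      trans (*-cong e e′) (solve 4 (λ a x b y → (a :* x) :* (b :* y) := a :* b :* (x :* y)) refl _ _ _ _)

  AllPrincipal : Subset → Set₁
  AllPrincipal F = ∀ I → IsIdeal I → IsNonzero I → ∃[ g ] g ∈ I × I ⊆ multiples g (𝒪 F)
    where open Ideals F

  module _ {F : Subset} (F-field : IsSubfield F) (class1 : Ideals.ClassNumberOne F) where

    open Ideals F
    private
      module 𝒪F = IsSubring (𝒪-isSubring F-field)

      unit-isIdeal : IsIdeal (𝒪 F)
      unit-isIdeal = record
        { resp = 𝒪F.resp ; inside = λ p → p ; has0 = 𝒪F.has0 ; has+ = 𝒪F.has+ ; absorb = 𝒪F.has* }

    -- The class of `I` is compared with that of the unit ideal: given a I = b 𝒪, the g in `I` with
    -- a g = b is a generator.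
    allPrincipal : AllPrincipal F
    allPrincipal I I-ideal I≠0
      with a , b , a∈ , b∈ , a≉0 , b≉0 , aI⊆b𝒪 , b𝒪⊆aI ← class1 I (𝒪 F) I-ideal unit-isIdeal I≠0
              (1# , 𝒪F.has1 , 1≉0)
      with g , g∈I , e ← b𝒪⊆aI (1# , 𝒪F.has1 , refl) = g , g∈I , λ {x} x∈I →
        let y , y∈ , e′ = aI⊆b𝒪 (x , x∈I , refl) in y , y∈ , cancelˡ a≉0 (begin
          a * x          ≈⟨ e′ ⟩
          b * y          ≈⟨ *-congʳ (*-identityʳ b) ⟨
          b * 1# * y     ≈⟨ *-congʳ e ⟩
          a * g * y      ≈⟨ *-assoc _ _ _ ⟩
          a * (g * y)    ∎)

    -- A generator of a 𝒪 + { x ∈ 𝒪 | P } decides P when a is not a unit.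
    excluded-middle : ∀ {a} → a ∈ 𝒪 F → ¬ a ≈ 0# → (∀ {y} → y ∈ 𝒪 F → ¬ a * y ≈ 1#) →
                      (P : Set) → P ⊎ ¬ P
    excluded-middle {a} a∈ a≉0 nonunit P = decide
        (allPrincipal I I-ideal (a , inj₁ (1# , 𝒪F.has1 , sym (*-identityʳ a)) , a≉0))
      where
      I : Subset
      I x = multiples a (𝒪 F) x ⊎ (P × x ∈ 𝒪 F)

      inside : ∀ {x} → multiples a (𝒪 F) x → x ∈ 𝒪 F
      inside (y , y∈ , e) = 𝒪F.resp (sym e) (𝒪F.has* a∈ y∈)

      inside′ : I ⊆ 𝒪 F
      inside′ (inj₁ p) = inside p
      inside′ (inj₂ (_ , x∈)) = x∈

      plus : ∀ {x y} → I x → I y → I (x + y)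
      plus (inj₁ (y , y∈ , e)) (inj₁ (z , z∈ , e′)) =
        inj₁ (y + z , 𝒪F.has+ y∈ z∈ , trans (+-cong e e′) (sym (distribˡ _ _ _)))
      plus (inj₁ q)       (inj₂ (p , y∈)) = inj₂ (p , 𝒪F.has+ (inside q) y∈)
      plus (inj₂ (p , x∈)) q              = inj₂ (p , 𝒪F.has+ x∈ (inside′ q))

      I-ideal : IsIdeal I
      I-ideal = record
        { resp = λ { e (inj₁ (y , y∈ , e′)) → inj₁ (y , y∈ , trans (sym e) e′)
                   ; e (inj₂ (p , x∈)) → inj₂ (p , 𝒪F.resp e x∈) }
        ; inside = inside′
        ; has0 = inj₁ (0# , 𝒪F.has0 , sym (zeroʳ a))
        ; has+ = plus
        ; absorb = λ { {r} r∈ (inj₁ (y , y∈ , e)) → inj₁ (r * y , 𝒪F.has* r∈ y∈ ,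
                         trans (*-congˡ e) (solve 3 (λ r a y → r :* (a :* y) := a :* (r :* y)) refl _ _ _))
                     ; r∈ (inj₂ (p , x∈)) → inj₂ (p , 𝒪F.has* r∈ x∈) }
        }

      decide : ∃[ g ] g ∈ I × I ⊆ multiples g (𝒪 F) → P ⊎ ¬ P
      decide (g , inj₂ (p , _) , _) = inj₁ p
      -- Here g is a multiple of a. If `P` held, 1 would lie in the ideal and be a multiple of g, so
      -- a would be a unit.
      decide (g , inj₁ (y , y∈ , e) , gen) = inj₂ λ p →
        let z , z∈ , e′ = gen (inj₂ (p , 𝒪F.has1)) in
        nonunit (𝒪F.has* y∈ z∈) (trans (sym (*-assoc _ _ _)) (trans (*-congʳ (sym e)) (sym e′)))

-- Denominators, and ℤ as the ring of integers of ℚ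

module Rationals (K : CharZeroField) where

  open CharZeroField K hiding (zero)
  open FieldTheory K
  open FieldProperties K
  open Integrality K
  open ClassNumber K
  open SetoidReasoning setoid

  ExcludedMiddle : Set₁
  ExcludedMiddle = (P : Set) → P ⊎ ¬ P

  denominator : ∀ q → fromℤ (ℚ.↧ q) * ι q ≈ fromℤ (ℚ.↥ q)
  denominator q@record{} = trans (sym (ι.*-homo _ _)) (ι.⟦⟧-cong (ℚ.toℚᵘ-injective
    (ℚᵘ.≃-trans (ℚ.toℚᵘ-homo-* (ℚ.↧ q ℚ./ 1) q)
    (ℚᵘ.≃-trans (ℚᵘ.*-congʳ {ℚ.toℚᵘ q} (ℚ.toℚᵘ-fromℚᵘ (mkℚᵘ (ℚ.↧ q) 0)))
    (ℚᵘ.≃-trans (*≡* (≡.trans (ℤ.*-identityʳ _) (≡.trans (ℤ.*-comm (ℚ.↧ q) (ℚ.↥ q))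
        (≡.cong (ℚ.↥ q ℤ.*_) (≡.cong (λ n → + suc n) (≡.sym (ℕ.+-identityʳ _)))))))
      (ℚᵘ.≃-sym (ℚ.toℚᵘ-fromℚᵘ (mkℚᵘ (ℚ.↥ q) 0))))))))

  *-≢0 : ∀ {i j} → ¬ i ≡ + 0 → ¬ j ≡ + 0 → ¬ i ℤ.* j ≡ + 0
  *-≢0 {i} p q e with ℤ.i*j≡0⇒i≡0∨j≡0 i e
  ... | inj₁ e = p e
  ... | inj₂ e = q e

  IsInteger : Subset
  IsInteger x = ∃[ z ] x ≈ fromℤ z

  common-denominator : ∀ n (q : Fin n → ℚ) → ∃[ d ] ¬ d ≡ + 0 × (∀ i → IsInteger (fromℤ d * ι (q i)))
  common-denominator zero    q = + 1 , (λ ()) , λ ()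
  common-denominator (suc n) q with d , d≢0 , c ← common-denominator n (q ∘ suc) =
    d ℤ.* ℚ.↧ q zero , *-≢0 {d} d≢0 (λ ()) , integer
    where
    integer : ∀ i → IsInteger (fromℤ (d ℤ.* ℚ.↧ q zero) * ι (q i))
    integer zero    = d ℤ.* ℚ.↥ q zero , (begin
      fromℤ (d ℤ.* ℚ.↧ q zero) * ι (q zero)          ≈⟨ *-congʳ (fromℤ-* d (ℚ.↧ q zero)) ⟩
      fromℤ d * fromℤ (ℚ.↧ q zero) * ι (q zero)      ≈⟨ *-assoc _ _ _ ⟩
      fromℤ d * (fromℤ (ℚ.↧ q zero) * ι (q zero))    ≈⟨ *-congˡ (denominator (q zero)) ⟩
      fromℤ d * fromℤ (ℚ.↥ q zero)                   ≈⟨ fromℤ-* d (ℚ.↥ q zero) ⟨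
      fromℤ (d ℤ.* ℚ.↥ q zero)                       ∎)
    integer (suc i) = ℚ.↧ q zero ℤ.* proj₁ (c i) , (begin
      fromℤ (d ℤ.* ℚ.↧ q zero) * ι (q (suc i))       ≈⟨ *-congʳ (fromℤ-* d (ℚ.↧ q zero)) ⟩
      fromℤ d * fromℤ (ℚ.↧ q zero) * ι (q (suc i))   ≈⟨ solve 3 (λ d e q → d :* e :* q := e :* (d :* q))
          refl _ _ _ ⟩
      fromℤ (ℚ.↧ q zero) * (fromℤ d * ι (q (suc i))) ≈⟨ *-congˡ (proj₂ (c i)) ⟩
      fromℤ (ℚ.↧ q zero) * fromℤ (proj₁ (c i))       ≈⟨ fromℤ-* (ℚ.↧ q zero) (proj₁ (c i)) ⟨
      fromℤ (ℚ.↧ q zero ℤ.* proj₁ (c i))             ∎)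

  clear-denominators : ∀ {n} {b : Fin n → Carrier} {x} → x ∈ ℚSpan.Spanned b →
    ∃[ d ] ¬ d ≡ + 0 × fromℤ d * x ∈ ℤSpan.Spanned b
  clear-denominators {n} {b} {x} (q ℚSpan., e) with d , d≢0 , c ← common-denominator n q =
    d , d≢0 , (λ i → proj₁ (c i)) ℤSpan., (begin
      fromℤ d * x                                 ≈⟨ *-congˡ e ⟩
      fromℤ d * sum (λ i → ι (q i) * b i)         ≈⟨ *-sum n _ _ ⟩
      sum (λ i → fromℤ d * (ι (q i) * b i))       ≈⟨ sum-cong n
          (λ i → trans (sym (*-assoc _ _ _)) (*-congʳ (proj₂ (c i)))) ⟩
      sum (λ i → fromℤ (proj₁ (c i)) * b i)       ∎)

  ℚ-subfield : Subset
  ℚ-subfield x = ∃[ q ] x ≈ ι q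

  ℚ-isSubfield : IsSubfield ℚ-subfield
  ℚ-isSubfield = record
    { isSubring = record
      { resp = λ { e (q , e′) → q , trans (sym e) e′ }
      ; has0 = 0ℚ , sym ι.0#-homo
      ; has1 = 1ℚ , sym ι.1#-homo
      ; has+ = λ { (p , e) (q , e′) → p ℚ.+ q , trans (+-cong e e′) (sym (ι.+-homo p q)) }
      ; has- = λ { (p , e) → ℚ.- p , trans (-‿cong e) (sym (ι.-‿homo p)) }
      ; has* = λ { (p , e) (q , e′) → p ℚ.* q , trans (*-cong e e′) (sym (ι.*-homo p q)) }
      }
    ; hasInv = inv
    }
    where
    inv : ∀ {x y} → x ∈ ℚ-subfield → x * y ≈ 1# → y ∈ ℚ-subfield
    inv {x} {y} (q , e) xy≈1 with q ℚ.≟ 0ℚ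
    ... | yes ≡.refl = ⊥-elim (1≉0 (trans (sym xy≈1) (trans (*-congʳ (trans e ι.0#-homo)) (zeroˡ y))))
    ... | no q≢0 = ℚ.1/ q , (begin
      y                       ≈⟨ *-identityˡ y ⟨
      1# * y                  ≈⟨ *-congʳ ι.1#-homo ⟨
      ι 1ℚ * y                ≈⟨ *-congʳ (ι.⟦⟧-cong (ℚ.*-inverseˡ q)) ⟨
      ι (ℚ.1/ q ℚ.* q) * y    ≈⟨ *-congʳ (ι.*-homo _ _) ⟩
      ι (ℚ.1/ q) * ι q * y    ≈⟨ *-assoc _ _ _ ⟩
      ι (ℚ.1/ q) * (ι q * y)  ≈⟨ *-congˡ (trans (*-congʳ (sym e)) xy≈1) ⟩
      ι (ℚ.1/ q) * 1#         ≈⟨ *-identityʳ _ ⟩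
      ι (ℚ.1/ q)              ∎)
      where instance _ = ℚ.≢-nonZero q≢0

  subfield-ℤ : ∀ {F} → IsSubfield F → ∀ z → fromℤ z ∈ F
  subfield-ℤ F-field z = resp (*-identityʳ _) (IsAdditive.hasℤ (subringAdditive isSubring) z has1)
    where
    open IsSubfield F-field
    open IsSubring isSubring

  subfield-ι : ∀ {F} → IsSubfield F → ∀ q → ι q ∈ F
  subfield-ι F-field q with y , e ← inverse (fromℤ (ℚ.↧ q)) (fromℤ-≉0 {ℚ.↧ q} λ ()) =
    resp (begin
      y * fromℤ (ℚ.↥ q)            ≈⟨ *-congˡ (denominator q) ⟨
      y * (fromℤ (ℚ.↧ q) * ι q)    ≈⟨ solve 3 (λ y d q → y :* (d :* q) := d :* y :* q) refl _ _ _ ⟩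
      fromℤ (ℚ.↧ q) * y * ι q      ≈⟨ *-congʳ e ⟩
      1# * ι q                     ≈⟨ *-identityˡ _ ⟩
      ι q                          ∎)
    (has* (hasInv (subfield-ℤ F-field (ℚ.↧ q)) e) (subfield-ℤ F-field (ℚ.↥ q)))
    where
    open IsSubfield F-field
    open IsSubring isSubring

  U-isSubfield : IsSubfield U
  U-isSubfield = record { isSubring = _ ; hasInv = _ }

  integer-additive : IsAdditive IsInteger
  integer-additive = record
    { resp = λ { e (z , e′) → z , trans (sym e) e′ }
    ; has0 = + 0 , sym fromℤ-0
    ; has+ = λ { (i , e) (j , e′) → i ℤ.+ j , trans (+-cong e e′) (sym (fromℤ-+ i j)) }
    ; has- = λ { (i , e) → ℤ.- i , trans (-‿cong e) (sym (fromℤ-neg i)) }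
    }

  module _ {F : Subset} (F-field : IsSubfield F)
           (integral-multiple : ∀ x → ∃[ d ] ¬ d ≡ + 0 × IsIntegral (fromℤ d * x)) where

    open Divisibility F-field
    open IsSubfield F-field
    open IsSubring isSubring

    -- If d is a denominator of the inverse of x, then d = x · (d / x) with d / x integral. This
    -- takes the place of the norm of x.
    divides-integer : ∀ {x} → x ∈ 𝒪 F → ¬ x ≈ 0# → ∃[ d ] ¬ d ≡ + 0 × x ∥ fromℤ d
    divides-integer {x} (_ , x∈) x≉0 =
      let y , xy≈1 = inverse x x≉0
          d , d≢0 , dy = integral-multiple y
      in d , d≢0 , fromℤ d * y , (dy , has* (subfield-ℤ F-field d) (hasInv x∈ xy≈1)) , (begin
        fromℤ d              ≈⟨ *-identityʳ _ ⟨
        fromℤ d * 1#         ≈⟨ *-congˡ xy≈1 ⟨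
        fromℤ d * (x * y)    ≈⟨ solve 3 (λ d x y → d :* (x :* y) := x :* (d :* y)) refl _ _ _ ⟩
        x * (fromℤ d * y)    ∎)

  module _ (em : ExcludedMiddle) where

    least : ∀ {P : ℕ → Set} n → P n → ∃[ m ] P m × (∀ k → k ℕ.< m → ¬ P k)
    least {P} n = go (ℕ.<-wellFounded n)
      where
      go : ∀ {n} → Acc ℕ._<_ n → P n → ∃[ m ] P m × (∀ k → k ℕ.< m → ¬ P k)
      go {n} (acc rs) p with em (∃[ k ] k ℕ.< n × P k)
      ... | inj₁ (k , k<n , q) = go (rs k<n) q
      ... | inj₂ none          = n , p , λ k k<n q → none (k , k<n , q)

    -- Division with remainder by the least positive member. As `S` is an arbitrary predicate, both
    -- the existence of a positive member and the choice of the least one use `em`.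
    ℤ-principal : ∀ {S : ℤ → Set} → S (+ 0) → (∀ {i j} → S i → S j → S (i ℤ.+ j)) →
      (∀ c {i} → S i → S (c ℤ.* i)) → ∃[ d ] S d × (∀ {z} → S z → ∃[ q ] z ≡ q ℤ.* d)
    ℤ-principal {S} has0 has+ has* with em (∃[ n ] S (+ suc n))
    ... | inj₂ none = + 0 , has0 , λ {z} z∈ → + 0 , zero-only z z∈
      where
      zero-only : ∀ z → S z → z ≡ + 0
      zero-only (+ zero)  _  = ≡.refl
      zero-only (+ suc n) z∈ = ⊥-elim (none (n , z∈))
      zero-only -[1+ n ]  z∈ = ⊥-elim (none (n , ≡.subst S (ℤ.-1*i≡-i -[1+ n ]) (has* -[1+ 0 ] z∈)))
    -- Positive members are indexed by their predecessors, so a remainder suc r below suc m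
    -- contradicts minimality at r.
    ... | inj₁ (n , p) with m , m∈ , below ← least {λ k → S (+ suc k)} n p =
      + suc m , m∈ , λ {z} z∈ → z ℤ./ℕ suc m , divide z z∈
      where
      divide : ∀ z → S z → z ≡ (z ℤ./ℕ suc m) ℤ.* + suc m
      divide z z∈ with z ℤ.%ℕ suc m | ℤ.n%ℕd<d z (suc m) | ℤ.a≡a%ℕn+[a/ℕn]*n z (suc m)
      ... | zero  | _   | e = ≡.trans e (ℤ.+-identityˡ _)
      ... | suc r | r<m | e = ⊥-elim (below r (ℕ.s<s⁻¹ r<m)
              (≡.subst S remainder (has+ z∈ (has* (ℤ.- (z ℤ./ℕ suc m)) m∈))))
        where
        w = (z ℤ./ℕ suc m) ℤ.* + suc m
        remainder : z ℤ.+ (ℤ.- (z ℤ./ℕ suc m)) ℤ.* + suc m ≡ + suc r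
        remainder = ≡.trans (≡.cong₂ ℤ._+_ e (≡.sym (ℤ.neg-distribˡ-* (z ℤ./ℕ suc m) (+ suc m))))
          (≡.trans (ℤ.+-assoc (+ suc r) w (ℤ.- w))
              (≡.trans (≡.cong (ℤ._+_ (+ suc r)) (ℤ.+-inverseʳ w)) (ℤ.+-identityʳ (+ suc r))))

    -- The z ∈ ℤ with z xᵏ ∈ ℤ for all k form an ideal stable under x; for
    -- its generator j this gives x j ∈ ℤ j.
    rational-integral : 𝒪 ℚ-subfield ⊆ IsInteger
    rational-integral {x} (x-int , x∈ℚ) = quotient
        (ℤ-principal {J} J0 (λ {i} {j} → J+ {i} {j}) (λ c {i} → J* c {i}))
      where
      module I = IsAdditive integer-additive
      module Q = IsSubring (IsSubfield.isSubring ℚ-isSubfield)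

      n   = proj₁ (integral⇒low x-int)
      xⁿ∈ = proj₂ (integral⇒low x-int)

      J : ℤ → Set
      J z = ∀ k → IsInteger (fromℤ z * x ^ k)

      J0 : J (+ 0)
      J0 k = I.resp (sym (trans (*-congʳ fromℤ-0) (zeroˡ _))) I.has0

      J+ : ∀ {i j} → J i → J j → J (i ℤ.+ j)
      J+ {i} {j} p q k = I.resp (trans (sym (distribʳ _ _ _)) (*-congʳ (sym (fromℤ-+ i j))))
          (I.has+ (p k) (q k))

      J* : ∀ c {i} → J i → J (c ℤ.* i)
      J* c {i} p k = I.resp (trans (sym (*-assoc _ _ _)) (*-congʳ (sym (fromℤ-* c i)))) (I.hasℤ c (p k))

      power∈ℚ : ∀ k → x ^ k ∈ ℚ-subfield
      power∈ℚ zero    = Q.has1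
      power∈ℚ (suc k) = Q.has* x∈ℚ (power∈ℚ k)

      common = common-denominator n λ i → proj₁ (power∈ℚ (toℕ i))
      D = proj₁ common

      -- Clearing the denominators of the first n powers clears those of all powers, which are
      -- integer combinations of them. So `J` has a nonzero member.
      D∈J : J D
      D∈J k = ℤSpan-mul (fromℤ D) integer-additive
        (λ i → I.resp (*-congˡ (sym (proj₂ (power∈ℚ (toℕ i))))) (proj₂ (proj₂ common) i))
        (pow∈low xⁿ∈ k)

      quotient : ∃[ j ] J j × (∀ {z} → J z → ∃[ q ] z ≡ q ℤ.* j) → IsInteger x
      quotient (j , j∈ , gen) = q , cancelˡ (fromℤ-≉0 j≢0) (begin
        fromℤ j * x           ≈⟨ *-congˡ (*-identityʳ x) ⟨
        fromℤ j * x ^ 1       ≈⟨ proj₂ (j∈ 1) ⟩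
        fromℤ y               ≡⟨ ≡.cong fromℤ y≡qj ⟩
        fromℤ (q ℤ.* j)       ≈⟨ trans (fromℤ-* q j) (*-comm _ _) ⟩
        fromℤ j * fromℤ q     ∎)
        where
        y = proj₁ (j∈ 1)

        y∈J : J y
        y∈J k = I.resp (begin
          fromℤ j * x ^ suc k       ≈⟨ *-assoc _ _ _ ⟨
          fromℤ j * x * x ^ k       ≈⟨ *-congʳ (*-congˡ (*-identityʳ x)) ⟨
          fromℤ j * x ^ 1 * x ^ k   ≈⟨ *-congʳ (proj₂ (j∈ 1)) ⟩
          fromℤ y * x ^ k           ∎) (j∈ (suc k))

        q    = proj₁ (gen {y} y∈J)
        y≡qj = proj₂ (gen {y} y∈J)

        j≢0 : ¬ j ≡ + 0
        j≢0 ≡.refl = proj₁ (proj₂ common) (≡.trans (proj₂ (gen {D} D∈J)) (ℤ.*-zeroʳ (proj₁ (gen {D} D∈J))))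

    -- By `rational-integral` an ideal here is determined by the integers it contains, and these
    -- form an ideal of ℤ.
    ℚ-allPrincipal : AllPrincipal ℚ-subfield
    ℚ-allPrincipal I I-ideal _ = generator (ℤ-principal {λ z → fromℤ z ∈ I}
        (I.resp (sym fromℤ-0) I.has0)
        (λ {i} {j} p q → I.resp (sym (fromℤ-+ i j)) (I.has+ p q))
        (λ c {i} p → I.resp (sym (fromℤ-* c i)) (I.absorb (ℤ⊆𝒪 c) p)))
      where
      open Ideals ℚ-subfield using (multiples)
      module I = Ideals.IsIdeal I-ideal

      ℤ⊆𝒪 : ∀ z → fromℤ z ∈ 𝒪 ℚ-subfield
      ℤ⊆𝒪 z = integral-ℤ z , z ℚ./ 1 , refl

      generator : ∃[ d ] fromℤ d ∈ I × (∀ {z} → fromℤ z ∈ I → ∃[ q ] z ≡ q ℤ.* d) →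
        ∃[ g ] g ∈ I × I ⊆ multiples g (𝒪 ℚ-subfield)
      generator (d , d∈ , gen) = fromℤ d , d∈ , λ {x} x∈ →
        let z , x≈z = rational-integral (I.inside x∈)
            q , e = gen {z} (I.resp x≈z x∈)
        in fromℤ q , ℤ⊆𝒪 q , trans x≈z (trans (reflexive (≡.cong fromℤ e)) (trans (fromℤ-* q d) (*-comm _ _)))

-- Linear dependence over ℚ, and generators of quadratic extensions

module LinearAlgebra (K : CharZeroField) where

  open CharZeroField K hiding (zero)
  open FieldTheory K
  open FieldProperties K
  open Rationals K
  open SetoidReasoning setoid

  Dependent : ∀ {m} → (Fin m → Carrier) → Set
  Dependent {m} w = Σ[ q ∈ (Fin m → ℚ) ] sum (λ i → ι (q i) * w i) ≈ 0# × ∃[ i ] ¬ q i ≡ 0ℚ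

  private
    ℚ-additive : IsAdditive ℚ-subfield
    ℚ-additive = subringAdditive (IsSubfield.isSubring ℚ-isSubfield)

  module _ {n} (u : Fin (suc n) → Carrier) where

    private module Tail = IsAdditive (ℚSpan.additive {b = u ∘ suc})

    tail : ∀ {x} → x ∈ ℚSpan.Spanned u → Carrier
    tail (c ℚSpan., _) = sum λ i → ι (c (suc i)) * u (suc i)

    tail∈ : ∀ {x} (p : x ∈ ℚSpan.Spanned u) → tail p ∈ ℚSpan.Spanned (u ∘ suc)
    tail∈ (c ℚSpan., _) = (c ∘ suc) ℚSpan., refl

    leading : ∀ {x} → x ∈ ℚSpan.Spanned u → ℚ
    leading (c ℚSpan., _) = c zero

    split : ∀ {x} (p : x ∈ ℚSpan.Spanned u) → x ≈ ι (leading p) * u zero + tail p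
    split (c ℚSpan., e) = e

    headless : ∀ {x} (p : x ∈ ℚSpan.Spanned u) → leading p ≡ 0ℚ → x ∈ ℚSpan.Spanned (u ∘ suc)
    headless {x} p e = Tail.resp (begin
      tail p                        ≈⟨ +-identityˡ _ ⟨
      0# + tail p                   ≈⟨ +-congʳ (trans (*-congʳ (trans (ι.⟦⟧-cong e) ι.0#-homo)) (zeroˡ _)) ⟨
      ι (leading p) * u zero + tail p  ≈⟨ split p ⟨
      x                             ∎) (tail∈ p)

    eliminate : ∀ {x y} (p : x ∈ ℚSpan.Spanned u) (q : y ∈ ℚSpan.Spanned u) t → t ℚ.* leading q ≡ leading p →
                x - ι t * y ∈ ℚSpan.Spanned (u ∘ suc)
    eliminate {x} {y} p q t e = Tail.resp (begin
      tail p - ι t * tail q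
        ≈⟨ solve 5 (λ r s t c u → r :- t :* s := (t :* c) :* u :+ r :- t :* (c :* u :+ s))
            refl (tail p) (tail q) (ι t) (ι (leading q)) (u zero) ⟩
      ι t * ι (leading q) * u zero + tail p - ι t * (ι (leading q) * u zero + tail q)
        ≈⟨ +-cong (+-congʳ (*-congʳ (trans (sym (ι.*-homo t (leading q))) (ι.⟦⟧-cong e))))
            (-‿cong (*-congˡ (sym (split q)))) ⟩
      ι (leading p) * u zero + tail p - ι t * y
        ≈⟨ +-congʳ (split p) ⟨
      x - ι t * y ∎) (Tail.hasDiff (tail∈ p) (ℚSpan.scale t (tail∈ q)))

  -- Gaussian elimination on the first spanning vector: a w j with nonzero leading coefficient
  -- clears that coefficient in all the others, which leaves one vector fewer on each side. Without
  -- such a w j the first spanning vector is dropped.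
  dependent : ∀ n {m} → n ℕ.< m → (u : Fin n → Carrier) (w : Fin m → Carrier) →
              (∀ j → w j ∈ ℚSpan.Spanned u) → Dependent w
  -- Everything in the span of the empty family is 0, so every coefficient may be 1.
  dependent zero {suc m} _ u w p = (λ _ → 1ℚ) ,
    sum-≈0 (suc m) (λ i → trans (*-congˡ (ℚSpan.combination (p i))) (zeroʳ (ι 1ℚ))) , zero , λ ()
  dependent (suc n) {suc m} (ℕ.s≤s n<m) u w p with Fin.any? (λ j → ¬? (leading u (p j) ℚ.≟ 0ℚ))
  ... | no none = dependent n (ℕ.m<n⇒m<1+n n<m) (u ∘ suc) w λ j →
    headless u (p j) (decidable-stable (_ ℚ.≟ _) λ h → none (j , h))
  ... | yes (j , h≢0) = extend (dependent n n<m (u ∘ suc) w′ λ i → eliminate u (p (Fin.punchIn j i)) (p j)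
          (t i) (t-spec i))
    where
    instance _ = ℚ.≢-nonZero h≢0
    h = leading u (p j)

    t : Fin m → ℚ
    t i = leading u (p (Fin.punchIn j i)) ℚ.* ℚ.1/ h

    t-spec : ∀ i → t i ℚ.* h ≡ leading u (p (Fin.punchIn j i))
    t-spec i = ≡.trans (ℚ.*-assoc s (ℚ.1/ h) h) (≡.trans (≡.cong (s ℚ.*_) (ℚ.*-inverseˡ h)) (ℚ.*-identityʳ s))
      where s = leading u (p (Fin.punchIn j i))

    w′ : Fin m → Carrier
    w′ i = w (Fin.punchIn j i) - ι (t i) * w j

    extend : Dependent w′ → Dependent w
    extend (q , rel , i , qi≢0) = q⁺ , (begin
        sum (λ k → ι (q⁺ k) * w k)
          ≈⟨ sum-remove {i = j} (λ k → ι (q⁺ k) * w k) ⟩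
        ι (q⁺ j) * w j + sum (λ i → ι (q⁺ (Fin.punchIn j i)) * w (Fin.punchIn j i))
          ≈⟨ +-cong (*-congʳ (ι.⟦⟧-cong (Vector.insertAt-lookup q j (ℚ.- s))))
                    (sum-cong m λ i → *-congʳ (ι.⟦⟧-cong (Vector.insertAt-punchIn q j (ℚ.- s) i))) ⟩
        ι (ℚ.- s) * w j + sum (λ i → ι (q i) * w (Fin.punchIn j i))
          ≈⟨ +-congʳ (*-congʳ (trans (ι.-‿homo s) (-‿cong (sym (proj₂ s∈))))) ⟩
        - sum (λ i → ι (q i) * ι (t i)) * w j + sum (λ i → ι (q i) * w (Fin.punchIn j i))
          ≈⟨ solve 3 (λ a w b → (:- a) :* w :+ b := b :+ (:- w) :* a) refl _ (w j) _ ⟩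
        sum (λ i → ι (q i) * w (Fin.punchIn j i)) + - w j * sum (λ i → ι (q i) * ι (t i))
          ≈⟨ +-congˡ (*-sum m (- w j) _) ⟩
        sum (λ i → ι (q i) * w (Fin.punchIn j i)) + sum (λ i → - w j * (ι (q i) * ι (t i)))
          ≈⟨ sum-+ m _ _ ⟩
        sum (λ i → ι (q i) * w (Fin.punchIn j i) + - w j * (ι (q i) * ι (t i)))
          ≈⟨ sum-cong m (λ i → solve 4 (λ q v w t → q :* v :+ (:- w) :* (q :* t) := q :* (v :- t :* w))
               refl (ι (q i)) (w (Fin.punchIn j i)) (w j) (ι (t i))) ⟩
        sum (λ i → ι (q i) * w′ i)
          ≈⟨ rel ⟩
        0# ∎) , Fin.punchIn j i , λ e → qi≢0 (≡.trans (≡.sym (Vector.insertAt-punchIn q j (ℚ.- s) i)) e)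
      where
      -- The multiples of w j inside `w′` add up to -s w j, so the pivot gets the coefficient -s.
      -- The sum is formed in `K`; closure of `ℚ-subfield` under sums shows that it is rational.
      s∈ : ∃[ s ] sum (λ i → ι (q i) * ι (t i)) ≈ ι s
      s∈ = IsAdditive.hasSum ℚ-additive m λ i → q i ℚ.* t i , sym (ι.*-homo _ _)
      s = proj₁ s∈
      q⁺ = insertAt q j (ℚ.- s)

  sum-split : ∀ a {b} (g : Fin (a ℕ.+ b) → Carrier) →
              sum g ≈ sum (λ i → g (i Fin.↑ˡ b)) + sum (λ j → g (a Fin.↑ʳ j))
  sum-split zero    g = sym (+-identityˡ _)
  sum-split (suc a) g = trans (+-congˡ (sum-split a (g ∘ suc))) (sym (+-assoc _ _ _))

  -- L = F ⊕ F θ; that the sum is direct is encoded by θ ∉ F.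
  record Generates (F L : Subset) (θ : Carrier) : Set where
    field
      θ∈L       : θ ∈ L
      θ∉F       : θ ∉ F
      decompose : ∀ {x} → x ∈ L → ∃[ u ] ∃[ v ] u ∈ F × v ∈ F × x ≈ u + v * θ

  -- Stated for degrees k and k + k, so that k = 1 gives ℚ ⊂ K₀ and k = 2 gives K₀ ⊂ K.
  module _ (em : ExcludedMiddle) {F L : Subset} (F-field : IsSubfield F) (L-field : IsSubfield L) (F⊆L : F ⊆ L)
           {k} {f : Fin k → Carrier} {l : Fin (k ℕ.+ k) → Carrier}
           (0<k : 0 ℕ.< k) (f-basis : IsℚBasis F f) (l-basis : IsℚBasis L l) where

    private
      module F = IsSubring (IsSubfield.isSubring F-field)
      module L = IsSubring (IsSubfield.isSubring L-field)
      module FB = IsℚBasis f-basis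
      module LB = IsℚBasis l-basis

      spannedF : ∀ {x} → x ∈ F → x ∈ ℚSpan.Spanned f
      spannedF x∈F = let q , e = FB.spanning x∈F in q ℚSpan., e

      spannedL : ∀ {x} → x ∈ L → x ∈ ℚSpan.Spanned l
      spannedL x∈L = let q , e = LB.spanning x∈L in q ℚSpan., e

      -- Otherwise the k + k independent basis vectors of `L` would all lie in a space spanned by k
      -- vectors.
      outside : ∃[ i ] l i ∉ F
      outside with em (∃[ i ] l i ∉ F)
      ... | inj₁ found = found
      ... | inj₂ none  = ⊥-elim (proj₂ (proj₂ (proj₂ dep)) (LB.independent (proj₁ dep) (proj₁ (proj₂ dep)) _))
        where
        l∈F : ∀ i → l i ∈ F
        l∈F i with em (l i ∈ F)
        ... | inj₁ p = p
        ... | inj₂ p = ⊥-elim (none (i , p))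
        dep = dependent k (ℕ.m<m+n k 0<k) f l (spannedF ∘ l∈F)

      θ : Carrier
      θ = l (proj₁ outside)

      θ∉F : θ ∉ F
      θ∉F = proj₂ outside

      combine : Fin k ⊎ Fin k → Carrier
      combine (inj₁ i) = f i
      combine (inj₂ i) = θ * f i

      combine∈L : ∀ i → combine i ∈ L
      combine∈L (inj₁ i) = F⊆L (FB.inside i)
      combine∈L (inj₂ i) = L.has* (LB.inside _) (F⊆L (FB.inside i))

      in-F : ∀ {n} (q : Fin n → ℚ) (g : Fin n → Carrier) → (∀ i → g i ∈ F) → sum (λ i → ι (q i) * g i) ∈ F
      in-F {n} q g g∈F = IsAdditive.hasSum (subringAdditive (IsSubfield.isSubring F-field)) n
        λ i → F.has* (subfield-ι F-field (q i)) (g∈F i)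

      module _ {x} (x∈L : x ∈ L) where

        w : Fin (suc (k ℕ.+ k)) → Carrier
        w zero    = x
        w (suc i) = combine (Fin.splitAt k i)

        w∈L : ∀ i → w i ∈ L
        w∈L zero    = x∈L
        w∈L (suc i) = combine∈L (Fin.splitAt k i)

        -- In a dependence among x, the f i and the θ f i, a vanishing coefficient of x would leave
        -- A + B θ = 0 with A and B in `F`. As θ is not in `F`, both would vanish, and independence
        -- of f would make every coefficient 0. So one can divide by the coefficient of x.
        solved : Dependent w → ∃[ u ] ∃[ v ] u ∈ F × v ∈ F × x ≈ u + v * θ
        solved (q , rel , j , qj≢0) = result
          where
          α β : Fin k → ℚ
          α i = q (suc (i Fin.↑ˡ k))
          β i = q (suc (k Fin.↑ʳ i))

          A = sum λ i → ι (α i) * f i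
          B = sum λ i → ι (β i) * f i

          A∈F : A ∈ F
          A∈F = in-F α f FB.inside

          B∈F : B ∈ F
          B∈F = in-F β f FB.inside

          relation : ι (q zero) * x + (A + B * θ) ≈ 0#
          relation = trans (+-congˡ (begin
            A + B * θ
              ≈⟨ +-congˡ (trans (*-comm B θ) (*-sum k θ _)) ⟩
            A + sum (λ i → θ * (ι (β i) * f i))
              ≈⟨ +-cong (sum-cong k λ i → *-congˡ (reflexive (≡.cong combine (≡.sym (Fin.splitAt-↑ˡ k i k)))))
                        (sum-cong k λ i → trans (solve 3 (λ t b f → t :* (b :* f) := b :* (t :* f))
                            refl θ (ι (β i)) (f i))
                          (*-congˡ (reflexive (≡.cong combine (≡.sym (Fin.splitAt-↑ʳ k k i)))))) ⟩
            sum (λ i → ι (α i) * w (suc (i Fin.↑ˡ k))) + sum (λ i → ι (β i) * w (suc (k Fin.↑ʳ i)))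
              ≈⟨ sum-split k (λ i → ι (q (suc i)) * w (suc i)) ⟨
            sum (λ i → ι (q (suc i)) * w (suc i)) ∎)) rel

          coefficients≡0 : q zero ≡ 0ℚ → ∀ i → q i ≡ 0ℚ
          coefficients≡0 e zero = e
          coefficients≡0 e (suc i) = ≡.subst (λ i → q (suc i) ≡ 0ℚ) (Fin.join-splitAt k k i)
              (by-side (Fin.splitAt k i))
            where
            A+Bθ≈0 : A + B * θ ≈ 0#
            A+Bθ≈0 = begin
              A + B * θ                      ≈⟨ +-identityˡ _ ⟨
              0# + (A + B * θ)               ≈⟨ +-congʳ
                  (trans (*-congʳ (trans (ι.⟦⟧-cong e) ι.0#-homo)) (zeroˡ x)) ⟨
              ι (q zero) * x + (A + B * θ)   ≈⟨ relation ⟩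
              0#                             ∎

            B≈0 : B ≈ 0#
            B≈0 with em (B ≈ 0#)
            ... | inj₁ B≈0 = B≈0
            ... | inj₂ B≉0 with B⁻¹ , BB⁻¹≈1 ← inverse B B≉0 = ⊥-elim (θ∉F (F.resp (begin
              B⁻¹ * - A                             ≈⟨ solve 4
                  (λ i a b t → i :* (:- a) := (b :* i) :* t :- i :* (a :+ b :* t)) refl B⁻¹ A B θ ⟩
              B * B⁻¹ * θ - B⁻¹ * (A + B * θ)       ≈⟨ +-cong (trans (*-congʳ BB⁻¹≈1) (*-identityˡ θ))
                                                         (trans (-‿cong (trans (*-congˡ A+Bθ≈0) (zeroʳ _)))
                                                             -0#≈0#) ⟩
              θ + 0#                                ≈⟨ +-identityʳ θ ⟩
              θ                                     ∎)
              (F.has* (IsSubfield.hasInv F-field B∈F BB⁻¹≈1) (F.has- A∈F))))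

            A≈0 : A ≈ 0#
            A≈0 = begin
              A            ≈⟨ +-identityʳ A ⟨
              A + 0#       ≈⟨ +-congˡ (trans (*-congʳ B≈0) (zeroˡ θ)) ⟨
              A + B * θ    ≈⟨ A+Bθ≈0 ⟩
              0#           ∎

            by-side : (s : Fin k ⊎ Fin k) → q (suc (Fin.join k k s)) ≡ 0ℚ
            by-side (inj₁ i) = FB.independent α A≈0 i
            by-side (inj₂ i) = FB.independent β B≈0 i

          result : ∃[ u ] ∃[ v ] u ∈ F × v ∈ F × x ≈ u + v * θ
          result with q zero ℚ.≟ 0ℚ
          ... | yes e = ⊥-elim (qj≢0 (coefficients≡0 e j))
          ... | no q₀≢0 with c , e ← inverse (ι (q zero)) (λ e → q₀≢0 (ι-0 e)) =
            - c * A , - c * B , F.has* (F.has- c∈F) A∈F , F.has* (F.has- c∈F) B∈F , (begin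
              x
                ≈⟨ trans (*-congʳ e) (*-identityˡ x) ⟨
              ι (q zero) * c * x
                ≈⟨ solve 6 (λ q c x a b t → q :* c :* x := c :* (q :* x :+ (a :+ b :* t)) :+
                    ((:- c) :* a :+ (:- c) :* b :* t)) refl (ι (q zero)) c x A B θ ⟩
              c * (ι (q zero) * x + (A + B * θ)) + (- c * A + - c * B * θ)
                ≈⟨ +-congʳ (trans (*-congˡ relation) (zeroʳ c)) ⟩
              0# + (- c * A + - c * B * θ)
                ≈⟨ +-identityˡ _ ⟩
              - c * A + - c * B * θ ∎)
            where
            c∈F : c ∈ F
            c∈F = IsSubfield.hasInv F-field (subfield-ι F-field (q zero)) e

    generates : ∃[ θ ] Generates F L θ
    generates = θ , record
      { θ∈L = LB.inside _
      ; θ∉F = θ∉F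
      ; decompose = λ x∈L → solved x∈L (dependent (k ℕ.+ k) (ℕ.n<1+n _) l (w x∈L) (λ i → spannedL (w∈L x∈L i)))
      }

-- Relative integral bases of quadratic extensions

module QuadraticExtension (K : CharZeroField) where

  open CharZeroField K hiding (zero)
  open FieldTheory K
  open FieldProperties K
  open Integrality K
  open ClassNumber K
  open Rationals K
  open LinearAlgebra K
  open SetoidReasoning setoid

  -- 1 and ω form a basis of `𝒪 L` over `𝒪 F`; their independence is recorded as ω ∉ F.
  record IntegralGenerator (F L : Subset) (ω : Carrier) : Set where
    field
      ω∈𝒪L      : ω ∈ 𝒪 L
      ω∉F       : ω ∉ F
      decompose : ∀ {x} → x ∈ 𝒪 L → ∃[ u ] ∃[ v ] u ∈ 𝒪 F × v ∈ 𝒪 F × x ≈ u + v * ω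

  module _ (em : ExcludedMiddle) {F : Subset} (F-field : IsSubfield F) where

    private
      module F = IsSubring (IsSubfield.isSubring F-field)

    module Coordinates {θ} (θ∉F : θ ∉ F) where

      -- Dividing by a nonzero v would put θ = -u / v into `F`.
      v≈0 : ∀ {u v} → u ∈ F → v ∈ F → u + v * θ ≈ 0# → v ≈ 0#
      v≈0 {u} {v} u∈F v∈F e with em (v ≈ 0#)
      ... | inj₁ v≈0 = v≈0
      ... | inj₂ v≉0 with w , vw≈1 ← inverse v v≉0 = ⊥-elim (θ∉F (F.resp (begin
        w * - u                        ≈⟨ solve 4
            (λ w u v t → w :* (:- u) := (v :* w) :* t :- w :* (u :+ v :* t)) refl w u v θ ⟩
        v * w * θ - w * (u + v * θ)    ≈⟨ +-cong (trans (*-congʳ vw≈1) (*-identityˡ θ))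
                                            (trans (-‿cong (trans (*-congˡ e) (zeroʳ w))) -0#≈0#) ⟩
        θ + 0#                         ≈⟨ +-identityʳ θ ⟩
        θ                              ∎)
        (F.has* (IsSubfield.hasInv F-field v∈F vw≈1) (F.has- u∈F))))

      u≈0 : ∀ {u v} → u ∈ F → v ∈ F → u + v * θ ≈ 0# → u ≈ 0#
      u≈0 {u} {v} u∈F v∈F e = begin
        u            ≈⟨ +-identityʳ u ⟨
        u + 0#       ≈⟨ +-congˡ (trans (*-congʳ (v≈0 u∈F v∈F e)) (zeroˡ θ)) ⟨
        u + v * θ    ≈⟨ e ⟩
        0#           ∎

      private
        difference : ∀ {u v u′ v′} → u + v * θ ≈ u′ + v′ * θ → (u - u′) + (v - v′) * θ ≈ 0#
        difference {u} {v} {u′} {v′} e = trans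
          (solve 5 (λ u v u′ v′ t → (u :- u′) :+ (v :- v′) :* t := (u :+ v :* t) :- (u′ :+ v′ :* t))
              refl u v u′ v′ θ)
          (x≈y⇒x-y≈0 e)

      v-unique : ∀ {u v u′ v′} → u ∈ F → v ∈ F → u′ ∈ F → v′ ∈ F → u + v * θ ≈ u′ + v′ * θ → v ≈ v′
      v-unique u∈ v∈ u′∈ v′∈ e = x-y≈0⇒x≈y
        (v≈0 (F.has+ u∈ (F.has- u′∈)) (F.has+ v∈ (F.has- v′∈)) (difference e))

      θ≉0 : ¬ θ ≈ 0#
      θ≉0 e = θ∉F (F.resp (sym e) F.has0)

      ω∉F : ∀ {u v ω} → u ∈ F → v ∈ F → ¬ v ≈ 0# → ω ≈ u + v * θ → ω ∉ F
      ω∉F {u} {v} {ω} u∈ v∈ v≉0 e ω∈ = v≉0 (v-unique u∈ v∈ ω∈ F.has0 (begin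
        u + v * θ     ≈⟨ e ⟨
        ω             ≈⟨ +-identityʳ ω ⟨
        ω + 0#        ≈⟨ +-congˡ (zeroˡ θ) ⟨
        ω + 0# * θ    ∎))

    private
      infix 4 _∼⟨_⟩_

      -- y is the conjugate of x with respect to F when θ² ∈ F.
      _∼⟨_⟩_ : Carrier → Carrier → Carrier → Set
      x ∼⟨ θ ⟩ y = ∃[ u ] ∃[ v ] u ∈ F × v ∈ F × x ≈ u + v * θ × y ≈ u - v * θ

    module _ {θ} (θ∉F : θ ∉ F) (θ²∈F : θ * θ ∈ F) where

      private
        conjugate-+ : ∀ {x y x′ y′} → x ∼⟨ θ ⟩ x′ → y ∼⟨ θ ⟩ y′ → x + y ∼⟨ θ ⟩ x′ + y′
        conjugate-+ (u , v , u∈ , v∈ , e , e′) (s , t , s∈ , t∈ , d , d′) =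
          u + s , v + t , F.has+ u∈ s∈ , F.has+ v∈ t∈ ,
          trans (+-cong e d) (solve 5 (λ u v s t θ → (u :+ v :* θ) :+ (s :+ t :* θ) := (u :+ s) :+ (v :+ t)
              :* θ) refl u v s t θ) ,
          trans (+-cong e′ d′) (solve 5 (λ u v s t θ → (u :- v :* θ) :+ (s :- t :* θ) := (u :+ s) :-
              (v :+ t) :* θ) refl u v s t θ)

        conjugate-* : ∀ {x y x′ y′} → x ∼⟨ θ ⟩ x′ → y ∼⟨ θ ⟩ y′ → x * y ∼⟨ θ ⟩ x′ * y′
        conjugate-* (u , v , u∈ , v∈ , e , e′) (s , t , s∈ , t∈ , d , d′) =
          u * s + v * t * (θ * θ) , u * t + v * s ,
          F.has+ (F.has* u∈ s∈) (F.has* (F.has* v∈ t∈) θ²∈F) , F.has+ (F.has* u∈ t∈) (F.has* v∈ s∈) ,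
          trans (*-cong e d) (solve 5 (λ u v s t θ → (u :+ v :* θ) :* (s :+ t :* θ) :=
            (u :* s :+ v :* t :* (θ :* θ)) :+ (u :* t :+ v :* s) :* θ) refl u v s t θ) ,
          trans (*-cong e′ d′) (solve 5 (λ u v s t θ → (u :- v :* θ) :* (s :- t :* θ) :=
            (u :* s :+ v :* t :* (θ :* θ)) :- (u :* t :+ v :* s) :* θ) refl u v s t θ)

        conjugate-F : ∀ {u} → u ∈ F → u ∼⟨ θ ⟩ u
        conjugate-F {u} u∈ = u , 0# , u∈ , F.has0 ,
          sym (trans (+-congˡ (zeroˡ θ)) (+-identityʳ u)) ,
          sym (trans (+-congˡ (trans (-‿cong (zeroˡ θ)) -0#≈0#)) (+-identityʳ u))

        conjugate-^ : ∀ {x x′} n → x ∼⟨ θ ⟩ x′ → x ^ n ∼⟨ θ ⟩ x′ ^ n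
        conjugate-^ zero    c = conjugate-F F.has1
        conjugate-^ (suc n) c = conjugate-* c (conjugate-^ n c)

        conjugate-sum : ∀ n {f f′ : Fin n → Carrier} → (∀ i → f i ∼⟨ θ ⟩ f′ i) → sum f ∼⟨ θ ⟩ sum f′
        conjugate-sum zero    c = conjugate-F F.has0
        conjugate-sum (suc n) c = conjugate-+ (c zero) (conjugate-sum n (c ∘ suc))

        -- Conjugation is a relation, not a function; uniqueness of coordinates is what makes 0 its
        -- only value at 0.
        conjugate-0 : ∀ {x x′} → x ∼⟨ θ ⟩ x′ → x ≈ 0# → x′ ≈ 0#
        conjugate-0 {x} {x′} (u , v , u∈ , v∈ , e , e′) x≈0 = begin
          x′           ≈⟨ e′ ⟩
          u - v * θ    ≈⟨ +-cong (u≈0 u∈ v∈ e₀) (-‿cong (trans (*-congʳ (v≈0 u∈ v∈ e₀)) (zeroˡ θ))) ⟩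
          0# - 0#      ≈⟨ -‿inverseʳ 0# ⟩
          0#           ∎
          where
          open Coordinates θ∉F
          e₀ = trans (sym e) x≈0

      -- The coefficients of an integral equation lie in `F` and are their own conjugates, so x′
      -- satisfies the equation of x.
      conjugate-integral : ∀ {x x′} → x ∼⟨ θ ⟩ x′ → IsIntegral x → IsIntegral x′
      conjugate-integral {x} {x′} c (n , a , e) = n , a , conjugate-0
        (conjugate-+ (conjugate-^ n c) (conjugate-sum n λ i →
          conjugate-* (conjugate-F (subfield-ℤ F-field (a i))) (conjugate-^ (toℕ i) c))) e

    module _ {L} (L-field : IsSubfield L) (F⊆L : F ⊆ L)
             (integral-multiple : ∀ {x} → x ∈ L → ∃[ d ] ¬ d ≡ + 0 × IsIntegral (fromℤ d * x)) where

      private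
        module L = IsSubring (IsSubfield.isSubring L-field)
        module 𝒪F = IsSubring (𝒪-isSubring F-field)
        module I = IsSubring integral-isSubring

      affine-generator : ∀ {θ a b} → a ∈ F → b ∈ F → ¬ a ≈ 0# → Generates F L θ → Generates F L (a * θ + b)
      affine-generator {θ} {a} {b} a∈ b∈ a≉0 gen with c , ac≈1 ← inverse a a≉0 = record
        { θ∈L = L.has+ (L.has* (F⊆L a∈) θ∈L) (F⊆L b∈)
        ; θ∉F = Coordinates.ω∉F θ∉F b∈ a∈ a≉0 (+-comm _ _)
        ; decompose = λ {x} x∈L →
            let u , v , u∈ , v∈ , e = decompose x∈L
                c∈ = IsSubfield.hasInv F-field a∈ ac≈1
            in
            u - v * c * b , v * c , F.has+ u∈ (F.has- (F.has* (F.has* v∈ c∈) b∈)) , F.has* v∈ c∈ , (begin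
              x
                ≈⟨ e ⟩
              u + v * θ
                ≈⟨ +-congˡ (*-congˡ (trans (*-congʳ ac≈1) (*-identityˡ θ))) ⟨
              u + v * (a * c * θ)
                ≈⟨ solve 6 (λ u v a c t b → u :+ v :* (a :* c :* t) := (u :- v :* c :* b) :+ v :* c :*
                    (a :* t :+ b)) refl u v a c θ b ⟩
              u - v * c * b + v * c * (a * θ + b) ∎)
        }
        where open Generates gen

      -- Completing the square and clearing denominators.
      square-root-generator : ∀ {θ} → Generates F L θ → ∃[ η ] Generates F L η × η * η ∈ 𝒪 F
      square-root-generator {θ} gen = fromℤ d * η + 0# , affine-generator d∈ F.has0 (fromℤ-≉0 d≢0) η-gen ,
        𝒪F.resp (begin
          fromℤ d * (fromℤ d * (η * η))         ≈⟨ solve 2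
              (λ d h → d :* (d :* (h :* h)) := (d :* h) :* (d :* h)) refl (fromℤ d) η ⟩
          fromℤ d * η * (fromℤ d * η)           ≈⟨ *-cong (+-identityʳ _) (+-identityʳ _) ⟨
          (fromℤ d * η + 0#) * (fromℤ d * η + 0#)  ∎)
          (I.has* (integral-ℤ d) (proj₂ (proj₂ multiple)) , F.has* d∈ (F.has* d∈ η²∈F))
        where
        open Generates gen
        square = decompose (L.has* θ∈L θ∈L)
        s  = proj₁ square
        t  = proj₁ (proj₂ square)
        s∈ = proj₁ (proj₂ (proj₂ square))
        t∈ = proj₁ (proj₂ (proj₂ (proj₂ square)))
        e  = proj₂ (proj₂ (proj₂ (proj₂ square)))

        -- From θ² = s + t θ follows (2θ - t)² = 4 s + t². The factor 2 avoids halves.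
        η : Carrier
        η = fromℤ (+ 2) * θ + - t

        η-gen : Generates F L η
        η-gen = affine-generator (subfield-ℤ F-field (+ 2)) (F.has- t∈) (fromℤ-≉0 {+ 2} λ ()) gen

        η²∈F : η * η ∈ F
        η²∈F = F.resp (begin
          fromℤ (+ 4) * s + t * t
            ≈⟨ solve 3 (λ s t h → con (+ 4) :* s :+ t :* t := con (+ 4) :* ((s :+ t :* h) :- t :* h) :+ t :*
                t) refl s t θ ⟩
          fromℤ (+ 4) * (s + t * θ - t * θ) + t * t
            ≈⟨ +-congʳ (*-congˡ (+-congʳ e)) ⟨
          fromℤ (+ 4) * (θ * θ - t * θ) + t * t
            ≈⟨ solve 2 (λ t h → con (+ 4) :* (h :* h :- t :* h) :+ t :* t :=
                 (con (+ 2) :* h :+ (:- t)) :* (con (+ 2) :* h :+ (:- t))) refl t θ ⟩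
          η * η ∎)
          (F.has+ (F.has* (subfield-ℤ F-field (+ 4)) s∈) (F.has* t∈ t∈))

        multiple = integral-multiple (F⊆L η²∈F)
        d   = proj₁ multiple
        d≢0 = proj₁ (proj₂ multiple)
        d∈  = subfield-ℤ F-field d

      -- With θ² = D integral and x = u + v θ ∈ 𝒪 L, also 2 D v = θ (x − x′) is
      -- integral. The values 2 D v form an ideal of 𝒪 F, and any ω ∈ 𝒪 L for
      -- which 2 D v generates it will do.
      integralGenerator : AllPrincipal F → ∀ {θ} → Generates F L θ → ∃[ ω ] IntegralGenerator F L ω
      integralGenerator principal {θ₀} gen₀ = finish (principal A A-ideal (two D , θ-in-A , two-D≉0))
        where
        root = square-root-generator gen₀
        θ = proj₁ root
        D∈ = proj₂ (proj₂ root)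
        open Ideals F
        open Generates (proj₁ (proj₂ root))
        open Coordinates θ∉F

        D : Carrier
        D = θ * θ

        D∈F : D ∈ F
        D∈F = proj₂ D∈

        two : Carrier → Carrier
        two x = fromℤ (+ 2) * x

        two∈ : ∀ {x} → x ∈ F → two x ∈ F
        two∈ = F.has* (subfield-ℤ F-field (+ 2))

        A : Subset
        A a = ∃[ u ] ∃[ v ] u ∈ F × v ∈ F × IsIntegral (u + v * θ) × a ≈ two D * v

        inside : A ⊆ 𝒪 F
        inside {a} (u , v , u∈ , v∈ , int , e) =
          I.resp (begin
            θ * ((u + v * θ) - (u - v * θ))
              ≈⟨ solve 3 (λ u v t → t :* ((u :+ v :* t) :- (u :- v :* t)) := con (+ 2) :* (t :* t) :* v)
                  refl u v θ ⟩
            two D * v ≈⟨ e ⟨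
            a ∎) (I.has* (integral-√ (proj₁ D∈))
                (I.has+ int (I.has- (conjugate-integral θ∉F D∈F (u , v , u∈ , v∈ , refl , refl) int)))) ,
          F.resp (sym e) (F.has* (two∈ D∈F) v∈)

        A-ideal : IsIdeal A
        A-ideal = record
          { resp = λ { e (u , v , u∈ , v∈ , int , e′) → u , v , u∈ , v∈ , int , trans (sym e) e′ }
          ; inside = inside
          ; has0 = 0# , 0# , F.has0 , F.has0 , I.resp (sym (trans (+-identityˡ _) (zeroˡ θ))) I.has0 , sym
                  (zeroʳ _)
          ; has+ = λ { (u , v , u∈ , v∈ , int , e) (s , t , s∈ , t∈ , int′ , e′) →
              u + s , v + t , F.has+ u∈ s∈ , F.has+ v∈ t∈ ,
              I.resp (solve 5 (λ u v s t θ → (u :+ v :* θ) :+ (s :+ t :* θ) := (u :+ s) :+ (v :+ t) :* θ)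
                  refl u v s t θ) (I.has+ int int′) ,
              trans (+-cong e e′) (sym (distribˡ _ _ _)) }
          ; absorb = λ { {r} (r-int , r∈) (u , v , u∈ , v∈ , int , e) →
              r * u , r * v , F.has* r∈ u∈ , F.has* r∈ v∈ ,
              I.resp (solve 4 (λ r u v θ → r :* (u :+ v :* θ) := r :* u :+ r :* v :* θ)
                  refl r u v θ) (I.has* r-int int) ,
              trans (*-congˡ e) (solve 3 (λ r d v → r :* (d :* v) := d :* (r :* v)) refl r (two D) v) }
          }

        -- θ is itself integral, being a square root of the integral `D`; its coordinate v = 1
        -- supplies a nonzero member of `A`.
        θ-in-A : two D ∈ A
        θ-in-A = 0# , 1# , F.has0 , F.has1 , I.resp (sym (trans (+-identityˡ _) (*-identityˡ θ)))
            (integral-√ (proj₁ D∈)) , sym (*-identityʳ _)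

        two-D≉0 : ¬ two D ≈ 0#
        two-D≉0 = *-≉0 (fromℤ-≉0 {+ 2} λ ()) (*-≉0 θ≉0 θ≉0)

        finish : ∃[ g ] g ∈ A × A ⊆ multiples g (𝒪 F) → ∃[ ω ] IntegralGenerator F L ω
        finish (g , (u₀ , v₀ , u₀∈ , v₀∈ , ω-int , g≈) , A⊆) = ω , record
          { ω∈𝒪L = ω-int , ω∈L
          ; ω∉F = ω∉F u₀∈ v₀∈ v₀≉0 refl
          ; decompose = decomposeω
          }
          where
          ω = u₀ + v₀ * θ

          ω∈L : ω ∈ L
          ω∈L = L.has+ (F⊆L u₀∈) (L.has* (F⊆L v₀∈) θ∈L)

          v₀≉0 : ¬ v₀ ≈ 0#
          v₀≉0 v₀≈0 = let y , _ , e = A⊆ θ-in-A in two-D≉0 (begin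
            two D             ≈⟨ e ⟩
            g * y             ≈⟨ *-congʳ (trans g≈ (trans (*-congˡ v₀≈0) (zeroʳ _))) ⟩
            0# * y            ≈⟨ zeroˡ y ⟩
            0#                ∎)

          decomposeω : ∀ {x} → x ∈ 𝒪 L → ∃[ u ] ∃[ v ] u ∈ 𝒪 F × v ∈ 𝒪 F × x ≈ u + v * ω
          -- Since v = v₀ y, the θ-parts of x and y ω agree. Hence x - y ω = u - y u₀ lies in `F`,
          -- and it is integral as a difference of integral elements.
          decomposeω {x} (x-int , x∈L) = u - y * u₀ , y ,
            (I.resp (begin
                x - y * ω                     ≈⟨ +-congʳ x≈ ⟩
                u - y * u₀ + y * ω - y * ω    ≈⟨ solve 2 (λ a b → a :+ b :- b := a) refl _ _ ⟩
                u - y * u₀                    ∎) (I.has+ x-int (I.has- (I.has* (proj₁ y∈) ω-int))) ,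
              F.has+ u∈ (F.has- (F.has* (proj₂ y∈) u₀∈))) , y∈ , x≈
            where
            parts = decompose x∈L
            u = proj₁ parts
            v = proj₁ (proj₂ parts)
            u∈ = proj₁ (proj₂ (proj₂ parts))
            v∈ = proj₁ (proj₂ (proj₂ (proj₂ parts)))
            e = proj₂ (proj₂ (proj₂ (proj₂ parts)))

            quotient = A⊆ {two D * v} (u , v , u∈ , v∈ , I.resp e x-int , refl)
            y = proj₁ quotient
            y∈ = proj₁ (proj₂ quotient)

            v≈v₀y : v ≈ v₀ * y
            v≈v₀y = cancelˡ two-D≉0 (begin
              two D * v           ≈⟨ proj₂ (proj₂ quotient) ⟩
              g * y               ≈⟨ *-congʳ g≈ ⟩
              two D * v₀ * y      ≈⟨ *-assoc _ _ _ ⟩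
              two D * (v₀ * y)    ∎)

            x≈ : x ≈ u - y * u₀ + y * ω
            x≈ = begin
              x                        ≈⟨ e ⟩
              u + v * θ                ≈⟨ +-congˡ (*-congʳ v≈v₀y) ⟩
              u + v₀ * y * θ           ≈⟨ solve 5
                  (λ u v y t w → u :+ v :* y :* t := (u :- y :* w) :+ y :* (w :+ v :* t)) refl u v₀ y θ u₀ ⟩
              u - y * u₀ + y * ω       ∎

-- Prime elements and valuations over a principal ring of integers

module Valuations (K : CharZeroField) where

  open CharZeroField K hiding (zero)
  open FieldTheory K
  open FieldProperties K
  open ClassNumber K
  open Rationals K
  open SetoidReasoning setoid

  module OverPID (em : ExcludedMiddle) {F : Subset} (F-field : IsSubfield F) (principal : AllPrincipal F) where

    open Ideals F
    private
      module R = IsSubring (𝒪-isSubring F-field)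

    open Divisibility F-field

    record PrimeElement (P : Subset) (π : Carrier) : Set where
      field
        π∈        : π ∈ 𝒪 F
        π≉0       : ¬ π ≈ 0#
        nonunit   : ¬ π ∥ 1#
        prime     : ∀ {x y} → x ∈ 𝒪 F → y ∈ 𝒪 F → π ∥ x * y → π ∥ x ⊎ π ∥ y
        generates : P ≐ (π ∥_)

      π^∈ : ∀ n → π ^ n ∈ 𝒪 F
      π^∈ zero    = R.has1
      π^∈ (suc n) = R.has* π∈ (π^∈ n)

      power-generates : ∀ n → power P n ≐ (π ^ n ∥_)
      power-generates zero = (λ x∈ → _ , x∈ , sym (*-identityˡ _)) ,
          λ { (y , y∈ , e) → R.resp (sym (trans e (*-identityˡ y))) y∈ }
      power-generates (suc n) =
        product⊆ (∥-isIdeal (π^∈ (suc n))) (λ a∈ b∈ → ∥-* (proj₁ generates a∈) (proj₁ (power-generates n) b∈)) ,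
        λ { (y , y∈ , e) → ∈-power (proj₂ generates (1# , R.has1 , sym (*-identityʳ π)))
              (proj₂ (power-generates n) (y , y∈ , refl)) (trans e (*-assoc _ _ _)) }
        where
        ∈-power : ∀ {a b x} → a ∈ P → b ∈ power P n → x ≈ a * b → x ∈ power P (suc n)
        ∈-power a∈ b∈ e = let m , a , b , p , q , e′ = ∈-product {P} {power P n} a∈ b∈ in m , a , b , p ,
            q , trans e e′

    primeElement : ∀ {P} → IsPrimeIdeal P → IsNonzero P → ∃[ π ] PrimeElement P π
    primeElement {P} P-prime P≠0 with π , π∈P , P⊆ ← principal P (IsPrimeIdeal.isIdeal P-prime) P≠0 = π , record
        { π∈ = inside π∈P
        ; π≉0 = λ π≈0 → let x , x∈ , x≉0 = P≠0 ; y , _ , e = P⊆ x∈ in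
            x≉0 (trans e (trans (*-congʳ π≈0) (zeroˡ y)))
        ; nonunit = λ d → proper (⊆P d)
        ; prime = λ x∈ y∈ d → Sum.map P⊆ P⊆ (prime x∈ y∈ (⊆P d))
        ; generates = P⊆ , ⊆P
        }
      where
      open IsPrimeIdeal P-prime
      open IsIdeal isIdeal
      ⊆P : ∀ {x} → π ∥ x → x ∈ P
      ⊆P (y , y∈ , e) = resp (trans (*-comm _ _) (sym e)) (absorb y∈ π∈P)

    ∥-trans : ∀ {a b c} → a ∥ b → b ∥ c → a ∥ c
    ∥-trans (x , x∈ , e) (y , y∈ , e′) = x * y , R.has* x∈ y∈ , trans e′ (trans (*-congʳ e) (*-assoc _ _ _))

    -- If ρ = π u, then the prime ρ divides π or u. The former makes the two ideals equal, the
    -- latter makes π a unit.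
    ∥-distinct : ∀ {P Q π ρ} → PrimeElement P π → PrimeElement Q ρ → ¬ (P ≐ Q) → ¬ π ∥ ρ
    ∥-distinct {π = π} {ρ} π-prime ρ-prime P≢Q π∥ρ@(u , u∈ , ρ≈πu)
      with PrimeElement.prime ρ-prime (PrimeElement.π∈ π-prime) u∈
              (1# , R.has1 , trans (sym ρ≈πu) (sym (*-identityʳ ρ)))
    ... | inj₁ ρ∥π = P≢Q
      ( (λ x∈ → proj₂ ρ.generates (∥-trans ρ∥π (proj₁ π.generates x∈)))
      , (λ x∈ → proj₂ π.generates (∥-trans π∥ρ (proj₁ ρ.generates x∈))) )
      where
      module π = PrimeElement π-prime
      module ρ = PrimeElement ρ-prime
    ... | inj₂ (w , w∈ , u≈ρw) = PrimeElement.nonunit π-prime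
            (w , w∈ , cancelˡ (PrimeElement.π≉0 ρ-prime) (begin
      ρ * 1#         ≈⟨ *-identityʳ ρ ⟩
      ρ              ≈⟨ ρ≈πu ⟩
      π * u          ≈⟨ *-congˡ u≈ρw ⟩
      π * (ρ * w)    ≈⟨ solve 3 (λ p r w → p :* (r :* w) := r :* (p :* w)) refl π ρ w ⟩
      ρ * (π * w)    ∎))

    module _ {P π} (π-prime : PrimeElement P π) where

      open PrimeElement π-prime

      Valuation : Carrier → ℕ → Set
      Valuation g n = ∃[ h ] h ∈ 𝒪 F × g ≈ π ^ n * h × ¬ π ∥ h

      private
        -- k is fuel: π can be split off fewer than k times.
        extract : ∀ k {g} → g ∈ 𝒪 F → ¬ π ^ k ∥ g → ∃[ n ] Valuation g n
        extract zero    {g} g∈ ∤ = ⊥-elim (∤ (g , g∈ , sym (*-identityˡ g)))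
        extract (suc k) {g} g∈ ∤ with em (π ∥ g)
        ... | inj₂ π∤g = 0 , g , g∈ , sym (*-identityˡ g) , π∤g
        ... | inj₁ (g′ , g′∈ , e) with n , h , h∈ , e′ , π∤h ← extract k g′∈ (λ { (y , y∈ , d) →
                ∤ (y , y∈ , trans e (trans (*-congˡ d) (sym (*-assoc _ _ _)))) }) =
          suc n , h , h∈ , trans e (trans (*-congˡ e′) (sym (*-assoc _ _ _))) , π∤h

      -- The ideal of all x with g ∣ πᵏ x for some k is principal; an exponent
      -- that works for its generator bounds the valuation of g.
      valuation : ∀ {g} → g ∈ 𝒪 F → ¬ g ≈ 0# → ∃[ n ] Valuation g n
      valuation {g} g∈ g≉0 = bounded (principal J J-ideal (g , g∈J , g≉0))
        where
        J : Subset
        J x = x ∈ 𝒪 F × ∃[ k ] g ∥ π ^ k * x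

        module G = IsIdeal (∥-isIdeal g∈)

        g∈J : g ∈ J
        g∈J = g∈ , 0 , 1# , R.has1 , *-comm _ _

        J-ideal : IsIdeal J
        J-ideal = record
          { resp = λ { e (x∈ , k , p) → R.resp e x∈ , k , G.resp (*-congˡ e) p }
          ; inside = proj₁
          ; has0 = R.has0 , 0 , G.resp (sym (zeroʳ _)) G.has0
          ; has+ = λ { {x} {y} (x∈ , k , p) (y∈ , l , q) → R.has+ x∈ y∈ , k ℕ.+ l , G.resp (begin
              π ^ l * (π ^ k * x) + π ^ k * (π ^ l * y)
                ≈⟨ solve 4 (λ s t x y → t :* (s :* x) :+ s :* (t :* y) := s :* t :* (x :+ y))
                    refl (π ^ k) (π ^ l) x y ⟩
              π ^ k * π ^ l * (x + y)
                ≈⟨ *-congʳ (^-+ π k l) ⟨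
              π ^ (k ℕ.+ l) * (x + y) ∎) (G.has+ (G.absorb (π^∈ l) p) (G.absorb (π^∈ k) q)) }
          ; absorb = λ { {r} {x} r∈ (x∈ , k , p) → R.has* r∈ x∈ , k ,
              G.resp (solve 3 (λ r s x → r :* (s :* x) := s :* (r :* x)) refl r (π ^ k) x) (G.absorb r∈ p) }
          }

        bounded : ∃[ j ] j ∈ J × J ⊆ (j ∥_) → ∃[ n ] Valuation g n
        -- If g = π^(k+1) x, then x lies in `J`, so j divides x. As g divides π^k j, cancelling g
        -- would make π a unit.
        bounded (j , (j∈ , k , (t , t∈ , e)) , J⊆) = extract (suc k) g∈ λ { (x , x∈ , d) →
          let y , y∈ , c = J⊆ {x} (x∈ , suc k , 1# , R.has1 , trans (sym d) (sym (*-identityʳ g))) in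
          nonunit (t * y , R.has* t∈ y∈ , cancelˡ g≉0 (begin
            g * 1#                  ≈⟨ *-identityʳ g ⟩
            g                       ≈⟨ d ⟩
            π * π ^ k * x           ≈⟨ *-congˡ c ⟩
            π * π ^ k * (j * y)     ≈⟨ solve 4 (λ p s j y → p :* s :* (j :* y) := s :* j :* (p :* y))
                refl π (π ^ k) j y ⟩
            π ^ k * j * (π * y)     ≈⟨ *-congʳ e ⟩
            g * t * (π * y)         ≈⟨ solve 4 (λ g t p y → g :* t :* (p :* y) := g :* (p :* (t :* y)))
                refl g t π y ⟩
            g * (π * (t * y))       ∎)) }

      -- If b exceeded a, cancelling π ^ a in m g = f y would give π ∣ m h, against primality. The
      -- factor m leaves room for an integer prime to ℓ.
      valuation-≤ : ∀ {f g m a b} → Valuation f b → Valuation g a → m ∈ 𝒪 F → ¬ π ∥ m → f ∥ m * g → b ℕ.≤ a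
      valuation-≤ {f} {g} {m} {a} {b} (k , k∈ , f≈ , _) (h , h∈ , g≈ , π∤h) m∈ π∤m (y , y∈ , mg≈fy) with b
          ℕ.≤? a
      ... | yes b≤a = b≤a
      ... | no b≰a with c , ≡.refl ← ℕ.m≤n⇒∃[o]m+o≡n (ℕ.≰⇒> b≰a) = ⊥-elim (Sum.[ π∤m , π∤h ] (prime m∈ h∈
        (π ^ c * (k * y) , R.has* (π^∈ c) (R.has* k∈ y∈) , cancelˡ (^-≉0 a π≉0) (begin
          π ^ a * (m * h)                    ≈⟨ solve 3 (λ s m h → s :* (m :* h) := m :* (s :* h))
              refl (π ^ a) m h ⟩
          m * (π ^ a * h)                    ≈⟨ *-congˡ g≈ ⟨
          m * g                              ≈⟨ mg≈fy ⟩
          f * y                              ≈⟨ *-congʳ f≈ ⟩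
          π * π ^ (a ℕ.+ c) * k * y          ≈⟨ *-congʳ (*-congʳ (*-congˡ (^-+ π a c))) ⟩
          π * (π ^ a * π ^ c) * k * y        ≈⟨ solve 5
              (λ p s t k y → p :* (s :* t) :* k :* y := s :* (p :* (t :* (k :* y))))
                  refl π (π ^ a) (π ^ c) k y ⟩
          π ^ a * (π * (π ^ c * (k * y)))    ∎))))

      valuation-∥ : ∀ {f g a b} → Valuation f b → Valuation g a → f ∥ g → b ℕ.≤ a
      valuation-∥ vf vg (y , y∈ , e) = valuation-≤ vf vg R.has1 nonunit (y , y∈ , trans (*-identityˡ _) e)

      valuation-unique : ∀ {f g a b} → Valuation f a → Valuation g b → f ∥ g → g ∥ f → a ≡ b
      valuation-unique vf vg f∥g g∥f = ℕ.≤-antisym (valuation-∥ vf vg f∥g) (valuation-∥ vg vf g∥f)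

      -- For g = π^n h the cofactor of the n-th power of `P` is the ideal of multiples of h. A
      -- cofactor of the next power would give π^(n+1) ∣ g, hence π ∣ h.
      hasValuation : ∀ {I g n} → IsIdeal I → g ∈ I → I ⊆ (g ∥_) → Valuation g n → HasValuation P I n
      hasValuation {I} {g} {n} I-ideal g∈I I⊆ (h , h∈ , g≈ , π∤h) =
        ((h ∥_) , ∥-isIdeal h∈ , (λ x∈ → factor (I⊆ x∈)) , product⊆ {power P n} {h ∥_} {I} I-ideal unfactor) ,
        λ (C , C-ideal , I≐) → contradict {C} C-ideal (proj₁ I≐ g∈I)
        where
        open IsIdeal I-ideal
        factor : ∀ {x} → g ∥ x → x ∈ power P n · (h ∥_)
        factor {x} (y , y∈ , e) =
          let m , a , b , p , q , e′ = ∈-product {power P n} {h ∥_}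
                (proj₂ (power-generates n) (1# , R.has1 , sym (*-identityʳ _))) (y , y∈ , refl)
          in m , a , b , p , q , trans (trans e (trans (*-congʳ g≈) (*-assoc _ _ _))) e′

        unfactor : ∀ {a b} → a ∈ power P n → h ∥ b → a * b ∈ I
        unfactor a∈ h∥b = let y , y∈ , e = ∥-* (proj₁ (power-generates n) a∈) h∥b in
          resp (trans (*-comm y g) (trans (*-congʳ g≈) (sym e))) (absorb y∈ g∈I)

        contradict : ∀ {C} → IsIdeal C → ¬ g ∈ power P (suc n) · C
        contradict {C} C-ideal g∈ =
          let y , y∈ , e = product⊆ {power P (suc n)} {C} {π ^ suc n ∥_} (∥-isIdeal (π^∈ (suc n))) multiple
                  g∈ in
          π∤h (y , y∈ , cancelˡ (^-≉0 n π≉0) (begin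
            π ^ n * h            ≈⟨ g≈ ⟨
            g                    ≈⟨ e ⟩
            π * π ^ n * y        ≈⟨ solve 3 (λ p s y → p :* s :* y := s :* (p :* y)) refl π (π ^ n) y ⟩
            π ^ n * (π * y)      ∎))
          where
          multiple : ∀ {a b} → a ∈ power P (suc n) → b ∈ C → π ^ suc n ∥ a * b
          multiple {b = b} a∈ b∈ = let y , y∈ , e = proj₁ (power-generates (suc n)) a∈ in
            y * b , R.has* y∈ (IsIdeal.inside C-ideal b∈) , trans (*-congʳ e) (*-assoc _ _ _)

      cancel-prime : ∀ {a x y} → a ∈ 𝒪 F → x ∈ 𝒪 F → y ∈ 𝒪 F → ¬ π ∥ a → π * x ≈ a * y → a ∥ x
      cancel-prime {a} {x} {y} a∈ x∈ y∈ π∤a e with prime a∈ y∈ (x , x∈ , sym e)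
      ... | inj₁ π∥a = ⊥-elim (π∤a π∥a)
      ... | inj₂ (z , z∈ , y≈) = z , z∈ , cancelˡ π≉0 (begin
        π * x          ≈⟨ e ⟩
        a * y          ≈⟨ *-congˡ y≈ ⟩
        a * (π * z)    ≈⟨ solve 3 (λ a p z → a :* (p :* z) := p :* (a :* z)) refl a π z ⟩
        π * (a * z)    ∎)

      ∤-power : ∀ {a} → a ∈ 𝒪 F → ¬ π ∥ a → ∀ n → ¬ π ∥ a ^ n
      ∤-power a∈ π∤a zero    = nonunit
      ∤-power {a} a∈ π∤a (suc n) d with prime a∈ (a^∈ n) d
        where
        a^∈ : ∀ n → a ^ n ∈ 𝒪 F
        a^∈ zero    = R.has1
        a^∈ (suc n) = R.has* a∈ (a^∈ n)
      ... | inj₁ p = π∤a p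
      ... | inj₂ p = ∤-power a∈ π∤a n p

-- Localization at ℓ inside the field and in the tensor product

module LocalizationAt (K : CharZeroField) (ℓ : ℕ) (ℓ-prime : Prime ℓ) where

  open CharZeroField K hiding (zero)
  open FieldTheory K
  open FieldProperties K
  open Rationals K
  open Localization ℓ
  open SetoidReasoning setoid

  private
    module ℤₗ = AbelianGroup (ℤAdic-abelianGroup ℓ)
    instance _ = prime⇒nonZero ℓ-prime

  PrimeTo : ℕ → Set
  PrimeTo m = ¬ ℓ ℕ.∣ m

  1-primeTo : PrimeTo 1
  1-primeTo ℓ∣1 = ℕ.nonTrivial⇒≢1 {{prime⇒nonTrivial ℓ-prime}} (ℕ.∣1⇒≡1 ℓ∣1)

  *-primeTo : ∀ {m n} → PrimeTo m → PrimeTo n → PrimeTo (m ℕ.* n)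
  *-primeTo p q d = Sum.[ p , q ] (euclidsLemma _ _ ℓ-prime d)

  private
    cast : ∀ a b c d → 1 ℕ.+ c ℕ.* d ≡ a ℕ.* b → + a ℤ.* + b ≡ + 1 ℤ.+ + c ℤ.* + d
    cast a b c d e = ≡.trans (≡.sym (ℤ.pos-* a b))
      (≡.trans (≡.cong +_ (≡.sym e)) (≡.cong (ℤ._+_ (+ 1)) (ℤ.pos-* c d)))

  bézout : ∀ {m} → PrimeTo m → ∃[ s ] ∃[ t ] s ℤ.* + m ℤ.+ t ℤ.* + ℓ ≡ + 1
  bézout {m} ℓ∤m with ℕ.coprime-Bézout {ℓ} {m} coprime
    where
    coprime : ℕ.Coprime ℓ m
    coprime {d} (d∣ℓ , d∣m) with prime⇒irreducible ℓ-prime d∣ℓ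
    ... | inj₁ d≡1    = d≡1
    ... | inj₂ ≡.refl = ⊥-elim (ℓ∤m d∣m)
  ... | ℕ.Bézout.+- x y e = ℤ.- + y , + x , ≡.trans
    (≡.cong (λ z → ℤ.- + y ℤ.* + m ℤ.+ z) (cast x ℓ y m e))
    (ℤS.solve 2 (λ y m → (ℤS.:- y) ℤS.:* m ℤS.:+ (ℤS.con (+ 1) ℤS.:+ y ℤS.:* m) ℤS.:= ℤS.con (+ 1)) ≡.refl
        (+ y) (+ m))
  ... | ℕ.Bézout.-+ x y e = + y , ℤ.- + x , ≡.trans
    (≡.cong (λ z → z ℤ.+ ℤ.- + x ℤ.* + ℓ) (cast y m x ℓ e))
    (ℤS.solve 2 (λ x l → ℤS.con (+ 1) ℤS.:+ x ℤS.:* l ℤS.:+ (ℤS.:- x) ℤS.:* l ℤS.:= ℤS.con (+ 1)) ≡.refl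
        (+ x) (+ ℓ))

  prime-part : ∀ n → ¬ n ≡ 0 → ∃[ k ] ∃[ m ] PrimeTo m × n ≡ ℓ ℕ.^ k ℕ.* m
  prime-part n = go (ℕ.<-wellFounded n)
    where
    go : ∀ {n} → Acc ℕ._<_ n → ¬ n ≡ 0 → ∃[ k ] ∃[ m ] PrimeTo m × n ≡ ℓ ℕ.^ k ℕ.* m
    go {n} (acc rs) n≢0 with ℓ ℕ.∣? n
    ... | no ℓ∤n = 0 , n , ℓ∤n , ≡.sym (ℕ.*-identityˡ n)
    ... | yes (ℕ.divides q ≡.refl) =
      let k , m , p , e = go (rs q<n) q≢0
      in suc k , m , p , ≡.trans (≡.cong (ℕ._* ℓ) e)
              (≡.trans (ℕ.*-comm (ℓ ℕ.^ k ℕ.* m) ℓ) (≡.sym (ℕ.*-assoc ℓ (ℓ ℕ.^ k) m)))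
      where
      q≢0 : ¬ q ≡ 0
      q≢0 ≡.refl = n≢0 ≡.refl
      q<n : q ℕ.< q ℕ.* ℓ
      q<n = ℕ.m<m*n q ℓ {{ℕ.≢-nonZero q≢0}} (ℕ.nonTrivial⇒n>1 ℓ {{prime⇒nonTrivial ℓ-prime}})

  -- The subset S ⊗ ℤ₍ₗ₎ of K.
  Local : Subset → Subset
  Local S x = ∃[ m ] PrimeTo m × fromℤ (+ m) * x ∈ S

  -- Full rank is expressed by multiples alone: every x has a denominator with respect to `S`. This
  -- is the form in which `negligible` uses it.
  record IsLattice (S : Subset) : Set where
    field
      isAdditive : IsAdditive S
      absorbing  : ∀ x → ∃[ d ] ¬ d ≡ + 0 × fromℤ d * x ∈ S

  order-isLattice : ∀ {O} → IsOrder O → IsLattice O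
  order-isLattice ord = record
    { isAdditive = subringAdditive isSubring
    ; absorbing = λ x → let q , e = IsℚBasis.spanning basis {x} _
                            d , d≢0 , (c ℤSpan., e′) = clear-denominators (q ℚSpan., e)
                        in d , d≢0 , proj₂ eq (c , e′)
    }
    where
    open IsOrder ord
    basis = proj₁ (proj₂ (proj₂ lattice))
    eq = proj₂ (proj₂ (proj₂ lattice))

  module _ {S : Subset} (S-additive : IsAdditive S) where

    private module S = IsAdditive S-additive

    local-⊇ : S ⊆ Local S
    local-⊇ {x} x∈ = 1 , 1-primeTo , S.hasℕ 1 x∈

    local-additive : IsAdditive (Local S)
    local-additive = record
      { resp = λ { e (m , p , q) → m , p , S.resp (*-congˡ e) q }
      ; has0 = 1 , 1-primeTo , S.resp (sym (zeroʳ _)) S.has0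
      ; has+ = λ { {x} {y} (m , p , q) (n , p′ , q′) → m ℕ.* n , *-primeTo p p′ , S.resp (begin
          fromℤ (+ n) * (fromℤ (+ m) * x) + fromℤ (+ m) * (fromℤ (+ n) * y)
            ≈⟨ solve 4 (λ n m x y → n :* (m :* x) :+ m :* (n :* y) := (m :* n) :* (x :+ y))
                refl (fromℤ (+ n)) (fromℤ (+ m)) x y ⟩
          fromℤ (+ m) * fromℤ (+ n) * (x + y)
            ≈⟨ *-congʳ (fromℤ-pos-* m n) ⟨
          fromℤ (+ (m ℕ.* n)) * (x + y) ∎) (S.has+ (S.hasℕ n q) (S.hasℕ m q′)) }
      ; has- = λ { (m , p , q) → m , p , S.resp (-‿distribʳ-* _ _) (S.has- q) }
      }

  -- Division of the ℓ-adic integer a by an integer m with s m + t ℓ = 1: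
  -- modulo ℓⁿ an inverse of m is s (1 + tℓ + ⋯ + (tℓ)ⁿ⁻¹).
  module _ m s t (id : s ℤ.* + m ℤ.+ t ℤ.* + ℓ ≡ + 1) where

    private
      inv : ℕ → ℤ
      inv zero    = + 0
      inv (suc n) = s ℤ.+ t ℤ.* + ℓ ℤ.* inv n

      1∣ : ∀ z → + 1 ∣ z
      1∣ z = divides z (≡.sym (ℤ.*-identityʳ z))

      ∣-step : ∀ n {z} → + (ℓ ℕ.^ n) ∣ z → + (ℓ ℕ.^ suc n) ∣ t ℤ.* + ℓ ℤ.* z
      ∣-step n (divides q ≡.refl) = divides (t ℤ.* q) (≡.trans
        (ℤS.solve 4 (λ t l q p → t ℤS.:* l ℤS.:* (q ℤS.:* p) ℤS.:= t ℤS.:* q ℤS.:* (l ℤS.:* p)) ≡.refl t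
            (+ ℓ) q (+ (ℓ ℕ.^ n)))
        (≡.cong (t ℤ.* q ℤ.*_) (≡.sym (ℤ.pos-* ℓ (ℓ ℕ.^ n)))))

      inv-coherent : ∀ n → + (ℓ ℕ.^ n) ∣ inv (suc n) ℤ.- inv n
      inv-coherent zero    = 1∣ (inv 1 ℤ.- inv 0)
      inv-coherent (suc n) = ≡.subst (_ ∣_)
        (ℤS.solve 4 (λ s c x y → c ℤS.:* (x ℤS.:- y) ℤS.:= (s ℤS.:+ c ℤS.:* x) ℤS.:- (s ℤS.:+ c ℤS.:* y))
            ≡.refl s (t ℤ.* + ℓ) (inv (suc n)) (inv n))
        (∣-step n (inv-coherent n))

      inv-inverse : ∀ n → + (ℓ ℕ.^ n) ∣ + m ℤ.* inv n ℤ.- + 1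
      inv-inverse zero    = 1∣ (+ m ℤ.* inv 0 ℤ.- + 1)
      inv-inverse (suc n) = ≡.subst (_ ∣_) (≡.trans
        (ℤS.solve 4 (λ m s c u → c ℤS.:* (m ℤS.:* u ℤS.:- ℤS.con (+ 1)) ℤS.:= m ℤS.:* (s ℤS.:+ c ℤS.:* u)
            ℤS.:- (s ℤS.:* m ℤS.:+ c)) ≡.refl (+ m) s (t ℤ.* + ℓ) (inv n))
        (≡.cong (λ z → + m ℤ.* inv (suc n) ℤ.- z) id))
        (∣-step n (inv-inverse n))

    divide : ℤAdic ℓ → ℤAdic ℓ
    divide a = record
      { seq = λ n → inv n ℤ.* seq a n
      ; coherent = λ n → ≡.subst (_ ∣_)
          (ℤS.solve 4 (λ u u′ a a′ → u′ ℤS.:* (a′ ℤS.:- a) ℤS.:+ a ℤS.:* (u′ ℤS.:- u) ℤS.:= u′ ℤS.:* a′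
              ℤS.:- u ℤS.:* a)
            ≡.refl (inv n) (inv (suc n)) (seq a n) (seq a (suc n)))
          (∣m∣n⇒∣m+n (∣n⇒∣m*n (inv (suc n)) (coherent a n)) (∣n⇒∣m*n (seq a n) (inv-coherent n)))
      }
      where open ℤAdic

    divide-spec : ∀ a n → + (ℓ ℕ.^ n) ∣ + m ℤ.* ℤAdic.seq (divide a) n ℤ.- ℤAdic.seq a n
    divide-spec a n = ≡.subst (_ ∣_)
      (ℤS.solve 3 (λ m u a → a ℤS.:* (m ℤS.:* u ℤS.:- ℤS.con (+ 1)) ℤS.:= m ℤS.:* (u ℤS.:* a) ℤS.:- a)
          ≡.refl (+ m) (inv n) (ℤAdic.seq a n))
      (∣n⇒∣m*n (ℤAdic.seq a n) (inv-inverse n))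

  private
    -- (1 + m) b
    times : ℕ → ℤAdic ℓ → ℤAdic ℓ
    times zero    b = b
    times (suc m) b = b ℤₗ.∙ times m b

    seq-times : ∀ m b n → ℤAdic.seq (times m b) n ≡ + suc m ℤ.* ℤAdic.seq b n
    seq-times zero    b n = ≡.sym (ℤ.*-identityˡ _)
    seq-times (suc m) b n = ≡.trans (≡.cong (ℤ._+_ (ℤAdic.seq b n)) (seq-times m b n))
      (≡.sym (ℤ.suc-* (+ suc m) (ℤAdic.seq b n)))

    ⊗-times : ∀ m x b → [ fromℤ (+ suc m) * x , b ] ≋ [ x , times m b ]
    ⊗-times zero    x b = ⊗-cong (trans (*-congʳ fromℤ-1) (*-identityˡ x)) (ℤₗ.refl {b})
    ⊗-times (suc m) x b = ≋-trans (⊗-cong (begin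
        fromℤ (+ suc (suc m)) * x               ≈⟨ *-congʳ (fromℤ-+ (+ 1) (+ suc m)) ⟩
        (fromℤ (+ 1) + fromℤ (+ suc m)) * x     ≈⟨ solve 2 (λ a x → (con (+ 1) :+ a) :* x := x :+ a :* x)
            refl _ x ⟩
        x + fromℤ (+ suc m) * x                 ∎) (ℤₗ.refl {b}))
      (≋-trans (⊗-addˡ x (fromℤ (+ suc m) * x) b)
      (≋-trans (++-cong {[ x , b ]} ≋-refl (⊗-times m x b)) (≋-sym (⊗-addʳ x b (times m b)))))

    -- m is a unit of ℤ_ℓ, so x ⊗ a = x ⊗ m b = m x ⊗ b with b = a / m.
    ⊗-divide : ∀ {m} → PrimeTo m → ∀ x a → ∃[ b ] [ x , a ] ≋ [ fromℤ (+ m) * x , b ]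
    ⊗-divide {zero}  p x a = ⊥-elim (p (ℓ ℕ.∣0))
    ⊗-divide {suc m} p x a with s , t , id ← bézout p = b ,
      ≋-sym (≋-trans (⊗-times m x b) (⊗-cong refl λ n →
        ≡.subst (λ z → _ ∣ z ℤ.- ℤAdic.seq a n) (≡.sym (seq-times m b n)) (divide-spec (suc m) s t id a n)))
      where b = divide (suc m) s t id a

  -- Each pure tensor is treated separately: the multiplier that brings its first factor into `Y` is
  -- compensated by dividing the second one.
  localize-mono : ∀ {X Y} → X ⊆ Local Y → localize X ⊆ localize Y
  localize-mono {X} {Y} X⊆ (s , s∈X , t≋s) = let s′ , s′∈Y , e = move s∈X in s′ , s′∈Y , ≋-trans t≋s e
    where
    move : ∀ {s} → All (λ p → proj₁ p ∈ X) s → ∃[ s′ ] All (λ p → proj₁ p ∈ Y) s′ × s ≋ s′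
    move [] = [] , [] , ≋-refl
    move {(x , a) ∷ s} (x∈ ∷ s∈) with m , p , mx∈ ← X⊆ x∈ with b , e ← ⊗-divide p x a with s′ , s′∈ , e′ ←
        move s∈ =
      (fromℤ (+ m) * x , b) ∷ s′ , mx∈ ∷ s′∈ , ++-cong e e′

  -- An element of K ⊗ ℤₗ has a value in K modulo each ℓⁿ; for large n it is
  -- well defined modulo Local Y.
  module _ {Y : Subset} (Y-lattice : IsLattice Y) where

    private
      open IsLattice Y-lattice
      module Y = IsAdditive isAdditive
      module L = IsAdditive (local-additive isAdditive)

      eval : ℕ → K⊗ℤₗ → Carrier
      eval n []            = 0#
      eval n ((x , a) ∷ s) = fromℤ (ℤAdic.seq a n) * x + eval n s

      eval-++ : ∀ n s t → eval n (s ++ t) ≈ eval n s + eval n t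
      eval-++ n []            t = sym (+-identityˡ _)
      eval-++ n ((x , a) ∷ s) t = trans (+-congˡ (eval-++ n s t)) (sym (+-assoc _ _ _))

      Eventually : (ℕ → Set) → Set
      Eventually P = ∃[ N ] ∀ n → N ℕ.≤ n → P n

      -- Let ℓ^k m, with m prime to ℓ, be a denominator of x. For n ≥ k a multiple of ℓ^n clears its
      -- ℓ-part, and `Local` allows the remaining m. The bound depends on x.
      negligible : ∀ x → Eventually λ n → ∀ {z} → + (ℓ ℕ.^ n) ∣ z → fromℤ z * x ∈ Local Y
      negligible x with d , d≢0 , dx∈ ← absorbing x
                   with k , m , p , e ← prime-part ℤ.∣ d ∣ (d≢0 ∘ ℤ.∣i∣≡0⇒i≡0) = k ,
                           λ { n k≤n {z} (divides q ≡.refl) →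
          let r = + (ℓ ℕ.^ (n ℕ.∸ k)) in
          L.resp (trans (sym (*-assoc _ _ _)) (*-congʳ
              (trans (sym (fromℤ-* (q ℤ.* r) (+ (ℓ ℕ.^ k)))) (reflexive (≡.cong fromℤ (exponent q k≤n))))))
            (L.hasℤ (q ℤ.* r) (m , p , Y.resp (begin
              fromℤ (+ ℤ.∣ d ∣) * x                         ≡⟨ ≡.cong (λ j → fromℤ (+ j) * x) e ⟩
              fromℤ (+ (ℓ ℕ.^ k ℕ.* m)) * x                 ≈⟨ *-congʳ (fromℤ-pos-* (ℓ ℕ.^ k) m) ⟩
              fromℤ (+ (ℓ ℕ.^ k)) * fromℤ (+ m) * x         ≈⟨ solve 3
                  (λ a m x → a :* m :* x := m :* (a :* x)) refl _ _ x ⟩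
              fromℤ (+ m) * (fromℤ (+ (ℓ ℕ.^ k)) * x)       ∎) (absolute d dx∈))) }
        where
        exponent : ∀ {k n} q → k ℕ.≤ n → q ℤ.* + (ℓ ℕ.^ (n ℕ.∸ k)) ℤ.* + (ℓ ℕ.^ k) ≡ q ℤ.* + (ℓ ℕ.^ n)
        exponent {k} {n} q k≤n = ≡.trans (ℤ.*-assoc q _ _)
            (≡.cong (q ℤ.*_) (≡.trans (≡.sym (ℤ.pos-* (ℓ ℕ.^ (n ℕ.∸ k)) (ℓ ℕ.^ k)))
          (≡.cong +_ (≡.trans (≡.sym (ℕ.^-distribˡ-+-* ℓ (n ℕ.∸ k) k)) (≡.cong (ℓ ℕ.^_) (ℕ.m∸n+n≡m k≤n))))))

        absolute : ∀ d → fromℤ d * x ∈ Y → fromℤ (+ ℤ.∣ d ∣) * x ∈ Y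
        absolute (+ n)    p = p
        absolute -[1+ n ] p = Y.resp (trans (-‿distribˡ-* _ _) (*-congʳ (sym (fromℤ-neg -[1+ n ])))) (Y.has- p)

      -- Only `⊗-cong` forces n to be large: equal ℓ-adic integers agree at level n merely modulo
      -- ℓ^n, an error that `negligible` absorbs. A derivation is finite, so the maximum of its
      -- bounds exists.
      invariant : ∀ {s t} → s ≋ t → Eventually λ n → eval n s - eval n t ∈ Local Y
      invariant ≋-refl = 0 , λ n _ → L.resp (sym (-‿inverseʳ _)) L.has0
      invariant (≋-sym p) = let N , h = invariant p in N , λ n N≤n →
        L.resp (solve 2 (λ a b → :- (a :- b) := b :- a) refl _ _) (L.has- (h n N≤n))
      invariant (≋-trans p q) = let N , h = invariant p ; N′ , h′ = invariant q in
        N ℕ.⊔ N′ , λ n N≤n → L.resp (solve 3 (λ a b c → (a :- b) :+ (b :- c) := a :- c) refl _ _ _)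
          (L.has+ (h n (ℕ.m⊔n≤o⇒m≤o N N′ N≤n)) (h′ n (ℕ.m⊔n≤o⇒n≤o N N′ N≤n)))
      invariant (++-cong {s} {s′} {t} {t′} p q) = let N , h = invariant p ; N′ , h′ = invariant q in
        N ℕ.⊔ N′ , λ n N≤n → L.resp (begin
            eval n s - eval n s′ + (eval n t - eval n t′)
              ≈⟨ solve 4 (λ a b c d → (a :- b) :+ (c :- d) := (a :+ c) :- (b :+ d))
                  refl (eval n s) (eval n s′) (eval n t) (eval n t′) ⟩
            eval n s + eval n t - (eval n s′ + eval n t′)
              ≈⟨ +-cong (eval-++ n s t) (-‿cong (eval-++ n s′ t′)) ⟨
            eval n (s ++ t) - eval n (s′ ++ t′) ∎)
          (L.has+ (h n (ℕ.m⊔n≤o⇒m≤o N N′ N≤n)) (h′ n (ℕ.m⊔n≤o⇒n≤o N N′ N≤n)))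
      invariant (++-comm s t) = 0 , λ n _ → L.resp (sym (x≈y⇒x-y≈0 (begin
        eval n (s ++ t)          ≈⟨ eval-++ n s t ⟩
        eval n s + eval n t      ≈⟨ +-comm _ _ ⟩
        eval n t + eval n s      ≈⟨ eval-++ n t s ⟨
        eval n (t ++ s)          ∎))) L.has0
      invariant (⊗-cong {x} {x′} {b} {b′} e p) = let N , h = negligible x in N , λ n N≤n →
        L.resp (begin
          fromℤ (ℤAdic.seq b n ℤ.- ℤAdic.seq b′ n) * x
            ≈⟨ *-congʳ (trans (fromℤ-+ (ℤAdic.seq b n) (ℤ.- ℤAdic.seq b′ n))
                (+-congˡ (fromℤ-neg (ℤAdic.seq b′ n)))) ⟩
          (fromℤ (ℤAdic.seq b n) - fromℤ (ℤAdic.seq b′ n)) * x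
            ≈⟨ solve 3 (λ b c x → (b :- c) :* x := (b :* x :+ con (+ 0)) :- (c :* x :+ con (+ 0))) refl _ _ x ⟩
          (fromℤ (ℤAdic.seq b n) * x + fromℤ (+ 0)) - (fromℤ (ℤAdic.seq b′ n) * x + fromℤ (+ 0))
            ≈⟨ +-cong (+-congˡ fromℤ-0) (-‿cong (+-cong (*-congˡ e) fromℤ-0)) ⟩
          eval n [ x , b ] - eval n [ x′ , b′ ] ∎) (h n N≤n (p n))
      invariant (⊗-addˡ x x′ b) = 0 , λ n _ → L.resp
          (sym (x≈y⇒x-y≈0 (trans (+-congʳ (distribˡ _ _ _)) (+-assoc _ _ _)))) L.has0
      invariant (⊗-addʳ x b b′) = 0 , λ n _ → L.resp (sym (x≈y⇒x-y≈0
        (trans (+-congʳ (trans (*-congʳ (fromℤ-+ (ℤAdic.seq b n) (ℤAdic.seq b′ n))) (distribʳ _ _ _)))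
            (+-assoc _ _ _)))) L.has0
      invariant (⊗-zeroˡ b) = 0 , λ n _ → L.resp (sym (x≈y⇒x-y≈0 (trans (+-identityʳ _) (zeroʳ _)))) L.has0

      eval∈ : ∀ n {s} → All (λ p → proj₁ p ∈ Y) s → eval n s ∈ Y
      eval∈ n []                     = Y.has0
      eval∈ n {(x , a) ∷ s} (p ∷ ps) = Y.has+ (Y.hasℤ (ℤAdic.seq a n) p) (eval∈ n ps)

      oneₗ : ℤAdic ℓ
      oneₗ = record { seq = λ _ → + 1 ; coherent = λ n → divides (+ 0) ≡.refl }

    -- x ⊗ 1 evaluates to x at every level, and a sum of tensors over `Y` evaluates into `Y`. At a
    -- high level the two values differ by an element of `Local Y`.
    localize-reflects : ∀ {X} → localize X ⊆ localize Y → X ⊆ Local Y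
    localize-reflects X≤Y {x} x∈ with s , s∈ , e ← X≤Y ([ x , oneₗ ] , x∈ ∷ [] , ≋-refl) with N , h ←
        invariant e =
      L.resp (begin
        eval N [ x , oneₗ ] - eval N s + eval N s    ≈⟨ solve 2 (λ a b → a :- b :+ b := a) refl _ _ ⟩
        eval N [ x , oneₗ ]                          ≈⟨ trans (+-identityʳ _)
            (trans (*-congʳ fromℤ-1) (*-identityˡ x)) ⟩
        x                                            ∎)
      (L.has+ (h N ℕ.≤-refl) (local-⊇ isAdditive (eval∈ N s∈)))

-- Rings between the integers of K₀ and those of K

module QuarticOrders (K : CharZeroField) where

  open CharZeroField K hiding (zero)
  open FieldTheory K
  open FieldProperties K
  open Integrality K
  open ClassNumber K
  open Rationals K
  open QuadraticExtension K
  open SetoidReasoning setoid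

  module Relative (em : ExcludedMiddle) {K₀ : Subset} (K₀-field : IsSubfield K₀) (principal : AllPrincipal K₀)
           (integral-multiple : ∀ x → ∃[ d ] ¬ d ≡ + 0 × IsIntegral (fromℤ d * x))
           {ω₀ ω : Carrier} (gen₀ : IntegralGenerator ℚ-subfield K₀ ω₀) (gen : IntegralGenerator K₀ U ω) where

    open Ideals K₀
    open Divisibility K₀-field
    private
      module F  = IsSubring (IsSubfield.isSubring K₀-field)
      module 𝒪₀ = IsSubring (𝒪-isSubring K₀-field)
      module I  = IsSubring integral-isSubring
      module ω₀ = IntegralGenerator gen₀
      module ω  = IntegralGenerator gen
      open Coordinates em K₀-field ω.ω∉F

    𝒪₀⊆𝒪 : 𝒪 K₀ ⊆ 𝒪 U
    𝒪₀⊆𝒪 (x-int , _) = x-int , _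

    -- A factor r passes to the test element, (r x) y = x (r y), where r y is again integral. So
    -- this also covers the given order, which need not contain `𝒪 K₀`.
    𝔣-isIdeal : ∀ {R} → IsAdditive R → IsIdeal (𝔣 K₀ R)
    𝔣-isIdeal R-additive = record
      { resp = λ { e ((x∈ , c) , x∈₀) → (O.resp e x∈ , λ y y∈ → resp (*-congʳ e) (c y y∈)) , 𝒪₀.resp e x∈₀ }
      ; inside = proj₂
      ; has0 = (O.has0 , λ y y∈ → resp (sym (zeroˡ y)) has0) , 𝒪₀.has0
      ; has+ = λ { ((x∈ , c) , x∈₀) ((y∈ , d) , y∈₀) →
          (O.has+ x∈ y∈ , λ z z∈ → resp (sym (distribʳ z _ _)) (has+ (c z z∈) (d z z∈))) , 𝒪₀.has+ x∈₀ y∈₀ }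
      ; absorb = λ { {r} {x} r∈ ((x∈ , c) , x∈₀) →
          (O.has* (𝒪₀⊆𝒪 r∈) x∈ , λ y y∈ → resp (solve 3 (λ r x y → x :* (r :* y) := r :* x :* y) refl r x y)
            (c (r * y) (O.has* (𝒪₀⊆𝒪 r∈) y∈))) , 𝒪₀.has* r∈ x∈₀ }
      }
      where
      open IsAdditive R-additive
      module O = IsSubring (𝒪-isSubring {U} U-isSubfield)

    multiple-∉ : ∀ {f} → f ∈ K₀ → ¬ f ≈ 0# → f * ω ∉ K₀
    multiple-∉ f∈ f≉0 = ω∉F F.has0 f∈ f≉0 (sym (+-identityˡ _))

    -- `outside` stands in for full rank: it excludes rings inside `K₀` and makes 𝔣 nonzero. That
    -- `R` is then an order is `intermediate-isOrder`.
    record Intermediate (R : Subset) : Set where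
      field
        isSubring : IsSubring R
        contains  : 𝒪 K₀ ⊆ R
        bounded   : R ⊆ 𝒪 U
        outside   : ∃[ x ] x ∈ R × x ∉ K₀

      open IsSubring isSubring public

      -- Testing the conductor on ω suffices, because 1 and ω generate `𝒪 U` over `𝒪 K₀`, which `R`
      -- contains.
      ∈-𝔣 : ∀ {c} → c ∈ 𝒪 K₀ → c * ω ∈ R → c ∈ 𝔣 K₀ R
      ∈-𝔣 {c} c∈ cω∈ = (𝒪₀⊆𝒪 c∈ , λ y y∈ → let u , v , u∈ , v∈ , e = ω.decompose y∈ in resp (begin
          c * u + v * (c * ω)  ≈⟨ solve 4 (λ c u v w → c :* u :+ v :* (c :* w) := c :* (u :+ v :* w))
              refl c u v ω ⟩
          c * (u + v * ω)      ≈⟨ *-congˡ e ⟨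
          c * y                ∎)
          (has+ (has* (contains c∈) (contains u∈)) (has* (contains v∈) cω∈))) , c∈

      -- Subtracting u, which `R` contains, leaves v ω in `R`; hence v conducts.
      coordinates : ∀ {x} → x ∈ R → ∃[ u ] ∃[ v ] u ∈ 𝒪 K₀ × v ∈ 𝔣 K₀ R × x ≈ u + v * ω
      coordinates {x} x∈ = let u , v , u∈ , v∈ , e = ω.decompose (bounded x∈) in u , v , u∈ , ∈-𝔣 v∈
          (resp (begin
        x - u              ≈⟨ +-congʳ e ⟩
        u + v * ω - u      ≈⟨ solve 2 (λ u b → u :+ b :- u := b) refl u _ ⟩
        v * ω              ∎) (has+ x∈ (has- (contains u∈)))) , e

      ideal : IsIdeal (𝔣 K₀ R)
      ideal = 𝔣-isIdeal {R} (subringAdditive isSubring)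

      nonzero : IsNonzero (𝔣 K₀ R)
      nonzero =
        let x , x∈ , x∉ = outside
            u , v , u∈ , v∈ , e = coordinates x∈
        in v , v∈ , λ v≈0 →
          x∉ (F.resp (sym (trans e (trans (+-congˡ (trans (*-congʳ v≈0) (zeroˡ ω))) (+-identityʳ u))))
              (proj₂ u∈))

      private generated = principal (𝔣 K₀ R) ideal nonzero

      f : Carrier
      f = proj₁ generated

      f∈𝔣 : f ∈ 𝔣 K₀ R
      f∈𝔣 = proj₁ (proj₂ generated)

      f∈ : f ∈ 𝒪 K₀
      f∈ = proj₂ f∈𝔣

      𝔣⊆ : 𝔣 K₀ R ⊆ (f ∥_)
      𝔣⊆ = proj₂ (proj₂ generated)

      fω∈ : f * ω ∈ R
      fω∈ = proj₂ (proj₁ f∈𝔣) ω ω.ω∈𝒪L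

      f≉0 : ¬ f ≈ 0#
      f≉0 f≈0 = let x , x∈ , x≉0 = nonzero ; y , _ , e = 𝔣⊆ x∈ in x≉0 (trans e (trans (*-congʳ f≈0) (zeroˡ y)))

    module _ {R : Subset} (R-int : Intermediate R) where

      open Intermediate R-int

      -- The product of the ℤ-basis 1, ω₀ of `𝒪 K₀` and the `𝒪 K₀`-basis 1, f ω of `R`.
      basis : Fin 4 → Carrier
      basis zero                   = 1#
      basis (suc zero)             = ω₀
      basis (suc (suc zero))       = f * ω
      basis (suc (suc (suc zero))) = ω₀ * (f * ω)

      private
        combination : (h : Fin 4 → Carrier) →
          sum (λ i → h i * basis i) ≈
          (h zero + h (suc zero) * ω₀) + f * (h (suc (suc zero)) + h (suc (suc (suc zero))) * ω₀) * ω
        combination h = begin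
          a * 1# + (b * ω₀ + (c * (f * ω) + (d * (ω₀ * (f * ω)) + 0#)))
            ≈⟨ +-cong (*-identityʳ a) (+-congˡ (+-congˡ (+-identityʳ _))) ⟩
          a + (b * ω₀ + (c * (f * ω) + d * (ω₀ * (f * ω))))
            ≈⟨ solve 7 (λ a b c d w₀ f w → a :+ (b :* w₀ :+ (c :* (f :* w) :+ d :* (w₀ :* (f :* w)))) :=
                 (a :+ b :* w₀) :+ f :* (c :+ d :* w₀) :* w) refl a b c d ω₀ f ω ⟩
          (a + b * ω₀) + f * (c + d * ω₀) * ω ∎
          where
          a = h zero
          b = h (suc zero)
          c = h (suc (suc zero))
          d = h (suc (suc (suc zero)))

        integers : ∀ {x} → x ∈ 𝒪 K₀ → ∃[ a ] ∃[ b ] x ≈ fromℤ a + fromℤ b * ω₀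
        integers x∈ =
          let u , v , u∈ , v∈ , e = ω₀.decompose x∈
              a , u≈a = rational-integral em u∈
              b , v≈b = rational-integral em v∈
          in a , b , trans e (+-cong u≈a (*-congʳ v≈b))

      basis∈ : ∀ i → basis i ∈ R
      basis∈ zero                   = has1
      basis∈ (suc zero)             = contains ω₀.ω∈𝒪L
      basis∈ (suc (suc zero))       = fω∈
      basis∈ (suc (suc (suc zero))) = has* (contains ω₀.ω∈𝒪L) fω∈

      spanned : R ⊆ ℤSpan basis
      spanned {x} x∈ =
        let u , v , u∈ , v∈ , e = coordinates x∈
            w , w∈ , v≈fw = 𝔣⊆ v∈
            a , b , u≈ = integers u∈
            c , d , w≈ = integers w∈
        in coefficient a b c d , (begin
          x
            ≈⟨ e ⟩
          u + v * ω
            ≈⟨ +-cong u≈ (*-congʳ (trans v≈fw (*-congˡ w≈))) ⟩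
          (fromℤ a + fromℤ b * ω₀) + f * (fromℤ c + fromℤ d * ω₀) * ω
            ≈⟨ combination (λ i → fromℤ (coefficient a b c d i)) ⟨
          sum (λ i → fromℤ (coefficient a b c d i) * basis i) ∎)
        where
        coefficient : (a b c d : ℤ) → Fin 4 → ℤ
        coefficient a b c d zero                   = a
        coefficient a b c d (suc zero)             = b
        coefficient a b c d (suc (suc zero))       = c
        coefficient a b c d (suc (suc (suc zero))) = d

      -- Two denominators are multiplied: d makes x integral, and an integer multiple `M` of f moves
      -- the ω-coordinate into 𝔣.
      absorbs : ∀ x → ∃[ d ] ¬ d ≡ + 0 × fromℤ d * x ∈ R
      absorbs x =
        let d , d≢0 , dx∈ = integral-multiple x
            u , v , u∈ , v∈ , e = ω.decompose (dx∈ , _)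
            M , M≢0 , f∥M@(y , y∈ , M≈) = divides-integer K₀-field integral-multiple f∈ f≉0
            M∈ = contains (IsIdeal.inside (∥-isIdeal f∈) f∥M)
        in M ℤ.* d , *-≢0 {M} M≢0 d≢0 , resp (begin
          fromℤ M * u + v * (y * (f * ω))
            ≈⟨ +-congˡ (*-congˡ (trans (solve 3 (λ y f w → y :* (f :* w) := f :* y :* w)
                refl y f ω) (*-congʳ (sym M≈)))) ⟩
          fromℤ M * u + v * (fromℤ M * ω)
            ≈⟨ solve 4 (λ m u v w → m :* u :+ v :* (m :* w) := m :* (u :+ v :* w)) refl (fromℤ M) u v ω ⟩
          fromℤ M * (u + v * ω)
            ≈⟨ *-congˡ e ⟨
          fromℤ M * (fromℤ d * x)
            ≈⟨ trans (*-congʳ (fromℤ-* M d)) (*-assoc _ _ _) ⟨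
          fromℤ (M ℤ.* d) * x ∎)
        (has+ (has* M∈ (contains u∈)) (has* (contains v∈) (has* (contains y∈) fω∈)))

      isℚBasis : IsℚBasis U basis
      isℚBasis = record
        { inside = _
        ; spanning = λ {x} _ → ℚ-span x
        ; independent = independent
        }
        where
        ℚ-span : ∀ x → Σ[ q ∈ (Fin 4 → ℚ) ] x ≈ sum (λ i → ι (q i) * basis i)
        ℚ-span x = ℚSpan.coefficients scaled , ℚSpan.combination scaled
          where
          d = proj₁ (absorbs x)
          c = spanned (proj₂ (proj₂ (absorbs x)))

          d/1≢0 : ¬ d ℚ./ 1 ≡ 0ℚ
          d/1≢0 e = fromℤ-≉0 {d} (proj₁ (proj₂ (absorbs x))) (trans (ι.⟦⟧-cong e) ι.0#-homo)

          instance _ = ℚ.≢-nonZero d/1≢0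

          scaled : x ∈ ℚSpan.Spanned basis
          scaled = IsAdditive.resp ℚSpan.additive (begin
              ι (ℚ.1/ (d ℚ./ 1)) * (fromℤ d * x)       ≈⟨ *-assoc _ _ _ ⟨
              ι (ℚ.1/ (d ℚ./ 1)) * ι (d ℚ./ 1) * x     ≈⟨ *-congʳ (ι.*-homo _ _) ⟨
              ι (ℚ.1/ (d ℚ./ 1) ℚ.* (d ℚ./ 1)) * x     ≈⟨ *-congʳ
                  (trans (ι.⟦⟧-cong (ℚ.*-inverseˡ (d ℚ./ 1))) ι.1#-homo) ⟩
              1# * x                                   ≈⟨ *-identityˡ x ⟩
              x                                        ∎)
            (ℚSpan.scale (ℚ.1/ (d ℚ./ 1)) ((λ i → proj₁ c i ℚ./ 1) ℚSpan., proj₂ c))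

        -- Coordinates are compared first over `K₀` with respect to ω, then over ℚ with respect to
        -- ω₀.
        independent : ∀ (q : Fin 4 → ℚ) → sum (λ i → ι (q i) * basis i) ≈ 0# → ∀ i → q i ≡ 0ℚ
        independent q e = λ
          { zero                   → ι-0 (C₀.u≈0 (q∈ zero) (q∈ (suc zero)) u≈0′)
          ; (suc zero)             → ι-0 (C₀.v≈0 (q∈ zero) (q∈ (suc zero)) u≈0′)
          ; (suc (suc zero))       → ι-0 (C₀.u≈0 (q∈ (suc (suc zero))) (q∈ (suc (suc (suc zero)))) w≈0)
          ; (suc (suc (suc zero))) → ι-0 (C₀.v≈0 (q∈ (suc (suc zero))) (q∈ (suc (suc (suc zero)))) w≈0)
          }
          where
          module C₀ = Coordinates em ℚ-isSubfield ω₀.ω∉F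

          q∈ : ∀ i → ι (q i) ∈ ℚ-subfield
          q∈ i = q i , refl

          u = ι (q zero) + ι (q (suc zero)) * ω₀
          w = ι (q (suc (suc zero))) + ι (q (suc (suc (suc zero)))) * ω₀

          in-K₀ : ∀ p r → ι p + ι r * ω₀ ∈ K₀
          in-K₀ p r = F.has+ (subfield-ι K₀-field p) (F.has* (subfield-ι K₀-field r) (proj₂ ω₀.ω∈𝒪L))

          relation : u + f * w * ω ≈ 0#
          relation = trans (sym (combination (λ i → ι (q i)))) e

          u≈0′ : u ≈ 0#
          u≈0′ = u≈0 (in-K₀ _ _) (F.has* (proj₂ f∈) (in-K₀ _ _)) relation

          w≈0 : w ≈ 0#
          w≈0 = cancelˡ-0 f≉0 (v≈0 (in-K₀ _ _) (F.has* (proj₂ f∈) (in-K₀ _ _)) relation)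

      intermediate-isOrder : IsOrder R
      intermediate-isOrder = record
        { isSubring = isSubring
        ; lattice = 4 , basis , isℚBasis , spanned , λ (c , e) → ℤSpan-min (subringAdditive isSubring)
                basis∈ (c ℤSpan., e)
        }

    standard : Carrier → Subset
    standard f x = ∃[ u ] ∃[ v ] u ∈ 𝒪 K₀ × v ∈ 𝒪 K₀ × x ≈ u + f * v * ω

    module _ {f} (f∈ : f ∈ 𝒪 K₀) (f≉0 : ¬ f ≈ 0#) where

      standard-intermediate : Intermediate (standard f)
      standard-intermediate = record
        { isSubring = record
          { resp = λ { e (u , v , u∈ , v∈ , e′) → u , v , u∈ , v∈ , trans (sym e) e′ }
          ; has0 = constant 𝒪₀.has0
          ; has1 = constant 𝒪₀.has1
          ; has+ = λ { (u , v , u∈ , v∈ , e) (s , t , s∈ , t∈ , e′) → u + s , v + t , 𝒪₀.has+ u∈ s∈ ,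
                  𝒪₀.has+ v∈ t∈ ,
              trans (+-cong e e′) (solve 6 (λ u v s t f w → (u :+ f :* v :* w) :+ (s :+ f :* t :* w) :=
                  (u :+ s) :+ f :* (v :+ t) :* w)
                refl u v s t f ω) }
          ; has- = λ { (u , v , u∈ , v∈ , e) → - u , - v , 𝒪₀.has- u∈ , 𝒪₀.has- v∈ ,
              trans (-‿cong e) (solve 4 (λ u v f w → :- (u :+ f :* v :* w) := (:- u) :+ f :* (:- v) :* w)
                  refl u v f ω) }
          ; has* = product
          }
        ; contains = constant
        ; bounded = λ { (u , v , u∈ , v∈ , e) →
            I.resp (sym e) (I.has+ (proj₁ u∈) (I.has* (I.has* (proj₁ f∈) (proj₁ v∈)) (proj₁ ω.ω∈𝒪L))) , _ }
        ; outside = f * ω , generator , multiple-∉ (proj₂ f∈) f≉0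
        }
        where
        constant : 𝒪 K₀ ⊆ standard f
        constant {u} u∈ = u , 0# , u∈ , 𝒪₀.has0 , sym
            (trans (+-congˡ (trans (*-congʳ (zeroʳ f)) (zeroˡ ω))) (+-identityʳ u))

        generator : f * ω ∈ standard f
        generator = 0# , 1# , 𝒪₀.has0 , 𝒪₀.has1 , sym (trans (+-identityˡ _) (*-congʳ (*-identityʳ f)))

        product : ∀ {x y} → x ∈ standard f → y ∈ standard f → x * y ∈ standard f
        product {x} {y} (u , v , u∈ , v∈ , e) (u′ , v′ , u′∈ , v′∈ , e′) =
          -- With ω² = s + t ω, the term in f² contributes f · f v v′ t to the ω-coordinate, again a
          -- multiple of f.
          let s , t , s∈ , t∈ , d = ω.decompose (I.has* (proj₁ ω.ω∈𝒪L) (proj₁ ω.ω∈𝒪L) , _) in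
          u * u′ + f * f * (v * v′) * s , u * v′ + v * u′ + f * (v * v′) * t ,
          𝒪₀.has+ (𝒪₀.has* u∈ u′∈) (𝒪₀.has* (𝒪₀.has* (𝒪₀.has* f∈ f∈) (𝒪₀.has* v∈ v′∈)) s∈) ,
          𝒪₀.has+ (𝒪₀.has+ (𝒪₀.has* u∈ v′∈) (𝒪₀.has* v∈ u′∈)) (𝒪₀.has* (𝒪₀.has* f∈ (𝒪₀.has* v∈ v′∈)) t∈) ,
              (begin
            x * y
              ≈⟨ *-cong e e′ ⟩
            (u + f * v * ω) * (u′ + f * v′ * ω)
              ≈⟨ solve 6 (λ u v s t f w → (u :+ f :* v :* w) :* (s :+ f :* t :* w) :=
                   u :* s :+ f :* (u :* t :+ v :* s) :* w :+ f :* f :* (v :* t) :* (w :* w))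
                       refl u v u′ v′ f ω ⟩
            u * u′ + f * (u * v′ + v * u′) * ω + f * f * (v * v′) * (ω * ω)
              ≈⟨ +-congˡ (*-congˡ d) ⟩
            u * u′ + f * (u * v′ + v * u′) * ω + f * f * (v * v′) * (s + t * ω)
              ≈⟨ solve 7 (λ a b f c s t w → a :+ f :* b :* w :+ f :* f :* c :* (s :+ t :* w) :=
                   (a :+ f :* f :* c :* s) :+ f :* (b :+ f :* c :* t) :* w)
                       refl (u * u′) (u * v′ + v * u′) f (v * v′) s t ω ⟩
            u * u′ + f * f * (v * v′) * s + f * (u * v′ + v * u′ + f * (v * v′) * t) * ω ∎)

      standard-∈-𝔣 : f ∈ 𝔣 K₀ (standard f)
      standard-∈-𝔣 = Intermediate.∈-𝔣 standard-intermediate f∈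
        (0# , 1# , 𝒪₀.has0 , 𝒪₀.has1 , sym (trans (+-identityˡ _) (*-congʳ (*-identityʳ f))))

      -- If c conducts, then c ω = u + f v ω for some integral u and v, and coordinates are unique.
      standard-𝔣⊆ : 𝔣 K₀ (standard f) ⊆ (f ∥_)
      standard-𝔣⊆ {c} ((_ , conducts) , c∈) = let u , v , u∈ , v∈ , e = conducts ω ω.ω∈𝒪L in
        v , v∈ , v-unique F.has0 (proj₂ c∈) (proj₂ u∈) (F.has* (proj₂ f∈) (proj₂ v∈)) (trans (+-identityˡ _) e)

-- Divisibility up to integers prime to ℓ

module SplitPrime (K : CharZeroField) (ℓ : ℕ) (ℓ-prime : Prime ℓ) where

  open CharZeroField K hiding (zero)
  open FieldTheory K
  open FieldProperties K
  open Integrality K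
  open ClassNumber K
  open Rationals K
  open LocalizationAt K ℓ ℓ-prime
  open SetoidReasoning setoid

  module OverPID (em : ExcludedMiddle) {F : Subset} (F-field : IsSubfield F) (principal : AllPrincipal F)
           (integral-multiple : ∀ x → ∃[ d ] ¬ d ≡ + 0 × IsIntegral (fromℤ d * x)) where

    open Divisibility F-field
    open Valuations.OverPID K em F-field principal
    private
      module R = IsSubring (𝒪-isSubring F-field)

    ℤ⊆𝒪 : ∀ z → fromℤ z ∈ 𝒪 F
    ℤ⊆𝒪 z = integral-ℤ z , subfield-ℤ F-field z

    -- By Bézout, a common divisor of m and ℓ divides 1.
    ∤-primeTo : ∀ {P π} → PrimeElement P π → π ∥ fromℤ (+ ℓ) → ∀ {m} → PrimeTo m → ¬ π ∥ fromℤ (+ m)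
    ∤-primeTo π-prime π∥ℓ {m} ℓ∤m π∥m = nonunit (resp (begin
        fromℤ s * fromℤ (+ m) + fromℤ t * fromℤ (+ ℓ)    ≈⟨ +-cong (fromℤ-* s (+ m)) (fromℤ-* t (+ ℓ)) ⟨
        fromℤ (s ℤ.* + m) + fromℤ (t ℤ.* + ℓ)            ≈⟨ fromℤ-+ (s ℤ.* + m) (t ℤ.* + ℓ) ⟨
        fromℤ (s ℤ.* + m ℤ.+ t ℤ.* + ℓ)                  ≡⟨ ≡.cong fromℤ (proj₂ (proj₂ (bézout ℓ∤m))) ⟩
        fromℤ (+ 1)                                      ≈⟨ fromℤ-1 ⟩
        1#                                               ∎)
      (has+ (absorb (ℤ⊆𝒪 s) π∥m) (absorb (ℤ⊆𝒪 t) π∥ℓ)))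
      where
      open PrimeElement π-prime
      open Ideals.IsIdeal (∥-isIdeal π∈)
      s = proj₁ (bézout ℓ∤m)
      t = proj₁ (proj₂ (bézout ℓ∤m))

    module _ {P₁ P₂ π₁ π₂} (prime₁ : PrimeElement P₁ π₁) (prime₂ : PrimeElement P₂ π₂)
             (π₁∤π₂ : ¬ π₁ ∥ π₂) (π₂∤π₁ : ¬ π₂ ∥ π₁) (ℓ∥π₁π₂ : fromℤ (+ ℓ) ∥ π₁ * π₂) where

      private
        module π₁ = PrimeElement prime₁
        module π₂ = PrimeElement prime₂

      -- k divides some integer ℓ^j m with m prime to ℓ, and each ℓ can be removed: k ∣ ℓ x gives k
      -- ∣ π₁ π₂ x, because π₁ π₂ is a multiple of ℓ, and then π₁ and π₂ are cancelled by primality.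
      coprime-part : ∀ {k} → k ∈ 𝒪 F → ¬ k ≈ 0# → ¬ π₁ ∥ k → ¬ π₂ ∥ k → ∃[ m ] PrimeTo m × k ∥ fromℤ (+ m)
      coprime-part {k} k∈ k≉0 π₁∤k π₂∤k =
        let d , d≢0 , k∥d = divides-integer F-field integral-multiple k∈ k≉0
            j , m , p , e = prime-part ℤ.∣ d ∣ (d≢0 ∘ ℤ.∣i∣≡0⇒i≡0)
        in m , p , cancel j (≡.subst (λ n → k ∥ fromℤ (+ n)) e (absolute d k∥d))
        where
        module k = Ideals.IsIdeal (∥-isIdeal k∈)

        absolute : ∀ d → k ∥ fromℤ d → k ∥ fromℤ (+ ℤ.∣ d ∣)
        absolute (+ n)    p = p
        absolute -[1+ n ] p = k.resp (trans (sym (fromℤ-* -[1+ 0 ] -[1+ n ]))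
            (reflexive (≡.cong fromℤ (ℤ.-1*i≡-i -[1+ n ]))))
          (k.absorb (ℤ⊆𝒪 -[1+ 0 ]) p)

        cancel-ℓ : ∀ {x} → x ∈ 𝒪 F → k ∥ fromℤ (+ ℓ) * x → k ∥ x
        cancel-ℓ {x} x∈ (y , y∈ , e) =
          let w , w∈ , e′ = ℓ∥π₁π₂
              z , z∈ , e″ = cancel-prime prime₁ k∈ (R.has* π₂.π∈ x∈) (R.has* w∈ y∈) π₁∤k (begin
                π₁ * (π₂ * x)              ≈⟨ *-assoc _ _ _ ⟨
                π₁ * π₂ * x                ≈⟨ *-congʳ e′ ⟩
                fromℤ (+ ℓ) * w * x        ≈⟨ solve 3 (λ l w x → l :* w :* x := w :* (l :* x)) refl _ w x ⟩
                w * (fromℤ (+ ℓ) * x)      ≈⟨ *-congˡ e ⟩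
                w * (k * y)                ≈⟨ solve 3 (λ w k y → w :* (k :* y) := k :* (w :* y)) refl w k y ⟩
                k * (w * y)                ∎)
          in cancel-prime prime₂ k∈ x∈ z∈ π₂∤k e″

        cancel : ∀ j {m} → k ∥ fromℤ (+ (ℓ ℕ.^ j ℕ.* m)) → k ∥ fromℤ (+ m)
        cancel zero    {m} p = ≡.subst (λ n → k ∥ fromℤ (+ n)) (ℕ.*-identityˡ m) p
        cancel (suc j) {m} p = cancel j (cancel-ℓ (ℤ⊆𝒪 (+ (ℓ ℕ.^ j ℕ.* m))) (k.resp (trans
          (reflexive (≡.cong (λ n → fromℤ (+ n)) (ℕ.*-assoc ℓ (ℓ ℕ.^ j) m)))
              (fromℤ-pos-* ℓ (ℓ ℕ.^ j ℕ.* m))) p))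

      -- π₂ is split off from the cofactor h of π₁ ^ a. The exponent found is b, because π₂ does not
      -- divide π₁ ^ a and valuations are unique.
      factorisation : ∀ {g a b} → g ∈ 𝒪 F → ¬ g ≈ 0# → Valuation prime₁ g a → Valuation prime₂ g b →
        ∃[ k ] k ∈ 𝒪 F × ¬ k ≈ 0# × g ≈ π₁ ^ a * (π₂ ^ b * k) × ¬ π₁ ∥ k × ¬ π₂ ∥ k
      factorisation {g} {a} {b} g∈ g≉0 (h , h∈ , g≈ , π₁∤h) v₂ =
        let n , k , k∈ , h≈ , π₂∤k = valuation prime₂ h∈ h≉0
            n≡b = valuation-unique prime₂ {g} {g} {n} {b}
              (π₁ ^ a * k , R.has* (π₁.π^∈ a) k∈ , trans g≈ (trans (*-congˡ h≈)
                  (solve 3 (λ s t k → s :* (t :* k) := t :* (s :* k)) refl (π₁ ^ a) (π₂ ^ n) k)) ,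
                λ d → Sum.[ ∤-power prime₂ π₁.π∈ π₂∤π₁ a , π₂∤k ] (π₂.prime (π₁.π^∈ a) k∈ d)) v₂ self self
        in k , k∈ , (λ k≈0 → h≉0 (trans h≈ (trans (*-congˡ k≈0) (zeroʳ _)))) ,
           trans g≈ (*-congˡ (trans h≈ (reflexive (≡.cong (λ n → π₂ ^ n * k) n≡b)))) ,
           (λ (y , y∈ , e) → π₁∤h (π₂ ^ n * y , R.has* (π₂.π^∈ n) y∈ , trans h≈ (trans (*-congˡ e)
              (solve 3 (λ t p y → t :* (p :* y) := p :* (t :* y)) refl (π₂ ^ n) π₁ y)))) , π₂∤k
        where
        h≉0 : ¬ h ≈ 0#
        h≉0 h≈0 = g≉0 (trans g≈ (trans (*-congˡ h≈0) (zeroʳ _)))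

        self : g ∥ g
        self = 1# , R.has1 , sym (*-identityʳ g)

      -- The powers of π₁ and π₂ in g divide those in f. The rest of g divides an integer m prime to
      -- ℓ by `coprime-part`, and this m is the multiplier.
      divides-multiple : ∀ {f g a₁ a₂ b₁ b₂} → f ∈ 𝒪 F → ¬ f ≈ 0# → g ∈ 𝒪 F → ¬ g ≈ 0# →
        Valuation prime₁ f a₁ → Valuation prime₂ f a₂ → Valuation prime₁ g b₁ → Valuation prime₂ g b₂ →
        b₁ ℕ.≤ a₁ → b₂ ℕ.≤ a₂ → ∃[ m ] PrimeTo m × g ∥ fromℤ (+ m) * f
      divides-multiple {f} {g} {a₁} {a₂} {b₁} {b₂} f∈ f≉0 g∈ g≉0 vf₁ vf₂ vg₁ vg₂ b₁≤a₁ b₂≤a₂ =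
        let h , h∈ , _ , f≈ , _ = factorisation {a = a₁} {a₂} f∈ f≉0 vf₁ vf₂
            k , k∈ , k≉0 , g≈ , π₁∤k , π₂∤k = factorisation {a = b₁} {b₂} g∈ g≉0 vg₁ vg₂
            m , p , (y , y∈ , m≈) = coprime-part k∈ k≉0 π₁∤k π₂∤k
            d₁ = a₁ ℕ.∸ b₁
            d₂ = a₂ ℕ.∸ b₂
        in m , p , π₁ ^ d₁ * (π₂ ^ d₂ * h) * y ,
           R.has* (R.has* (π₁.π^∈ d₁) (R.has* (π₂.π^∈ d₂) h∈)) y∈ , (begin
             fromℤ (+ m) * f
               ≈⟨ *-cong m≈ (trans f≈ (*-cong (split π₁ {a₁} b₁≤a₁) (*-congʳ (split π₂ {a₂} b₂≤a₂)))) ⟩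
             k * y * (π₁ ^ b₁ * π₁ ^ d₁ * (π₂ ^ b₂ * π₂ ^ d₂ * h))
               ≈⟨ regroup k y (π₁ ^ b₁) (π₁ ^ d₁) (π₂ ^ b₂) (π₂ ^ d₂) h ⟩
             π₁ ^ b₁ * (π₂ ^ b₂ * k) * (π₁ ^ d₁ * (π₂ ^ d₂ * h) * y)
               ≈⟨ *-congʳ g≈ ⟨
             g * (π₁ ^ d₁ * (π₂ ^ d₂ * h) * y) ∎)
        where
        split : ∀ x {a b} → b ℕ.≤ a → x ^ a ≈ x ^ b * x ^ (a ℕ.∸ b)
        split x {a} {b} b≤a = trans (reflexive (≡.cong (x ^_) (≡.sym (ℕ.m+[n∸m]≡n b≤a)))) (^-+ x b (a ℕ.∸ b))

        regroup : ∀ k y s₁ t₁ s₂ t₂ h → k * y * (s₁ * t₁ * (s₂ * t₂ * h)) ≈ s₁ * (s₂ * k) * (t₁ * (t₂ * h) * y)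
        regroup = solve 7 (λ k y s₁ t₁ s₂ t₂ h →
          k :* y :* (s₁ :* t₁ :* (s₂ :* t₂ :* h)) := s₁ :* (s₂ :* k) :* (t₁ :* (t₂ :* h) :* y)) refl

-- Comparing localized orders through their conductors

module LocalOrders (K : CharZeroField) (ℓ : ℕ) (ℓ-prime : Prime ℓ) where

  open CharZeroField K hiding (zero)
  open FieldTheory K
  open FieldProperties K
  open Integrality K
  open ClassNumber K
  open Rationals K
  open QuadraticExtension K
  open LocalizationAt K ℓ ℓ-prime
  open SetoidReasoning setoid

  local-common : ∀ {S} → IsAdditive S → ∀ n (e : Fin n → Carrier) → (∀ i → e i ∈ Local S) →
                 ∃[ m ] PrimeTo m × (∀ i → fromℤ (+ m) * e i ∈ S)
  local-common add zero    e e∈ = 1 , 1-primeTo , λ ()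
  local-common add (suc n) e e∈ =
    let m , p , me∈ = e∈ zero
        k , q , ke∈ = local-common add n (e ∘ suc) (e∈ ∘ suc)
    in m ℕ.* k , *-primeTo p q , λ
      { zero    → resp (trans (solve 3 (λ k m x → k :* (m :* x) := m :* k :* x)
              refl _ _ _) (*-congʳ (sym (fromℤ-pos-* m k)))) (hasℕ k me∈)
      ; (suc i) → resp (trans (sym (*-assoc _ _ _)) (*-congʳ (sym (fromℤ-pos-* m k)))) (hasℕ m (ke∈ i)) }
    where open IsAdditive add

  module Relative (em : ExcludedMiddle) {K₀ : Subset} (K₀-field : IsSubfield K₀) (principal : AllPrincipal K₀)
           (integral-multiple : ∀ x → ∃[ d ] ¬ d ≡ + 0 × IsIntegral (fromℤ d * x))
           {ω₀ ω : Carrier} (gen₀ : IntegralGenerator ℚ-subfield K₀ ω₀) (gen : IntegralGenerator K₀ U ω) where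

    open Divisibility K₀-field
    open QuarticOrders.Relative K em K₀-field principal integral-multiple gen₀ gen
    private
      module 𝒪₀ = IsSubring (𝒪-isSubring K₀-field)

    ℕ∈ : ∀ m → fromℤ (+ m) ∈ 𝒪 K₀
    ℕ∈ m = integral-ℤ (+ m) , subfield-ℤ K₀-field (+ m)

    module _ {R S} (R-int : Intermediate R) (S-int : Intermediate S) where

      private
        module R = Intermediate R-int
        module S = Intermediate S-int

      -- The single element f ω of `R` carries the information: if m f ω lies in `S`, then m f lies
      -- in the 𝔣 of `S`.
      local-⊆⇒∥ : R ⊆ Local S → ∃[ m ] PrimeTo m × S.f ∥ fromℤ (+ m) * R.f
      local-⊆⇒∥ R⊆S = let m , p , q = R⊆S R.fω∈ in
        m , p , S.𝔣⊆ (S.∈-𝔣 (𝒪₀.has* (ℕ∈ m) R.f∈) (S.resp (sym (*-assoc _ _ _)) q))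

      -- One m serves all x: the ω-coordinate of x is a multiple of `R.f`, and m `R.f` is a multiple
      -- of `S.f`.
      ∥⇒local-⊆ : ∃[ m ] PrimeTo m × S.f ∥ fromℤ (+ m) * R.f → R ⊆ Local S
      ∥⇒local-⊆ (m , p , (y , y∈ , mf≈)) {x} x∈ =
        let u , v , u∈ , v∈ , e = R.coordinates x∈
            w , w∈ , v≈ = R.𝔣⊆ v∈
        in m , p , S.resp (begin
          fromℤ (+ m) * u + y * w * (S.f * ω)
            ≈⟨ +-congˡ (solve 4 (λ y w g o → y :* w :* (g :* o) := g :* y :* w :* o) refl y w S.f ω) ⟩
          fromℤ (+ m) * u + S.f * y * w * ω
            ≈⟨ +-congˡ (*-congʳ (*-congʳ mf≈)) ⟨
          fromℤ (+ m) * u + fromℤ (+ m) * R.f * w * ω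
            ≈⟨ solve 5 (λ m u f w o → m :* u :+ m :* f :* w :* o := m :* (u :+ f :* w :* o))
                refl (fromℤ (+ m)) u R.f w ω ⟩
          fromℤ (+ m) * (u + R.f * w * ω)
            ≈⟨ *-congˡ (trans e (+-congˡ (*-congʳ v≈))) ⟨
          fromℤ (+ m) * x ∎)
        (S.has+ (S.contains (𝒪₀.has* (ℕ∈ m) u∈)) (S.has* (S.contains (𝒪₀.has* y∈ w∈)) S.fω∈))

    order-intermediate : ∀ {R} → IsOrder R → 𝒪 K₀ ⊆ R → Intermediate R
    order-intermediate {R} ord contains = record
      { isSubring = IsOrder.isSubring ord
      ; contains = contains
      ; bounded = order⊆𝒪 ord
      ; outside =
          let d , d≢0 , dω∈ = IsLattice.absorbing (order-isLattice ord) ω in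
          fromℤ d * ω , dω∈ , multiple-∉ (subfield-ℤ K₀-field d) (fromℤ-≉0 {d} d≢0)
      }

    -- For an order O with 𝒪 K₀ ⊗ ℤₗ ⊆ O ⊗ ℤₗ: the largest order with the same localization.
    module _ {O} (O-order : IsOrder O) (𝒪₀⊆O : 𝒪 K₀ ⊆ Local O) where

      private
        module O = IsSubring (IsOrder.isSubring O-order)
        O-additive = subringAdditive (IsOrder.isSubring O-order)
        module L = IsAdditive (local-additive O-additive)
        module I = IsSubring integral-isSubring

      saturation : Subset
      saturation = 𝒪 U ∩ Local O

      ⊆-saturation : O ⊆ saturation
      ⊆-saturation x∈ = order⊆𝒪 O-order x∈ , local-⊇ O-additive x∈

      saturation-intermediate : Intermediate saturation
      saturation-intermediate = record
        { isSubring = record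
          { resp = λ { e ((p , _) , q) → (I.resp e p , _) , L.resp e q }
          ; has0 = (I.has0 , _) , L.has0
          ; has1 = (I.has1 , _) , local-⊇ O-additive O.has1
          ; has+ = λ { ((p , _) , q) ((p′ , _) , q′) → (I.has+ p p′ , _) , L.has+ q q′ }
          ; has- = λ { ((p , _) , q) → (I.has- p , _) , L.has- q }
          ; has* = λ { {x} {y} ((p , _) , (m , c , q)) ((p′ , _) , (n , c′ , q′)) → (I.has* p p′ , _) ,
              (m ℕ.* n , *-primeTo c c′ , O.resp (begin
                fromℤ (+ m) * x * (fromℤ (+ n) * y)     ≈⟨ solve 4
                    (λ m x n y → m :* x :* (n :* y) := m :* n :* (x :* y)) refl _ x _ y ⟩
                fromℤ (+ m) * fromℤ (+ n) * (x * y)     ≈⟨ *-congʳ (fromℤ-pos-* m n) ⟨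
                fromℤ (+ (m ℕ.* n)) * (x * y)           ∎) (O.has* q q′)) }
          }
        ; contains = λ x∈ → (proj₁ x∈ , _) , 𝒪₀⊆O x∈
        ; bounded = proj₁
        ; outside =
            let d , d≢0 , dω∈ = IsLattice.absorbing (order-isLattice O-order) ω in
            fromℤ d * ω , ⊆-saturation dω∈ ,
            multiple-∉ (subfield-ℤ K₀-field d) (fromℤ-≉0 {d} d≢0)
        }

      saturation-order : IsOrder saturation
      saturation-order = intermediate-isOrder saturation-intermediate

      private
        -- A priori each element has its own multiplier. The finite basis provided by
        -- `saturation-order` makes a common one possible.
        cleared : ∃[ m ] PrimeTo m × (∀ {x} → x ∈ saturation → fromℤ (+ m) * x ∈ O)
        cleared =
          let n , b , _ , ⊆span , span⊆ = IsOrder.lattice saturation-order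
              m , p , mb∈ = local-common O-additive n b (λ i → proj₂ (span⊆ (ℤSpan.δ i , ℤSpan.sum-δ i b)))
          in m , p , λ x∈ → let c , e = ⊆span x∈ in ℤSpan-mul (fromℤ (+ m)) O-additive mb∈ (c ℤSpan., e)

      abstract
        -- If c sends all integers into the saturation, then m c sends them into `O`. With
        -- `𝔣⊆-saturation` the two ideals agree up to a factor that is a unit at the primes above ℓ.
        saturation-𝔣 : ∃[ m ] PrimeTo m × (∀ {c} → c ∈ 𝔣 K₀ saturation → fromℤ (+ m) * c ∈ 𝔣 K₀ O)
        saturation-𝔣 = let m , p , clear = cleared in m , p , λ { ((c∈ , conducts) , c∈₀) →
          (((I.has* (integral-ℤ (+ m)) (proj₁ c∈) , _) ,
            λ y y∈ → O.resp (sym (*-assoc _ _ _)) (clear (conducts y y∈))) , 𝒪₀.has* (ℕ∈ m) c∈₀) }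

      𝔣⊆-saturation : 𝔣 K₀ O ⊆ 𝔣 K₀ saturation
      𝔣⊆-saturation ((c∈ , conducts) , c∈₀) = (c∈ , λ y y∈ → ⊆-saturation (conducts y y∈)) , c∈₀

-- The isomorphism of the lattice with pairs of valuations

module Position (K : CharZeroField) (ℓ : ℕ) (ℓ-prime : Prime ℓ) where

  open CharZeroField K hiding (zero)
  open FieldTheory K
  open FieldProperties K
  open Integrality K
  open ClassNumber K
  open Rationals K
  open LinearAlgebra K
  open QuadraticExtension K
  open LocalizationAt K ℓ ℓ-prime
  open Localization ℓ

  module _ {K₀ : Subset} (cm : IsQuarticCM K₀) (class1 : Ideals.ClassNumberOne K₀) {𝔩₁ 𝔩₂ : Subset}
           (𝔩₁-prime : Ideals.IsPrimeIdeal K₀ 𝔩₁) (𝔩₂-prime : Ideals.IsPrimeIdeal K₀ 𝔩₂) (𝔩₁≢𝔩₂ : ¬ (𝔩₁ ≐ 𝔩₂))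
           (ℓ-splits : Ideals.multiples K₀ (fromℤ (+ ℓ)) (𝒪 K₀) ≐ Ideals._·_ K₀ 𝔩₁ 𝔩₂)
           {O : Subset} (O-order : IsOrder O) (rm : HasLocallyMaximalRM K₀ O) where

    open IsQuarticCM cm using () renaming (K₀-isSubfield to K₀-field; degree to K-degree; K₀-degree to
        K₀-degree)
    open Ideals K₀
    open Divisibility K₀-field

    private
      module 𝒪₀ = IsSubring (𝒪-isSubring K₀-field)
      module P₁ = IsPrimeIdeal 𝔩₁-prime
      module P₂ = IsPrimeIdeal 𝔩₂-prime
      module I₁ = IsIdeal P₁.isIdeal
      module I₂ = IsIdeal P₂.isIdeal

    ℓ≉0 : ¬ fromℤ (+ ℓ) ≈ 0#
    ℓ≉0 = fromℤ-≉0 {+ ℓ} λ e → ℕ.≢-nonZero⁻¹ ℓ {{prime⇒nonZero ℓ-prime}} (ℤ.+-injective e)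

    ℓ∈𝔩₁𝔩₂ : fromℤ (+ ℓ) ∈ 𝔩₁ · 𝔩₂
    ℓ∈𝔩₁𝔩₂ = proj₁ ℓ-splits (1# , 𝒪₀.has1 , sym (*-identityʳ _))

    ℓ∈𝔩₁ : fromℤ (+ ℓ) ∈ 𝔩₁
    ℓ∈𝔩₁ = product⊆ {𝔩₁} {𝔩₂} {𝔩₁} P₁.isIdeal (λ a∈ b∈ → I₁.resp (*-comm _ _) (I₁.absorb (I₂.inside b∈) a∈))
        ℓ∈𝔩₁𝔩₂

    ℓ∈𝔩₂ : fromℤ (+ ℓ) ∈ 𝔩₂
    ℓ∈𝔩₂ = product⊆ {𝔩₁} {𝔩₂} {𝔩₂} P₂.isIdeal (λ a∈ b∈ → I₂.absorb (I₁.inside a∈) b∈) ℓ∈𝔩₁𝔩₂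

    abstract
      -- ℓ is the nonzero nonunit that `excluded-middle` asks for: it lies in the proper ideal `𝔩₁`.
      em : ExcludedMiddle
      em = excluded-middle K₀-field class1 (I₁.inside ℓ∈𝔩₁) ℓ≉0
        λ y∈ e → P₁.proper (I₁.resp (trans (*-comm _ _) e) (I₁.absorb y∈ ℓ∈𝔩₁))

      principal : AllPrincipal K₀
      principal = allPrincipal K₀-field class1

      -- The given order supplies the denominators, being of full rank and consisting of integral
      -- elements.
      integral-multiple : ∀ x → ∃[ d ] ¬ d ≡ + 0 × IsIntegral (fromℤ d * x)
      integral-multiple x =
        let d , d≢0 , dx∈ = IsLattice.absorbing (order-isLattice O-order) x
        in d , d≢0 , proj₁ (order⊆𝒪 O-order dx∈)

    private
      ℚ-basis : IsℚBasis ℚ-subfield {1} (λ _ → 1#)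
      ℚ-basis = record
        { inside = λ _ → 1ℚ , sym ι.1#-homo
        ; spanning = λ (q , e) → (λ _ → q) , trans e (sym (trans (+-identityʳ _) (*-identityʳ _)))
        ; independent = λ { q e zero → ι-0 (trans (sym (trans (+-identityʳ _) (*-identityʳ _))) e) }
        }

      ℚ⊆K₀ : ℚ-subfield ⊆ K₀
      ℚ⊆K₀ (q , e) = IsSubring.resp (IsSubfield.isSubring K₀-field) (sym e) (subfield-ι K₀-field q)

      abstract
        generator₀ : ∃[ ω₀ ] IntegralGenerator ℚ-subfield K₀ ω₀
        generator₀ = integralGenerator em ℚ-isSubfield K₀-field ℚ⊆K₀ (λ {x} _ → integral-multiple x)
            (ℚ-allPrincipal em)
          (proj₂ (generates em ℚ-isSubfield K₀-field ℚ⊆K₀ (ℕ.s≤s ℕ.z≤n) ℚ-basis (proj₂ K₀-degree)))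

        generator : ∃[ ω ] IntegralGenerator K₀ U ω
        generator = integralGenerator em K₀-field U-isSubfield _ (λ {x} _ → integral-multiple x) principal
          (proj₂ (generates em K₀-field U-isSubfield _ (ℕ.s≤s ℕ.z≤n) (proj₂ K₀-degree) (proj₂ K-degree)))

      gen₀ = proj₂ generator₀
      gen  = proj₂ generator

    open Valuations.OverPID K em K₀-field principal
    open SplitPrime.OverPID K ℓ ℓ-prime em K₀-field principal integral-multiple
    open QuarticOrders.Relative K em K₀-field principal integral-multiple gen₀ gen
    open LocalOrders.Relative K ℓ ℓ-prime em K₀-field principal integral-multiple gen₀ gen
    private
      abstract
        element₁ : ∃[ π ] PrimeElement 𝔩₁ π
        element₁ = primeElement 𝔩₁-prime (_ , ℓ∈𝔩₁ , ℓ≉0)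

        element₂ : ∃[ π ] PrimeElement 𝔩₂ π
        element₂ = primeElement 𝔩₂-prime (_ , ℓ∈𝔩₂ , ℓ≉0)

    π₁ π₂ : Carrier
    π₁ = proj₁ element₁
    π₂ = proj₁ element₂

    prime₁ : PrimeElement 𝔩₁ π₁
    prime₁ = proj₂ element₁

    prime₂ : PrimeElement 𝔩₂ π₂
    prime₂ = proj₂ element₂

    private
      module π₁ = PrimeElement prime₁
      module π₂ = PrimeElement prime₂

    π₁∤π₂ : ¬ π₁ ∥ π₂
    π₁∤π₂ = ∥-distinct prime₁ prime₂ 𝔩₁≢𝔩₂

    π₂∤π₁ : ¬ π₂ ∥ π₁
    π₂∤π₁ = ∥-distinct prime₂ prime₁ λ (p , q) → 𝔩₁≢𝔩₂ (q , p)

    generator∈ : ∀ {P π} → PrimeElement P π → π ∈ P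
    generator∈ p = proj₂ (PrimeElement.generates p) (1# , 𝒪₀.has1 , sym (*-identityʳ _))

    ℓ∥π₁π₂ : fromℤ (+ ℓ) ∥ π₁ * π₂
    ℓ∥π₁π₂ = proj₂ ℓ-splits (∈-product {𝔩₁} {𝔩₂} (generator∈ prime₁) (generator∈ prime₂))

    π₁∤primeTo : ∀ {m} → PrimeTo m → ¬ π₁ ∥ fromℤ (+ m)
    π₁∤primeTo = ∤-primeTo prime₁ (proj₁ π₁.generates ℓ∈𝔩₁)

    π₂∤primeTo : ∀ {m} → PrimeTo m → ¬ π₂ ∥ fromℤ (+ m)
    π₂∤primeTo = ∤-primeTo prime₂ (proj₁ π₂.generates ℓ∈𝔩₂)

    Valuations : Carrier → ℕ × ℕ → Set
    Valuations g (a , b) = Valuation prime₁ g a × Valuation prime₂ g b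

    valuations : ∀ {g} → g ∈ 𝒪 K₀ → ¬ g ≈ 0# → ∃[ n ] Valuations g n
    valuations g∈ g≉0 =
      let a , va = valuation prime₁ g∈ g≉0
          b , vb = valuation prime₂ g∈ g≉0
      in (a , b) , va , vb

    infix 4 _≥²_

    _≥²_ : ℕ × ℕ → ℕ × ℕ → Set
    _≥²_ = Pointwise ℕ._≥_ ℕ._≥_

    valuations-≥ : ∀ {f g n k} → Valuations f n → Valuations g k →
                   ∃[ m ] PrimeTo m × g ∥ fromℤ (+ m) * f → n ≥² k
    valuations-≥ {f} {g} {a , b} {c , d} (vf₁ , vf₂) (vg₁ , vg₂) (m , p , g∥mf) =
      valuation-≤ prime₁ {g} {f} {a = a} {c} vg₁ vf₁ (ℤ⊆𝒪 (+ m)) (π₁∤primeTo p) g∥mf ,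
      valuation-≤ prime₂ {g} {f} {a = b} {d} vg₂ vf₂ (ℤ⊆𝒪 (+ m)) (π₂∤primeTo p) g∥mf

    ≥²-antisym : ∀ {n k} → n ≥² k → k ≥² n → n ≡ k
    ≥²-antisym (p , q) (p′ , q′) = ≡.cong₂ _,_ (ℕ.≤-antisym p′ p) (ℕ.≤-antisym q′ q)

    ∥⇒∥1* : ∀ {f g} → g ∥ f → ∃[ m ] PrimeTo m × g ∥ fromℤ (+ m) * f
    ∥⇒∥1* (y , y∈ , e) = 1 , 1-primeTo , y , y∈ , trans (trans (*-congʳ fromℤ-1) (*-identityˡ _)) e

    hasValuations : ∀ {I g n} → IsIdeal I → g ∈ I → I ⊆ (g ∥_) → Valuations g n → HasValuations K₀ 𝔩₁ 𝔩₂ I n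
    hasValuations {I} {g} {a , b} I-ideal g∈I I⊆ (v₁ , v₂) =
      hasValuation prime₁ {I} {g} {a} I-ideal g∈I I⊆ v₁ , hasValuation prime₂ {I} {g} {b} I-ideal g∈I I⊆ v₂

    private
      module _ (X : OverOrder K₀) where

        open OverOrder X

        order-int : Intermediate order
        order-int = order-intermediate isOrder contains

        conductor-generator : Carrier
        conductor-generator = Intermediate.f order-int

        positioned : ∃[ n ] Valuations conductor-generator n
        positioned = valuations (Intermediate.f∈ order-int) (Intermediate.f≉0 order-int)

    open OverOrder using (order)

    pos : OverOrder K₀ → ℕ × ℕ
    pos X = proj₁ (positioned X)

    pos-valuations : ∀ X → HasValuations K₀ 𝔩₁ 𝔩₂ (𝔣 K₀ (order X)) (pos X)
    pos-valuations X = hasValuations {𝔣 K₀ (order X)} {conductor-generator X} {pos X}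
        (Intermediate.ideal (order-int X)) (Intermediate.f∈𝔣 (order-int X)) (Intermediate.𝔣⊆ (order-int X))
            (proj₂ (positioned X))

    pos-mono : ∀ {X Y} → X ≤ₗ Y → pos X ≥² pos Y
    pos-mono {X} {Y} X≤Y = valuations-≥ {conductor-generator X} {conductor-generator Y}
        (proj₂ (positioned X)) (proj₂ (positioned Y))
      (local-⊆⇒∥ (order-int X) (order-int Y)
        (localize-reflects (order-isLattice (OverOrder.isOrder Y)) X≤Y))

    pos-cancel : ∀ {X Y} → pos X ≥² pos Y → X ≤ₗ Y
    pos-cancel {X} {Y} (p , q) = localize-mono
      (∥⇒local-⊆ (order-int X) (order-int Y)
        (divides-multiple prime₁ prime₂ π₁∤π₂ π₂∤π₁ ℓ∥π₁π₂ {conductor-generator X} {conductor-generator Y}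
          (Intermediate.f∈ (order-int X)) (Intermediate.f≉0 (order-int X)) (Intermediate.f∈ (order-int Y))
              (Intermediate.f≉0 (order-int Y))
          (proj₁ (proj₂ (positioned X))) (proj₂ (proj₂ (positioned X)))
          (proj₁ (proj₂ (positioned Y))) (proj₂ (proj₂ (positioned Y))) p q))

    pos-cong : ∀ {X Y} → X ≈ₗ Y → pos X ≡ pos Y
    pos-cong {X} {Y} (p , q) = ≥²-antisym (pos-mono {X} {Y} p) (pos-mono {Y} {X} q)

    pos-injective : ∀ {X Y} → pos X ≡ pos Y → X ≈ₗ Y
    pos-injective {X} {Y} e = pos-cancel {X} {Y} (≡.subst (pos X ≥²_) e refl²) , pos-cancel {Y} {X}
        (≡.subst (_≥² pos X) e refl²)
      where
      refl² : pos X ≥² pos X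
      refl² = ℕ.≤-refl , ℕ.≤-refl

    intermediate-overorder : ∀ {R} → Intermediate R → OverOrder K₀
    intermediate-overorder {R} R-int = record
      { order = R
      ; isOrder = intermediate-isOrder R-int
      ; contains = Intermediate.contains R-int
      }

    -- The standard order of π₁ ^ a π₂ ^ b has the required position. The generator chosen for its 𝔣
    -- may differ from this product, but the two divide each other.
    pos-surjective : ∀ n → ∃[ X ] pos X ≡ n
    pos-surjective (a , b) = X , ≥²-antisym
        (valuations-≥ {conductor-generator X} {f} (proj₂ (positioned X)) vf
            (∥⇒∥1* {conductor-generator X} {f} (standard-𝔣⊆ f∈ f≉0 (Intermediate.f∈𝔣 (order-int X)))))
        (valuations-≥ {f} {conductor-generator X} vf (proj₂ (positioned X))
            (∥⇒∥1* {f} {conductor-generator X} (Intermediate.𝔣⊆ (order-int X) (standard-∈-𝔣 f∈ f≉0))))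
      where
      f = π₁ ^ a * π₂ ^ b

      f∈ : f ∈ 𝒪 K₀
      f∈ = 𝒪₀.has* (π₁.π^∈ a) (π₂.π^∈ b)

      f≉0 : ¬ f ≈ 0#
      f≉0 = *-≉0 (^-≉0 a π₁.π≉0) (^-≉0 b π₂.π≉0)

      X = intermediate-overorder (standard-intermediate f∈ f≉0)

      vf : Valuations f (a , b)
      vf = (π₂ ^ b , π₂.π^∈ b , refl , ∤-power prime₁ π₂.π∈ π₁∤π₂ b)
         , (π₁ ^ a , π₁.π^∈ a , *-comm _ _ , ∤-power prime₂ π₁.π∈ π₂∤π₁ a)

    private
      𝒪₀⊆O : 𝒪 K₀ ⊆ Local O
      𝒪₀⊆O = localize-reflects (order-isLattice O-order) rm

      X-int : Intermediate (saturation O-order 𝒪₀⊆O)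
      X-int = saturation-intermediate O-order 𝒪₀⊆O

      X : OverOrder K₀
      X = intermediate-overorder X-int

      O-additive : IsAdditive O
      O-additive = subringAdditive (IsOrder.isSubring O-order)

      𝔣O-ideal : IsIdeal (𝔣 K₀ O)
      𝔣O-ideal = 𝔣-isIdeal {O} O-additive

    -- `O` ⊆ `saturation` ⊆ `Local O`, and inclusions up to `Local` become inclusions of
    -- localizations.
    localization-X : localize (order X) ≐ localize O
    localization-X = localize-mono proj₂ ,
      localize-mono (local-⊇ (subringAdditive (IsOrder.isSubring (OverOrder.isOrder X)))
        ∘ ⊆-saturation O-order 𝒪₀⊆O)

    pos-unique : ∀ X {g} → g ∈ 𝒪 K₀ → ¬ g ≈ 0# → conductor-generator X ∥ g →
      ∃[ m ] PrimeTo m × g ∥ fromℤ (+ m) * conductor-generator X → Valuations g (pos X)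
    pos-unique X {g} g∈ g≉0 f∥g g∥mf = ≡.subst (Valuations g) n≡pos vg
      where
      n  = proj₁ (valuations g∈ g≉0)
      vg = proj₂ (valuations g∈ g≉0)

      n≡pos : n ≡ pos X
      n≡pos = ≥²-antisym {n} {pos X}
        (valuations-≥ {g} {conductor-generator X} {n} {pos X} vg (proj₂ (positioned X))
            (∥⇒∥1* {g} {conductor-generator X} f∥g))
        (valuations-≥ {conductor-generator X} {g} {pos X} {n} (proj₂ (positioned X)) vg g∥mf)

    -- Let f generate the 𝔣 of the saturation and g that of `O`. Then f ∣ g because 𝔣 of `O` is the
    -- smaller ideal, and g ∣ m f by `saturation-𝔣`; m does not affect valuations at `𝔩₁` and `𝔩₂`.
    valuations-O : HasValuations K₀ 𝔩₁ 𝔩₂ (𝔣 K₀ O) (pos X)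
    valuations-O = hasValuations {𝔣 K₀ O} {g} {pos X} 𝔣O-ideal g∈ 𝔣⊆
        (pos-unique X (proj₂ g∈) g≉0 f∥g (m , m-primeTo , 𝔣⊆ mf∈))
      where
      f = conductor-generator X
      f∈ = Intermediate.f∈𝔣 (order-int X)

      multiplier = saturation-𝔣 O-order 𝒪₀⊆O
      m         = proj₁ multiplier
      m-primeTo = proj₁ (proj₂ multiplier)

      mf∈ : fromℤ (+ m) * f ∈ 𝔣 K₀ O
      mf∈ = proj₂ (proj₂ multiplier) f∈

      -- ℓ divides 0, so a multiplier prime to ℓ is nonzero. Then m f is a nonzero member of 𝔣 of
      -- `O`, as principality requires.
      m≉0 : ¬ fromℤ (+ m) ≈ 0#
      m≉0 = fromℤ-≉0 {+ m} λ e → m-primeTo (≡.subst (ℓ ℕ.∣_) (≡.sym (ℤ.+-injective e)) (ℓ ℕ.∣0))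

      mf≉0 : ¬ fromℤ (+ m) * f ≈ 0#
      mf≉0 = *-≉0 m≉0 (Intermediate.f≉0 (order-int X))

      generated : ∃[ g ] g ∈ 𝔣 K₀ O × 𝔣 K₀ O ⊆ (g ∥_)
      generated = principal (𝔣 K₀ O) 𝔣O-ideal (fromℤ (+ m) * f , mf∈ , mf≉0)

      g = proj₁ generated

      g∈ : g ∈ 𝔣 K₀ O
      g∈ = proj₁ (proj₂ generated)

      𝔣⊆ : 𝔣 K₀ O ⊆ (g ∥_)
      𝔣⊆ = proj₂ (proj₂ generated)

      g≉0 : ¬ g ≈ 0#
      g≉0 g≈0 = let y , _ , e = 𝔣⊆ mf∈ in mf≉0 (trans e (trans (*-congʳ g≈0) (zeroˡ y)))

      f∥g : f ∥ g
      f∥g = Intermediate.𝔣⊆ (order-int X) (𝔣⊆-saturation O-order 𝒪₀⊆O g∈)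

    position : PositionGivenByValuations K₀ ℓ 𝔩₁ 𝔩₂ O
    position = pos , pos-valuations , record
      { isOrderMonomorphism = record
        { isOrderHomomorphism = record { cong = λ {X} {Y} → pos-cong {X} {Y} ; mono = λ {X} {Y} → pos-mono
                {X} {Y} }
        ; injective = λ {X} {Y} → pos-injective {X} {Y}
        ; cancel = λ {X} {Y} → pos-cancel {X} {Y}
        }
      ; surjective = λ n → let X , e = pos-surjective n in X , λ {Z} Z≈X → ≡.trans (pos-cong {Z} {X} Z≈X) e
      } , X , localization-X , valuations-O

lemma10 : (K : CharZeroField) →
    let open CharZeroField K using (fromℤ)
        open FieldTheory K in
    (K₀ : Subset) →
    let open Ideals K₀ in
    IsQuarticCM K₀ → IsPrimitive → ClassNumberOne →
    (ℓ : ℕ) → Prime ℓ →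
    let open Localization ℓ in
    (𝔩₁ 𝔩₂ : Subset) →
    IsPrimeIdeal 𝔩₁ → IsPrimeIdeal 𝔩₂ → HasNorm 𝔩₁ ℓ → HasNorm 𝔩₂ ℓ →
    ¬ (𝔩₁ ≐ 𝔩₂) → multiples (fromℤ (+ ℓ)) (𝒪 K₀) ≐ 𝔩₁ · 𝔩₂ →
    (O : Subset) → IsOrder O → HasLocallyMaximalRM K₀ O →
    PositionGivenByValuations K₀ ℓ 𝔩₁ 𝔩₂ O
lemma10 K K₀ cm _ class1 ℓ ℓ-prime 𝔩₁ 𝔩₂ 𝔩₁-prime 𝔩₂-prime _ _ 𝔩₁≢𝔩₂ ℓ-splits O O-order rm =
  Position.position K ℓ ℓ-prime cm class1 𝔩₁-prime 𝔩₂-prime 𝔩₁≢𝔩₂ ℓ-splits O-order rm
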